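{- Let $p$ be an odd prime, $m\ge3$ odd, $k\ge1$ even with $\gcd(m,k)=1$, and $\lambda$ a fixed nonsquare in $\mathbb{F}_p$. As $(a,b,c)$ runs through $\mathbb{F}_{p^m}^3$, the values of $S(a,b,c)$ and their frequencies are: - $2(p-1)p^m$: $1$; - $(p-1)p^m$: $2(p^m-1)$; - $(p-1)p^{\frac{m+1}{2}}$: $(p^m-1)(p^m-p^{m-1})(p^{m-1}+p^{\frac{m-1}{2}})$; - $-(p-1)p^{\frac{m+1}{2}}$: $(p^m-1)(p^m-p^{m-1})(p^{m-1}-p^{\frac{m-1}{2}})$; - $2(p-1)p^{\frac{m+1}{2}}$: $\frac14(p^m-1)(p^{m-1}+p^{\frac{m-1}{2}})^2$; - $-2(p-1)p^{\frac{m+1}{2}}$: $\frac14(p^m-1)(p^{m-1}-p^{\frac{m-1}{2}})^2$; - $0$: $(p^m-1)\big(p^{2m}+\frac32p^{2(m-1)}-2p^{2m-1}+p^m-\frac12p^{m-1}-1\big)$.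
   Context: $\mathrm{Tr}$ is the trace from $\mathbb{F}_{p^m}$ to $\mathbb{F}_p$ and $\zeta_p=e^{2\pi i/p}$. $S(a,b,c)=\sum_{y\in\mathbb{F}_p^*}\sum_{x\in\mathbb{F}_{p^m}}\big(\zeta_p^{y\,\mathrm{Tr}((a+b)x^2+cx^{p^k+1})}+\zeta_p^{y\,\mathrm{Tr}((a-b)\lambda x^2+c\lambda x^{p^k+1})}\big)$. -}

module Defs where

open import Level using (Level; _⊔_) renaming (suc to lsuc)
open import Algebra.Bundles using (CommutativeRing)
open import Algebra.Apartness.Bundles using (HeytingField; HeytingCommutativeRing)
import Algebra.Properties.Semiring.Exp as Exp
import Algebra.Properties.Semiring.Mult as Mult
import Algebra.Properties.Semiring.Sum as Sum
open import Data.Fin.Base using (Fin; toℕ)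
open import Data.Fin.Properties as Fin using (any?)
open import Data.Integer.Base as ℤ using (ℤ; +_; -[1+_])
open import Data.List.Base using (List; []; _∷_; length)
import Data.List.Membership.Setoid as Membership
import Data.List.Relation.Unary.Unique.Setoid as UniqueList
open import Data.Nat.Base as ℕ using (ℕ; suc; _∸_)
open import Data.Nat.DivMod using (_/_)
open import Data.Product.Base using (∃-syntax; _×_; _,_)
open import Data.Product.Relation.Binary.Pointwise.NonDependent using (_×ₛ_)
open import Data.Rational.Base as ℚ using (ℚ; ½)
open import Function.Bundles using (Inverse; _⇔_)
open import Function.Properties.Inverse using (Inverse⇒Injection) renaming (sym to ↔-sym)
open import Relation.Binary.Bundles using (Setoid)
open import Relation.Binary.Definitions using (Decidable)
open import Relation.Binary.PropositionalEquality using (_≡_)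
import Relation.Binary.PropositionalEquality as ≡
open import Relation.Nullary using (¬_; Dec; yes; no)
open import Relation.Nullary.Decidable using (via-injection)

private
  variable
    a ℓ c ℓ₁ ℓ₂ c′ ℓ₁′ ℓ₂′ : Level

module FieldNotions (K : HeytingField c ℓ₁ ℓ₂) where

  commutativeRing : CommutativeRing c ℓ₁
  commutativeRing = HeytingCommutativeRing.commutativeRing
    (HeytingField.heytingCommutativeRing K)

  open CommutativeRing commutativeRing public
  open Exp semiring public using (_^_)
  open Mult semiring public using () renaming (_×_ to _·_)
  open Sum semiring public using (sum-syntax)

  fromℕ : ℕ → Carrier
  fromℕ n = n · 1#

  fromℤ : ℤ → Carrier
  fromℤ (+ n)    = fromℕ n
  fromℤ -[1+ n ] = - fromℕ (suc n)

  CharacteristicZero : Set ℓ₁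
  CharacteristicZero = ∀ n → fromℕ n ≈ 0# → n ≡ 0

  IsPrimitiveRoot : ℕ → Carrier → Set ℓ₁
  IsPrimitiveRoot n ζ =
    ζ ^ n ≈ 1# × (∀ j → 0 ℕ.< j → j ℕ.< n → ¬ (ζ ^ j ≈ 1#))

record FiniteField c ℓ₁ ℓ₂ (q : ℕ) : Set (lsuc (c ⊔ ℓ₁ ⊔ ℓ₂)) where
  field
    heytingField : HeytingField c ℓ₁ ℓ₂

  open FieldNotions heytingField public

  field
    enumeration : Inverse (≡.setoid (Fin q)) setoid

  element : Fin q → Carrier
  element = Inverse.to enumeration

  infix 4 _≟_
  _≟_ : Decidable _≈_
  _≟_ = via-injection (Inverse⇒Injection (↔-sym enumeration)) Fin._≟_

-- 𝔽_p is the prime subfield { fromℕ j | 0 ≤ j < p } of 𝔽_{p^m}.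
module FiniteFieldNotions
  (p m : ℕ) (F : FiniteField c ℓ₁ ℓ₂ (p ℕ.^ m)) where

  open FiniteField F

  IsNonsquareIn𝔽p : Fin p → Set ℓ₁
  IsNonsquareIn𝔽p u =
    ¬ (∃[ j ] fromℕ (toℕ {p} j) ^ 2 ≈ fromℕ (toℕ u))

  -- The trace, as an element of 𝔽_{p^m} lying in the prime subfield.
  Tr : Carrier → Carrier
  Tr x = ∑[ i < m ] (x ^ (p ℕ.^ toℕ i))

  -- The j < p with fromℕ j ≈ t when t lies in the prime subfield. The value
  -- 0 for other t is a dummy; it is never used below, where t = y Tr(x)
  -- with y in the prime subfield.
  residue : Carrier → ℕ
  residue t with any? (λ (j : Fin p) → fromℕ (toℕ j) ≟ t)
  ... | yes (j , _) = toℕ j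
  ... | no _        = 0

module ExponentialSum
  (p m k : ℕ) (F : FiniteField c ℓ₁ ℓ₂ (p ℕ.^ m)) (u : Fin p)
  (K : HeytingField c′ ℓ₁′ ℓ₂′) (ζ : HeytingField.Carrier K) where

  open FiniteField F hiding (sum-syntax)
  open FiniteFieldNotions p m F
  private module K = FieldNotions K
  open K using (sum-syntax)

  λ₀ : Carrier
  λ₀ = fromℕ (toℕ u)

  -- t ↦ ζ^t on the prime subfield.
  χ : Carrier → K.Carrier
  χ t = ζ K.^ residue t

  -- The outer index i stands for y = i + 1, so that y runs through 𝔽_p^*.
  S : Carrier × Carrier × Carrier → K.Carrier
  S (a , b , c) =
    ∑[ i < p ∸ 1 ] (∑[ n < p ℕ.^ m ] (
      let y = fromℕ (suc (toℕ i))
          x = element n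
      in  χ (y * Tr ((a + b) * x ^ 2 + c * x ^ (p ℕ.^ k ℕ.+ 1)))
          K.+
          χ (y * Tr ((a - b) * λ₀ * x ^ 2 + c * λ₀ * x ^ (p ℕ.^ k ℕ.+ 1)))))

  Triples : Setoid _ _
  Triples = setoid ×ₛ (setoid ×ₛ setoid)

  TakesValue : ℤ → Carrier × Carrier × Carrier → Set ℓ₁′
  TakesValue v t = S t K.≈ K.fromℤ v

HasCardinality : (A : Setoid a ℓ) → (Setoid.Carrier A → Set ℓ₁) → ℕ → Set _
HasCardinality A P n =
  ∃[ xs ] Unique xs × (∀ x → x ∈ xs ⇔ P x) × length xs ≡ n
  where
  open UniqueList A using (Unique)
  open Membership A using (_∈_)

-- The frequencies are rational expressions, hence the comparison in ℚ.
HasFrequency : (A : Setoid a ℓ) → (Setoid.Carrier A → Set ℓ₁) → ℚ → Set _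
HasFrequency A P f = ∃[ n ] HasCardinality A P n × (+ n) ℚ./ 1 ≡ f

-- Pairs (value , frequency). For m odd the divisions by 2 in the exponents
-- are exact.
distribution : (p m : ℕ) → List (ℤ × ℚ)
distribution p m =
    (v₂ , one)
  ∷ (v₁ , two ℚ.* (P m ℚ.- one))
  ∷ (w₁ , (P m ℚ.- one) ℚ.* (P m ℚ.- P (m ∸ 1)) ℚ.* (P (m ∸ 1) ℚ.+ P h))
  ∷ (ℤ.- w₁ , (P m ℚ.- one) ℚ.* (P m ℚ.- P (m ∸ 1)) ℚ.* (P (m ∸ 1) ℚ.- P h))
  ∷ (w₂ , ¼ ℚ.* (P m ℚ.- one) ℚ.* sq (P (m ∸ 1) ℚ.+ P h))
  ∷ (ℤ.- w₂ , ¼ ℚ.* (P m ℚ.- one) ℚ.* sq (P (m ∸ 1) ℚ.- P h))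
  ∷ (+ 0 , (P m ℚ.- one) ℚ.*
       (P (2 ℕ.* m) ℚ.+ three/2 ℚ.* P (2 ℕ.* (m ∸ 1)) ℚ.- two ℚ.* P (2 ℕ.* m ∸ 1)
         ℚ.+ P m ℚ.- ½ ℚ.* P (m ∸ 1) ℚ.- one))
  ∷ []
  where
  h : ℕ
  h = (m ∸ 1) / 2

  v₁ v₂ w₁ w₂ : ℤ
  v₁ = (+ p ℤ.- + 1) ℤ.* + (p ℕ.^ m)
  v₂ = + 2 ℤ.* (+ p ℤ.- + 1) ℤ.* + (p ℕ.^ m)
  w₁ = (+ p ℤ.- + 1) ℤ.* + (p ℕ.^ ((m ℕ.+ 1) / 2))
  w₂ = + 2 ℤ.* (+ p ℤ.- + 1) ℤ.* + (p ℕ.^ ((m ℕ.+ 1) / 2))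

  one two ¼ three/2 : ℚ
  one     = + 1 ℚ./ 1
  two     = + 2 ℚ./ 1
  ¼       = + 1 ℚ./ 4
  three/2 = + 3 ℚ./ 2

  P : ℕ → ℚ
  P e = + (p ℕ.^ e) ℚ./ 1

  sq : ℚ → ℚ
  sq x = x ℚ.* x

{-# OPTIONS --safe #-}
module Submission where

-- Put e(t) = p[t = 0] − 1, the sum of ζ^(yt) over y ∈ 𝔽p*, and
-- T(α,c) = Σ_x e(Q(x)) for the quadratic form Q(x) = Tr(α x² + c x^(p^k+1)).
-- Then S(a,b,c) = T(a+b,c) + T(a−b,c), since e(λt) = e(t), and
-- (a,b) ↦ (a+b,a−b) is a bijection; so only the distribution of α ↦ T(α,c)
-- for fixed c is needed, and no Gauss sum is evaluated.
--
-- Values. With N_j = #{x : Q(x) = j}, which depends only on the square class of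
-- j, put a = N_0 − (N_1 + N_λ)/2 and b = (N_1 − N_λ)/2. Counting the pairs with
-- Q(x) = Q(x′) gives T = (p−1) a and a² + p b² = p^m |R|, where R is the radical
-- of Q. Descent shows a = 0 or b = 0. For c ≠ 0, R is the solution space of a
-- recurrence of order two for the automorphism σ = (x ↦ x^(p^k)), whose fixed
-- field is 𝔽p, so |R| ∈ {1, p, p²}; as m is odd, T ∈ {0, ± (p−1) p^((m+1)/2)}.
--
-- Frequencies. Σ_α T(α,c) = (p−1) p^m and Σ_α T(α,c)² = (p−1)² p^(2m) for every
-- c: in the second sum only pairs with x² + y x′² = 0, y ∈ 𝔽p*, survive, and
-- these satisfy x / x′ ∈ 𝔽p. The two moments determine how often each value occurs.

open import Algebra.Apartness.Bundles using (HeytingField)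
open import Algebra.Bundles using (CommutativeRing)
open import Algebra.Bundles.Raw using (RawRing)
import Algebra.Morphism.RingMonomorphism as RingMonomorphism
open import Algebra.Morphism.Structures using (IsRingMonomorphism)
import Algebra.Properties.CommutativeMonoid.Sum as MonoidSum
import Algebra.Properties.CommutativeSemiring.Binomial as Binomial
import Algebra.Properties.Group as GroupProperties
import Algebra.Properties.Ring as RingProperties
import Algebra.Properties.Semiring.Exp as Exp
import Algebra.Properties.Semiring.Mult as Mult
import Algebra.Properties.Semiring.Sum as Sum
import Algebra.Solver.Ring as RingSolver
open import Algebra.Solver.Ring.AlmostCommutativeRing using (fromCommutativeRing; _-Raw-AlmostCommutative⟶_)
open import Algebra.Structures using (IsCommutativeRing)
open import Data.Fin.Base as Fin using (Fin; zero; suc; toℕ)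
import Data.Fin.Permutation as Permutation
import Data.Fin.Properties as Fin
open import Data.Integer.Base as ℤ using (ℤ; +_; -[1+_])
import Data.Integer.Properties as ℤ
import Data.Integer.Tactic.RingSolver as ℤ-Solver
open import Data.List.Base as List using (List; []; _∷_; allFin; cartesianProduct; filter; length)
open import Data.List.Membership.Propositional.Properties using (∈-allFin; ∈-cartesianProduct⁺; ∈-filter⁺; ∈-filter⁻)
open import Data.List.Membership.Setoid.Properties using (∈-map⁺; ∈-map⁻; ∈-resp-≈)
open import Data.List.Properties using (length-map)
open import Data.List.Relation.Unary.All as All using (All; []; _∷_)
open import Data.List.Relation.Unary.Any as Any using (Any; here; there)
open import Data.List.Relation.Unary.Unique.Propositional using (Unique)
open import Data.List.Relation.Unary.Unique.Propositional.Properties using (allFin⁺; cartesianProduct⁺; filter⁺)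
open import Data.List.Relation.Unary.Unique.Setoid.Properties using (map⁺)
open import Data.Maybe.Base using (just; nothing)
open import Data.Nat.Base as ℕ using (ℕ; zero; suc)
open import Data.Nat.Combinatorics using (_C_; nCn≡1; nCk≡n!/k![n-k]!; k![n∸k]!∣n!)
open import Data.Nat.Coprimality using (coprime-Bézout; prime⇒coprime; gcd≡1⇒coprime)
open import Data.Nat.DivMod using (m/n*n≡m; m*n/n≡m; _/_; _%_; m≡m%n+[m/n]*n; m%n<n)
open import Data.Nat.Divisibility as ℕ using (_∣_; _∤_)
open import Data.Nat.GCD using (gcd; module Bézout)
open import Data.Nat.Primality using (Prime; euclidsLemma; prime⇒nonZero; prime⇒nonTrivial)
import Data.Nat.Properties as ℕ
import Data.Nat.Tactic.RingSolver as ℕ-Solver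
open import Data.Product.Base using (∃-syntax; _×_; _,_; proj₁; proj₂)
open import Data.Rational.Base as ℚ using (ℚ; ½)
import Data.Rational.Properties as ℚ
open import Data.Rational.Solver using () renaming (module +-*-Solver to ℚ-Solver)
import Data.Rational.Unnormalised.Base as ℚᵘ
import Data.Rational.Unnormalised.Properties as ℚᵘ
open import Data.Sum.Base as ⊎ using (_⊎_; inj₁; inj₂)
open import Function.Base using (_∘_; id; _$_)
open import Function.Bundles using (Equivalence; Inverse; _⇔_; mk⇔)
open import Level using (Level)
open import Relation.Binary.Bundles using (Setoid)
open import Relation.Binary.Definitions using (WeaklyDecidable; tri<; tri≈; tri>)
import Relation.Binary.PropositionalEquality as ≡
open import Relation.Binary.PropositionalEquality using (_≡_; _≢_; cong; cong₂; subst; module ≡-Reasoning)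
open import Relation.Nullary using (¬_; Dec; yes; no; contradiction; ¬?; _×-dec_; _⊎-dec_)
open import Relation.Unary using (Decidable)
open import Defs

-- Summing over y turns the character values into rational integers. Everything before the final
-- evaluation therefore happens in ℤ; K returns only through `characterSum` and the injectivity of ℤ
-- → K in characteristic zero. Write |R| = p^d. In a² + p b² = p^(m+d) the descent exchanges the
-- roles of a and b at each division by p. If b = 0, then a² = p^(m+d), so m + d is even, d = 1 and
-- a = ± p^((m+1)/2); if a = 0, then T = 0. Oddness of m also carries the second moment: a square
-- root in 𝔽q of an element of 𝔽p has degree at most 2 over 𝔽p, hence lies in 𝔽p. For c = 0 and α ≠
-- 0 the radical is trivial and T = 0, so T(0,0) = (p-1) p^m is the only exceptional value. In units
-- of w = (p-1) p^((m+1)/2) it equals H = p^((m-1)/2), and for c ≠ 0 the two moments say n₊ - n₋ = H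
-- and n₊ + n₋ = H² for the numbers of α with T = w and T = -w. The distribution of S is the sum
-- over c of the self-convolution of that of T(·,c). A test function G is carried along, so that one
-- formula serves all seven values.

private
  variable
    c ℓ : Level

-- Integer coefficients in a commutative ring

module IntegerImage (R : CommutativeRing c ℓ) where

  open CommutativeRing R
  open Mult semiring renaming (_×_ to _·_)
  open import Algebra.Properties.Ring ring
    using (-0#≈0#; -‿involutive; -‿distribˡ-*; -‿distribʳ-*; -‿+-comm)
  open import Relation.Binary.Reasoning.Setoid setoid

  ⟦_⟧ : ℤ → Carrier
  ⟦ + n ⟧      = n · 1#
  ⟦ -[1+ n ] ⟧ = - (suc n · 1#)

  +-cancel-common : ∀ x y z → (x + y) - (x + z) ≈ y - z
  +-cancel-common x y z = begin
    (x + y) - (x + z) ≈⟨ +-congˡ (-‿+-comm x z) ⟨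
    (x + y) + (- x - z) ≈⟨ +-congʳ (+-comm x y) ⟩
    (y + x) + (- x - z) ≈⟨ +-assoc y x _ ⟩
    y + (x + (- x - z)) ≈⟨ +-congˡ (+-assoc x (- x) (- z)) ⟨
    y + ((x - x) - z) ≈⟨ +-congˡ (+-congʳ (-‿inverseʳ x)) ⟩
    y + (0# - z) ≈⟨ +-congˡ (+-identityˡ (- z)) ⟩
    y - z ∎

  ⟦⊖⟧ : ∀ m n → ⟦ m ℤ.⊖ n ⟧ ≈ m · 1# - n · 1#
  ⟦⊖⟧ m zero = begin
    ⟦ m ℤ.⊖ 0 ⟧ ≡⟨ cong ⟦_⟧ (ℤ.⊖-≥ {m} ℕ.z≤n) ⟩
    m · 1# ≈⟨ +-identityʳ _ ⟨
    m · 1# + 0# ≈⟨ +-congˡ -0#≈0# ⟨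
    m · 1# - 0# ∎
  ⟦⊖⟧ zero (suc n) = sym (+-identityˡ _)
  ⟦⊖⟧ (suc m) (suc n) = begin
    ⟦ suc m ℤ.⊖ suc n ⟧ ≡⟨ cong ⟦_⟧ (ℤ.[1+m]⊖[1+n]≡m⊖n m n) ⟩
    ⟦ m ℤ.⊖ n ⟧ ≈⟨ ⟦⊖⟧ m n ⟩
    m · 1# - n · 1# ≈⟨ +-cancel-common 1# _ _ ⟨
    suc m · 1# - suc n · 1# ∎

  ⟦⟧-+ : ∀ i j → ⟦ i ℤ.+ j ⟧ ≈ ⟦ i ⟧ + ⟦ j ⟧
  ⟦⟧-+ (+ m)    (+ n)    = ×-homo-+ 1# m n
  ⟦⟧-+ (+ m)    -[1+ n ] = ⟦⊖⟧ m (suc n)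
  ⟦⟧-+ -[1+ m ] (+ n)    = trans (⟦⊖⟧ n (suc m)) (+-comm _ _)
  ⟦⟧-+ -[1+ m ] -[1+ n ] = begin
    - (suc (suc (m ℕ.+ n)) · 1#) ≡⟨ cong (λ z → - (z · 1#)) (≡.sym (ℕ.+-suc (suc m) n)) ⟩
    - ((suc m ℕ.+ suc n) · 1#) ≈⟨ -‿cong (×-homo-+ 1# (suc m) (suc n)) ⟩
    - (suc m · 1# + suc n · 1#) ≈⟨ -‿+-comm _ _ ⟨
    - (suc m · 1#) - suc n · 1# ∎

  ⟦⟧-neg : ∀ i → ⟦ ℤ.- i ⟧ ≈ - ⟦ i ⟧
  ⟦⟧-neg (+ zero)  = sym -0#≈0#
  ⟦⟧-neg (+ suc n) = refl
  ⟦⟧-neg -[1+ n ]  = sym (-‿involutive _)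

  ⟦⟧-*⁺ : ∀ m j → ⟦ + m ℤ.* j ⟧ ≈ ⟦ + m ⟧ * ⟦ j ⟧
  ⟦⟧-*⁺ m (+ n)    = trans (reflexive (cong ⟦_⟧ (≡.sym (ℤ.pos-* m n)))) (×1-homo-* m n)
  ⟦⟧-*⁺ m -[1+ n ] = begin
    ⟦ + m ℤ.* ℤ.- (+ suc n) ⟧ ≡⟨ cong ⟦_⟧ (ℤ.neg-distribʳ-* (+ m) (+ suc n)) ⟨
    ⟦ ℤ.- (+ m ℤ.* + suc n) ⟧ ≈⟨ ⟦⟧-neg (+ m ℤ.* + suc n) ⟩
    - ⟦ + m ℤ.* + suc n ⟧ ≈⟨ -‿cong (⟦⟧-*⁺ m (+ suc n)) ⟩
    - (⟦ + m ⟧ * ⟦ + suc n ⟧) ≈⟨ -‿distribʳ-* _ _ ⟩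
    ⟦ + m ⟧ * ⟦ -[1+ n ] ⟧ ∎

  ⟦⟧-* : ∀ i j → ⟦ i ℤ.* j ⟧ ≈ ⟦ i ⟧ * ⟦ j ⟧
  ⟦⟧-* (+ m)    j = ⟦⟧-*⁺ m j
  ⟦⟧-* -[1+ m ] j = begin
    ⟦ ℤ.- (+ suc m) ℤ.* j ⟧ ≡⟨ cong ⟦_⟧ (ℤ.neg-distribˡ-* (+ suc m) j) ⟨
    ⟦ ℤ.- (+ suc m ℤ.* j) ⟧ ≈⟨ ⟦⟧-neg (+ suc m ℤ.* j) ⟩
    - ⟦ + suc m ℤ.* j ⟧ ≈⟨ -‿cong (⟦⟧-*⁺ (suc m) j) ⟩
    - (⟦ + suc m ⟧ * ⟦ j ⟧) ≈⟨ -‿distribˡ-* _ _ ⟩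
    ⟦ -[1+ m ] ⟧ * ⟦ j ⟧ ∎

  ⟦⟧-morphism : ℤ.+-*-rawRing -Raw-AlmostCommutative⟶ fromCommutativeRing R
  ⟦⟧-morphism = record
    { ⟦_⟧    = ⟦_⟧
    ; +-homo = ⟦⟧-+
    ; *-homo = ⟦⟧-*
    ; -‿homo = ⟦⟧-neg
    ; 0-homo = refl
    ; 1-homo = +-identityʳ 1#
    }

  private
    -- Distinct integers may agree in R when the characteristic is positive; the solver asks only
    -- for a sound test, so comparing them in ℤ is enough.
    coefficientEquality : WeaklyDecidable (λ i j → ⟦ i ⟧ ≈ ⟦ j ⟧)
    coefficientEquality i j with i ℤ.≟ j
    ... | yes i≡j = just (reflexive (cong ⟦_⟧ i≡j))
    ... | no  _   = nothing

  module Solver =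
    RingSolver ℤ.+-*-rawRing (fromCommutativeRing R) ⟦⟧-morphism coefficientEquality

  sum-const : ∀ n x → Sum.sum semiring {n} (λ _ → x) ≈ n · 1# * x
  sum-const n x = begin
    Sum.sum semiring {n} (λ _ → x) ≈⟨ Sum.sum-replicate semiring n ⟩
    n · x ≈⟨ ×-congʳ n (*-identityˡ x) ⟨
    n · (1# * x) ≈⟨ ×-assoc-* n 1# x ⟨
    n · 1# * x ∎

-- Divisibility of binomial coefficients by a prime

prime>1 : ∀ {p} → Prime p → 1 ℕ.< p
prime>1 p-prime = ℕ.nonTrivial⇒n>1 _ {{prime⇒nonTrivial p-prime}}

prime∤! : ∀ {p} → Prime p → ∀ j → j ℕ.< p → p ∤ j ℕ.!
prime∤! p-prime zero    j<p p∣1 =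
  ℕ.>⇒∤ (prime>1 p-prime) p∣1
prime∤! p-prime (suc j) j<p p∣j! with euclidsLemma (suc j) (j ℕ.!) p-prime p∣j!
... | inj₁ p∣j = ℕ.>⇒∤ j<p p∣j
... | inj₂ p∣! = prime∤! p-prime j (ℕ.<-trans (ℕ.n<1+n j) j<p) p∣!

-- p divides p! = C(p,k) k! (p-k)!, but neither factorial, as all their factors are below p.
prime∣choose : ∀ {p} → Prime p → ∀ k → 0 ℕ.< k → k ℕ.< p → p ∣ p C k
prime∣choose {p} p-prime k 0<k k<p with euclidsLemma (p C k) (k ℕ.! ℕ.* (p ℕ.∸ k) ℕ.!) p-prime p∣product
  where
  instance _ = k ℕ.!* (p ℕ.∸ k) !≢0

  product≡p! : (p C k) ℕ.* (k ℕ.! ℕ.* (p ℕ.∸ k) ℕ.!) ≡ p ℕ.!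
  product≡p! = ≡.trans (cong (ℕ._* (k ℕ.! ℕ.* (p ℕ.∸ k) ℕ.!)) (nCk≡n!/k![n-k]! (ℕ.<⇒≤ k<p)))
                       (m/n*n≡m (k![n∸k]!∣n! (ℕ.<⇒≤ k<p)))

  n∣n! : ∀ n → 0 ℕ.< n → n ∣ n ℕ.!
  n∣n! (suc n) _ = ℕ.m∣m*n (n ℕ.!)

  p∣product : p ∣ (p C k) ℕ.* (k ℕ.! ℕ.* (p ℕ.∸ k) ℕ.!)
  p∣product = subst (p ∣_) (≡.sym product≡p!) (n∣n! p (ℕ.<-trans 0<k k<p))
... | inj₁ p∣C = p∣C
... | inj₂ p∣rest with euclidsLemma (k ℕ.!) ((p ℕ.∸ k) ℕ.!) p-prime p∣rest
...   | inj₁ p∣k! = contradiction p∣k! (prime∤! p-prime k k<p)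
...   | inj₂ p∣!  = contradiction p∣! (prime∤! p-prime (p ℕ.∸ k) (ℕ.∸-monoʳ-< 0<k (ℕ.<⇒≤ k<p)))

-- Finite fields on `Fin q`

-- Transporting the field along its enumeration replaces ≈ by ≡.
record FieldOn (q : ℕ) : Set where
  infixl 6 _+_
  infixl 7 _*_
  infix  8 -_
  field
    _+_ _*_           : Fin q → Fin q → Fin q
    -_                : Fin q → Fin q
    0# 1#             : Fin q
    isCommutativeRing : IsCommutativeRing _≡_ _+_ _*_ -_ 0# 1#
    inverse           : ∀ x → x ≢ 0# → ∃[ y ] x * y ≡ 1#
    1≢0               : 1# ≢ 0#

  commutativeRing : CommutativeRing _ _
  commutativeRing = record { isCommutativeRing = isCommutativeRing }

module Field {q : ℕ} (𝔽 : FieldOn q) where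

  open FieldOn 𝔽 public using (inverse; 1≢0)
  open CommutativeRing (FieldOn.commutativeRing 𝔽) public
    using ( _+_; _*_; -_; _-_; 0#; 1#; +-assoc; +-comm; +-identityˡ; +-identityʳ; -‿inverseʳ; -‿inverseˡ
          ; *-assoc; *-comm; *-identityˡ; *-identityʳ; distribˡ; distribʳ; zeroˡ; zeroʳ
          ; semiring; ring; +-commutativeMonoid; *-commutativeMonoid; +-group; commutativeSemiring)
  open Exp semiring public
    using (_^_; ^-homo-*; ^-assocʳ)
  open import Algebra.Properties.CommutativeSemiring.Exp commutativeSemiring public using (^-distrib-*)
  open Mult semiring public using (×1-homo-*; ×-homo-+) renaming (_×_ to _·_)
  open IntegerImage (FieldOn.commutativeRing 𝔽) public using (⟦_⟧; ⟦⟧-+; ⟦⟧-*; ⟦⟧-neg; sum-const)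
  open IntegerImage.Solver (FieldOn.commutativeRing 𝔽) public
    using (solve; _:=_; con; _:+_; _:*_; _:-_; :-_; _:^_)
  open ≡-Reasoning

  private
    A = Fin q

  infix 4 _≟_
  _≟_ : (x y : A) → Dec (x ≡ y)
  _≟_ = Fin._≟_

  +-cancelˡ : ∀ x {y z} → x + y ≡ x + z → y ≡ z
  +-cancelˡ x {y} {z} = GroupProperties.∙-cancelˡ +-group x y z

  x-y≡0⇒x≡y : ∀ {x y} → x - y ≡ 0# → x ≡ y
  x-y≡0⇒x≡y {x} {y} = RingProperties.x∙y⁻¹≈ε⇒x≈y ring x y

  *-nonzeroˡ : ∀ {x y} → x * y ≡ 0# → x ≢ 0# → y ≡ 0#
  *-nonzeroˡ {x} {y} xy≡0 x≢0 = let (x⁻¹ , xx⁻¹≡1) = inverse x x≢0 in begin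
    y ≡⟨ *-identityˡ y ⟨
    1# * y ≡⟨ cong (_* y) xx⁻¹≡1 ⟨
    x * x⁻¹ * y ≡⟨ solve 3 (λ x i y → x :* i :* y := i :* (x :* y)) ≡.refl x x⁻¹ y ⟩
    x⁻¹ * (x * y) ≡⟨ cong (x⁻¹ *_) xy≡0 ⟩
    x⁻¹ * 0# ≡⟨ zeroʳ x⁻¹ ⟩
    0# ∎

  *-nonzero : ∀ {x y} → x ≢ 0# → y ≢ 0# → x * y ≢ 0#
  *-nonzero x≢0 y≢0 xy≡0 = y≢0 (*-nonzeroˡ xy≡0 x≢0)

  *-cancelˡ : ∀ {x y z} → x ≢ 0# → x * y ≡ x * z → y ≡ z
  *-cancelˡ {x} {y} {z} x≢0 xy≡xz = x-y≡0⇒x≡y (*-nonzeroˡ (begin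
    x * (y - z) ≡⟨ solve 3 (λ x y z → x :* (y :- z) := x :* y :- x :* z) ≡.refl x y z ⟩
    x * y - x * z ≡⟨ cong (_- x * z) xy≡xz ⟩
    x * z - x * z ≡⟨ -‿inverseʳ (x * z) ⟩
    0# ∎) x≢0)

  ^-nonzero : ∀ {x} n → x ≢ 0# → x ^ n ≢ 0#
  ^-nonzero zero    x≢0 = 1≢0
  ^-nonzero (suc n) x≢0 = *-nonzero x≢0 (^-nonzero n x≢0)

  1^n≡1 : ∀ n → 1# ^ n ≡ 1#
  1^n≡1 zero    = ≡.refl
  1^n≡1 (suc n) = ≡.trans (*-identityˡ _) (1^n≡1 n)

  0^n≡0 : ∀ n → 0 ℕ.< n → 0# ^ n ≡ 0#
  0^n≡0 (suc n) _ = zeroˡ (0# ^ n)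

  bijection : (φ ψ : A → A) → (∀ x → φ (ψ x) ≡ x) → (∀ x → ψ (φ x) ≡ x) → Permutation.Permutation′ q
  bijection = Permutation.permutation

  translation : A → Permutation.Permutation′ q
  translation a = bijection (_+ a) (_- a)
    (λ x → solve 2 (λ x a → x :- a :+ a := x) ≡.refl x a)
    (λ x → solve 2 (λ x a → x :+ a :- a := x) ≡.refl x a)

  dilation : ∀ a → a ≢ 0# → Permutation.Permutation′ q
  dilation a a≢0 = let (a⁻¹ , aa⁻¹≡1) = inverse a a≢0 in bijection (a *_) (a⁻¹ *_)
    (λ x → ≡.trans (≡.sym (*-assoc a a⁻¹ x)) (≡.trans (cong (_* x) aa⁻¹≡1) (*-identityˡ x)))
    (λ x → ≡.trans (≡.sym (*-assoc a⁻¹ a x))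
             (≡.trans (cong (_* x) (≡.trans (*-comm a⁻¹ a) aa⁻¹≡1)) (*-identityˡ x)))

  -- The translation x ↦ x + 1 permutes the field, so it preserves the sum of all elements, yet it
  -- adds `q · 1#` to that sum.
  q·1≡0 : q · 1# ≡ 0#
  q·1≡0 = +-cancelˡ (sum id) (begin
    sum id + q · 1# ≡⟨ cong (λ z → sum id + z) (≡.trans (sum-const q 1#) (*-identityʳ _)) ⟨
    sum id + sum {q} (λ _ → 1#) ≡⟨ ∑-distrib-+ id (λ _ → 1#) ⟨
    sum {q} (λ x → x + 1#) ≡⟨ sum-permute id (translation 1#) ⟨
    sum id ≡⟨ +-identityʳ _ ⟨
    sum id + 0# ∎)
    where open Sum semiring

  -- Multiplication by a permutes the nonzero elements; 0 is given the factor 1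
  -- in the product, so that the missing factor a is contributed by x = 0.
  x^q≡x : ∀ x → x ^ q ≡ x
  x^q≡x a with a ≟ 0#
  ... | yes ≡.refl = 0^n≡0 q (ℕ.≤-trans (ℕ.s≤s ℕ.z≤n) (Fin.toℕ<n 0#))
  ... | no a≢0     = *-cancelˡ Πg≢0 (begin
    Π g * a ^ q ≡⟨ cong (Π g *_) (sum-replicate q) ⟨
    Π g * Π {q} (λ _ → a) ≡⟨ ∑-distrib-+ g (λ _ → a) ⟨
    Π (λ x → g x * a) ≡⟨ sum-cong-≗ step ⟩
    Π (λ x → g (a * x) * δ x) ≡⟨ ∑-distrib-+ (λ x → g (a * x)) δ ⟩
    Π (λ x → g (a * x)) * Π δ ≡⟨ cong₂ _*_ (≡.sym (sum-permute g (dilation a a≢0))) Πδ≡a ⟩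
    Π g * a ∎)
    where
    open MonoidSum *-commutativeMonoid renaming (sum to Π)

    g δ : A → A
    g x with x ≟ 0#
    ... | yes _ = 1#
    ... | no _  = x
    δ x with x ≟ 0#
    ... | yes _ = a
    ... | no _  = 1#

    step : ∀ x → g x * a ≡ g (a * x) * δ x
    step x with x ≟ 0# | a * x ≟ 0#
    ... | yes _      | yes _    = ≡.refl
    ... | yes ≡.refl | no ax≢0  = contradiction (zeroʳ a) ax≢0
    ... | no x≢0     | yes ax≡0 = contradiction ax≡0 (*-nonzero a≢0 x≢0)
    ... | no x≢0     | no _     = ≡.trans (*-comm x a) (≡.sym (*-identityʳ _))

    Π≢0 : ∀ n (f : Fin n → A) → (∀ i → f i ≢ 0#) → Π f ≢ 0#
    Π≢0 zero    f f≢0 = 1≢0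
    Π≢0 (suc n) f f≢0 = *-nonzero (f≢0 zero) (Π≢0 n (f ∘ suc) (f≢0 ∘ suc))

    Πg≢0 : Π g ≢ 0#
    Πg≢0 = Π≢0 q g g≢0
      where
      g≢0 : ∀ x → g x ≢ 0#
      g≢0 x with x ≟ 0#
      ... | yes _   = 1≢0
      ... | no x≢0  = x≢0

    δ-zero : δ 0# ≡ a
    δ-zero with 0# ≟ 0#
    ... | yes _  = ≡.refl
    ... | no 0≢0 = contradiction ≡.refl 0≢0

    δ-nonzero : ∀ x → x ≢ 0# → δ x ≡ 1#
    δ-nonzero x x≢0 with x ≟ 0#
    ... | yes x≡0 = contradiction x≡0 x≢0
    ... | no _    = ≡.refl

    Π-single : ∀ n (o : Fin n) (f : Fin n → A) → f o ≡ a → (∀ x → x ≢ o → f x ≡ 1#) → Π f ≡ a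
    Π-single (suc n) zero f fo≡a f≡1 = begin
      f zero * Π (f ∘ suc) ≡⟨ cong₂ _*_ fo≡a (sum-cong-≗ (λ i → f≡1 (suc i) λ ())) ⟩
      a * Π {n} (λ _ → 1#) ≡⟨ cong (a *_) (sum-replicate-zero n) ⟩
      a * 1# ≡⟨ *-identityʳ a ⟩
      a ∎
    Π-single (suc n) (suc o) f fo≡a f≡1 = begin
      f zero * Π (f ∘ suc) ≡⟨ cong₂ _*_ (f≡1 zero λ ()) (Π-single n o (f ∘ suc) fo≡a λ x x≢o → f≡1 (suc x) (x≢o ∘ Fin.suc-injective)) ⟩
      1# * a ≡⟨ *-identityˡ a ⟩
      a ∎

    Πδ≡a : Π δ ≡ a
    Πδ≡a = Π-single q 0# δ δ-zero δ-nonzero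

  -- Polynomial functions and their roots

  -- IsPolynomial n l f: f is a polynomial function of formal degree at most n
  -- whose coefficient of degree n is l.
  data IsPolynomial : ℕ → A → (A → A) → Set where
    constant : ∀ {l f} → (∀ x → f x ≡ l) → IsPolynomial 0 l f
    horner   : ∀ {n l f g} a → IsPolynomial n l g → (∀ x → f x ≡ a + x * g x) → IsPolynomial (suc n) l f

  polynomial-+ : ∀ {n l l′ f g} → IsPolynomial n l f → IsPolynomial n l′ g →
                 IsPolynomial n (l + l′) (λ x → f x + g x)
  polynomial-+ (constant f≡) (constant g≡) = constant λ x → cong₂ _+_ (f≡ x) (g≡ x)
  polynomial-+ (horner {g = f₁} a F f≡) (horner {g = g₁} b G g≡) =
    horner (a + b) (polynomial-+ F G) λ x → ≡.trans (cong₂ _+_ (f≡ x) (g≡ x))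
      (solve 5 (λ a b x u v → a :+ x :* u :+ (b :+ x :* v) := a :+ b :+ x :* (u :+ v)) ≡.refl a b x (f₁ x) (g₁ x))

  polynomial-* : ∀ {n l f} r → IsPolynomial n l f → IsPolynomial n (r * l) (λ x → r * f x)
  polynomial-* r (constant f≡) = constant λ x → cong (r *_) (f≡ x)
  polynomial-* r (horner {g = g} a G f≡) = horner (r * a) (polynomial-* r G) λ x →
    ≡.trans (cong (r *_) (f≡ x))
      (solve 4 (λ r a x u → r :* (a :+ x :* u) := r :* a :+ x :* (r :* u)) ≡.refl r a x (g x))

  polynomial-raise : ∀ {n l f} → IsPolynomial n l f → IsPolynomial (suc n) 0# f
  polynomial-raise {l = l} (constant f≡) = horner l (constant λ _ → ≡.refl) λ x →
    ≡.trans (f≡ x) (solve 2 (λ l x → l := l :+ x :* con (+ 0)) ≡.refl l x)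
  polynomial-raise (horner a G f≡) = horner a (polynomial-raise G) f≡

  polynomial-lower : ∀ {n n′ l f} → n ℕ.< n′ → IsPolynomial n l f → IsPolynomial n′ 0# f
  polynomial-lower {n} {suc n′} {l} {f} (ℕ.s≤s n≤n′) F with ℕ.m≤n⇒m<n∨m≡n n≤n′
  ... | inj₁ n<n′   = polynomial-raise (polynomial-lower n<n′ F)
  ... | inj₂ ≡.refl = polynomial-raise F

  polynomial-^ : ∀ n → IsPolynomial n 1# (_^ n)
  polynomial-^ zero    = constant λ _ → ≡.refl
  polynomial-^ (suc n) = horner 0# (polynomial-^ n) λ x → ≡.sym (+-identityˡ _)

  -- For f x = a + x g x the difference f x - f r is (x - r) g x + r (g x - g r), and induction
  -- factors the last difference. The quotient g + r h keeps the leading coefficient because `r * h`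
  -- has lower degree than g.
  polynomial-factor : ∀ {n l f} → IsPolynomial (suc n) l f → ∀ r →
                      ∃[ h ] IsPolynomial n l h × (∀ x → f x - f r ≡ (x - r) * h x)
  polynomial-factor {zero} {l} {f} (horner {g = g} a (constant g≡) f≡) r =
    (λ _ → l) , constant (λ _ → ≡.refl) , λ x → begin
      f x - f r ≡⟨ cong₂ _-_ (f≡ x) (f≡ r) ⟩
      (a + x * g x) - (a + r * g r) ≡⟨ cong₂ (λ u v → (a + x * u) - (a + r * v)) (g≡ x) (g≡ r) ⟩
      (a + x * l) - (a + r * l) ≡⟨ solve 4 (λ a x l r → (a :+ x :* l) :- (a :+ r :* l) := (x :- r) :* l) ≡.refl a x l r ⟩
      (x - r) * l ∎
  polynomial-factor {suc n} {l} {f} (horner {g = g} a G f≡) r =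
    let (h , H , g-≡) = polynomial-factor G r in
    (λ x → g x + r * h x) ,
    subst (λ z → IsPolynomial (suc n) z (λ x → g x + r * h x)) (+-identityʳ l) (polynomial-+ G (polynomial-raise (polynomial-* r H))) ,
    λ x → begin
      f x - f r ≡⟨ cong₂ _-_ (f≡ x) (f≡ r) ⟩
      (a + x * g x) - (a + r * g r) ≡⟨ solve 5 (λ a x r u v → (a :+ x :* u) :- (a :+ r :* v) := (x :- r) :* u :+ r :* (u :- v)) ≡.refl a x r (g x) (g r) ⟩
      (x - r) * g x + r * (g x - g r) ≡⟨ cong (λ z → (x - r) * g x + r * z) (g-≡ x) ⟩
      (x - r) * g x + r * ((x - r) * h x) ≡⟨ solve 4 (λ x r u v → (x :- r) :* u :+ r :* ((x :- r) :* v) := (x :- r) :* (u :+ r :* v)) ≡.refl x r (g x) (h x) ⟩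
      (x - r) * (g x + r * h x) ∎

  -- Dividing out the root `ρ zero` lowers the degree and leaves the leading coefficient alone;
  -- after n divisions a nonzero constant would have a root.
  root-bound : ∀ {n l f} → IsPolynomial n l f → l ≢ 0# → (ρ : Fin (suc n) → A) →
               (∀ {i j} → ρ i ≡ ρ j → i ≡ j) → ¬ (∀ i → f (ρ i) ≡ 0#)
  root-bound (constant f≡) l≢0 ρ ρ-injective roots = l≢0 (≡.trans (≡.sym (f≡ _)) (roots zero))
  root-bound {suc n} {l} {f} F@(horner _ _ _) l≢0 ρ ρ-injective roots =
    let (h , H , f-≡) = polynomial-factor F (ρ zero) in
    root-bound H l≢0 (ρ ∘ suc) (Fin.suc-injective ∘ ρ-injective) λ i → *-nonzeroˡ
      (begin
        (ρ (suc i) - ρ zero) * h (ρ (suc i)) ≡⟨ f-≡ (ρ (suc i)) ⟨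
        f (ρ (suc i)) - f (ρ zero) ≡⟨ cong₂ _-_ (roots (suc i)) (roots zero) ⟩
        0# - 0# ≡⟨ -‿inverseʳ 0# ⟩
        0# ∎)
      (λ eq → Fin.0≢1+n (≡.sym (ρ-injective (x-y≡0⇒x≡y eq))))

-- Integer sums and indicator functions

module IntegerSums where

  open import Data.Integer.Base using (_+_; _*_; _-_)
  open ≡-Reasoning
  private module ℤΣ = Sum ℤ.+-*-semiring

  opaque
    ∑ : ∀ {n} → (Fin n → ℤ) → ℤ
    ∑ = ℤΣ.sum

    ∑-empty : (f : Fin 0 → ℤ) → ∑ f ≡ + 0
    ∑-empty f = ≡.refl

    ∑-suc : ∀ {n} (f : Fin (suc n) → ℤ) → ∑ f ≡ f zero + ∑ (f ∘ suc)
    ∑-suc f = ≡.refl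

    ∑-cong : ∀ {n} {f g : Fin n → ℤ} → (∀ x → f x ≡ g x) → ∑ f ≡ ∑ g
    ∑-cong = ℤΣ.sum-cong-≗

    ∑-+ : ∀ {n} (f g : Fin n → ℤ) → ∑ (λ x → f x + g x) ≡ ∑ f + ∑ g
    ∑-+ = ℤΣ.∑-distrib-+

    ∑-*ˡ : ∀ {n} k (f : Fin n → ℤ) → ∑ (λ x → k * f x) ≡ k * ∑ f
    ∑-*ˡ k f = ≡.sym (ℤΣ.*-distribˡ-sum k f)

    ∑-*ʳ : ∀ {n} k (f : Fin n → ℤ) → ∑ (λ x → f x * k) ≡ ∑ f * k
    ∑-*ʳ k f = ≡.sym (ℤΣ.*-distribʳ-sum k f)

    ∑-const : ∀ n k → ∑ {n} (λ _ → k) ≡ + n * k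
    ∑-const zero    k = ≡.refl
    ∑-const (suc n) k = ≡.trans (cong (λ z → k + z) (∑-const n k)) (≡.sym (ℤ.suc-* (+ n) k))

    ∑-0 : ∀ n → ∑ {n} (λ _ → + 0) ≡ + 0
    ∑-0 n = ≡.trans (∑-const n (+ 0)) (ℤ.*-zeroʳ (+ n))

    ∑-- : ∀ {n} (f g : Fin n → ℤ) → ∑ (λ x → f x - g x) ≡ ∑ f - ∑ g
    ∑-- {zero}  f g = ≡.refl
    ∑-- {suc n} f g = ≡.trans (cong (λ z → f zero - g zero + z) (∑-- (f ∘ suc) (g ∘ suc)))
      (rearrange (f zero) (g zero) _ _)
      where
      rearrange : ∀ a b c d → a - b + (c - d) ≡ a + c - (b + d)
      rearrange = ℤ-Solver.solve-∀

    ∑-swap : ∀ {m n} (f : Fin m → Fin n → ℤ) → ∑ (λ x → ∑ (f x)) ≡ ∑ (λ y → ∑ (λ x → f x y))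
    ∑-swap = ℤΣ.∑-comm

    ∑-permute : ∀ {n} (f : Fin n → ℤ) (π : Permutation.Permutation′ n) → ∑ (λ x → f (π Permutation.⟨$⟩ʳ x)) ≡ ∑ f
    ∑-permute f π = ≡.sym (ℤΣ.sum-permute f π)

    ∑-≤ : ∀ {n} {f g : Fin n → ℤ} → (∀ x → f x ℤ.≤ g x) → ∑ f ℤ.≤ ∑ g
    ∑-≤ {zero}  f≤g = ℤ.≤-refl
    ∑-≤ {suc n} f≤g = ℤ.+-mono-≤ (f≤g zero) (∑-≤ (f≤g ∘ suc))

  private
    variable
      a b : Level
      P : Set a
      Q : Set b

  𝟙 : Dec P → ℤ
  𝟙 (yes _) = + 1
  𝟙 (no _)  = + 0

  𝟙-yes : (P? : Dec P) → P → 𝟙 P? ≡ + 1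
  𝟙-yes (yes _) p = ≡.refl
  𝟙-yes (no ¬p) p = contradiction p ¬p

  𝟙-no : (P? : Dec P) → ¬ P → 𝟙 P? ≡ + 0
  𝟙-no (yes p) ¬p = contradiction p ¬p
  𝟙-no (no _)  ¬p = ≡.refl

  𝟙-cong : (P? : Dec P) (Q? : Dec Q) → (P → Q) → (Q → P) → 𝟙 P? ≡ 𝟙 Q?
  𝟙-cong (yes p) Q? P⇒Q Q⇒P = ≡.sym (𝟙-yes Q? (P⇒Q p))
  𝟙-cong (no ¬p) Q? P⇒Q Q⇒P = ≡.sym (𝟙-no Q? (¬p ∘ Q⇒P))

  -- Lets a summand be rewritten under the very condition that its indicator tests.
  𝟙-*-congˡ : (P? : Dec P) {x y : ℤ} → (P → x ≡ y) → 𝟙 P? * x ≡ 𝟙 P? * y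
  𝟙-*-congˡ (yes p) x≡y = cong (+ 1 *_) (x≡y p)
  𝟙-*-congˡ (no _)  x≡y = ≡.refl

  ∑-δ : ∀ {n} (a : Fin n) (f : Fin n → ℤ) → ∑ (λ x → 𝟙 (x Fin.≟ a) * f x) ≡ f a
  ∑-δ {suc n} zero f = begin
    ∑ (λ x → 𝟙 (x Fin.≟ zero) * f x) ≡⟨ ∑-suc _ ⟩
    + 1 * f zero + ∑ {n} (λ _ → + 0) ≡⟨ cong₂ _+_ (ℤ.*-identityˡ (f zero)) (∑-0 n) ⟩
    f zero + + 0 ≡⟨ ℤ.+-identityʳ (f zero) ⟩
    f zero ∎
  ∑-δ {suc n} (suc a) f = begin
    ∑ (λ x → 𝟙 (x Fin.≟ suc a) * f x)
      ≡⟨ ∑-suc _ ⟩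
    + 0 + ∑ (λ x → 𝟙 (suc x Fin.≟ suc a) * f (suc x))
      ≡⟨ ℤ.+-identityˡ _ ⟩
    ∑ (λ x → 𝟙 (suc x Fin.≟ suc a) * f (suc x))
      ≡⟨ ∑-cong (λ x → cong (_* f (suc x)) (𝟙-cong (suc x Fin.≟ suc a) (x Fin.≟ a) Fin.suc-injective (cong suc))) ⟩
    ∑ (λ x → 𝟙 (x Fin.≟ a) * f (suc x))
      ≡⟨ ∑-δ a (f ∘ suc) ⟩
    f (suc a) ∎

  ∑-𝟙≟ : ∀ {n} (a : Fin n) → ∑ (λ x → 𝟙 (x Fin.≟ a)) ≡ + 1
  ∑-𝟙≟ a = ≡.trans (∑-cong λ x → ≡.sym (ℤ.*-identityʳ _)) (∑-δ a (λ _ → + 1))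

  -- By injectivity the indicator of the image is the sum of the point indicators of the `e i`;
  -- after exchanging the sums each of these picks out one value of f.
  ∑-image : ∀ {n q} {S : Fin q → Set a} (S? : ∀ x → Dec (S x)) (e : Fin n → Fin q) →
            (∀ {i j} → e i ≡ e j → i ≡ j) → (∀ i → S (e i)) → (∀ x → S x → ∃[ i ] e i ≡ x) →
            (f : Fin q → ℤ) → ∑ (λ x → 𝟙 (S? x) * f x) ≡ ∑ (λ i → f (e i))
  ∑-image {n = n} {S = S} S? e injective into onto f = begin
    ∑ (λ x → 𝟙 (S? x) * f x) ≡⟨ ∑-cong (λ x → cong (_* f x) (indicator x)) ⟩
    ∑ (λ x → ∑ (λ i → 𝟙 (x Fin.≟ e i)) * f x) ≡⟨ ∑-cong (λ x → ≡.sym (∑-*ʳ (f x) (λ i → 𝟙 (x Fin.≟ e i)))) ⟩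
    ∑ (λ x → ∑ (λ i → 𝟙 (x Fin.≟ e i) * f x)) ≡⟨ ∑-swap (λ x i → 𝟙 (x Fin.≟ e i) * f x) ⟩
    ∑ (λ i → ∑ (λ x → 𝟙 (x Fin.≟ e i) * f x)) ≡⟨ ∑-cong (λ i → ∑-δ (e i) f) ⟩
    ∑ (λ i → f (e i)) ∎
    where
    indicator : ∀ x → 𝟙 (S? x) ≡ ∑ (λ i → 𝟙 (x Fin.≟ e i))
    indicator x with S? x
    ... | no x∉S  = ≡.sym (≡.trans (∑-cong (λ i → 𝟙-no (x Fin.≟ e i) λ { ≡.refl → x∉S (into i) })) (∑-0 n))
    ... | yes x∈S = let (i , ei≡x) = onto x x∈S in begin
      + 1 ≡⟨ ∑-𝟙≟ i ⟨
      ∑ (λ j → 𝟙 (j Fin.≟ i)) ≡⟨ ∑-cong (λ j → 𝟙-cong (j Fin.≟ i) (x Fin.≟ e j)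
                                             (λ { ≡.refl → ≡.sym ei≡x }) (λ x≡ej → injective (≡.trans (≡.sym x≡ej) (≡.sym ei≡x)))) ⟩
      ∑ (λ j → 𝟙 (x Fin.≟ e j)) ∎

∑-zero⇒zero : ∀ {n} (f : Fin n → ℤ) → (∀ x → + 0 ℤ.≤ f x) → IntegerSums.∑ f ≡ + 0 → ∀ x → f x ≡ + 0
∑-zero⇒zero {suc n} f f≥0 ∑f≡0 = zeros
  where
  open IntegerSums

  ∑tail≥0 : + 0 ℤ.≤ ∑ (f ∘ suc)
  ∑tail≥0 = subst (ℤ._≤ ∑ (f ∘ suc)) (∑-0 n) (∑-≤ (f≥0 ∘ suc))

  head+tail : f zero ℤ.+ ∑ (f ∘ suc) ≡ + 0
  head+tail = ≡.trans (≡.sym (∑-suc f)) ∑f≡0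

  zeros : ∀ x → f x ≡ + 0
  zeros zero    = ℤ.≤-antisym
    (subst (f zero ℤ.≤_) head+tail (subst (ℤ._≤ f zero ℤ.+ ∑ (f ∘ suc)) (ℤ.+-identityʳ _) (ℤ.+-monoʳ-≤ (f zero) ∑tail≥0)))
    (f≥0 zero)
  zeros (suc x) = ∑-zero⇒zero (f ∘ suc) (f≥0 ∘ suc) (ℤ.≤-antisym
    (subst (∑ (f ∘ suc) ℤ.≤_) head+tail (subst (ℤ._≤ f zero ℤ.+ ∑ (f ∘ suc)) (ℤ.+-identityˡ _) (ℤ.+-monoˡ-≤ (∑ (f ∘ suc)) (f≥0 zero))))
    ∑tail≥0) x

-- From the solution numbers to a² + p b²

module NormForm where

  open import Data.Integer.Base using (_+_; _*_; _-_)
  open ≡-Reasoning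

  -- X, 2y, 2z stand for the numbers of solutions of Q x = 0, 1, u, S for the sum of the squares of
  -- all solution numbers, R for the size of the radical. The hypotheses say that each nonzero
  -- square class has (p-1)/2 members, so q = X + (p-1)(y+z) and S = X² + 2(p-1)(y²+z²). Then p S -
  -- q² = (p-1)(a² + p b²) with a = X - (y+z) and b = y - z. Using y and z in place of 2y and 2z
  -- makes a and b integers.
  norm-form : ∀ p q X y z S R → p - + 1 ≢ + 0 →
    (p - + 1) * (+ 2 * y + + 2 * z) ≡ + 2 * (q - X) →
    (p - + 1) * (+ 2 * y * (+ 2 * y) + + 2 * z * (+ 2 * z)) ≡ + 2 * (S - X * X) →
    p * S - q * q ≡ q * ((p - + 1) * R) →
    ∃[ a ] ∃[ b ] p * X - q ≡ (p - + 1) * a × a * a + p * (b * b) ≡ q * R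
  norm-form p q X y z S R p-1≢0 linear quadratic distances =
    X - (y + z) , y - z ,
    ≡.trans (cong (λ q → p * X - q) q≡) (solve₁ p X y z) ,
    ℤ.*-cancelˡ-≡ (p - + 1) _ _ {{ℤ.≢-nonZero p-1≢0}} (begin
      (p - + 1) * ((X - (y + z)) * (X - (y + z)) + p * ((y - z) * (y - z)))
        ≡⟨ solve₂ p X y z ⟩
      p * (X * X + + 2 * (p - + 1) * (y * y + z * z)) - (X + (p - + 1) * (y + z)) * (X + (p - + 1) * (y + z))
        ≡⟨ cong₂ (λ S q → p * S - q * q) S≡ q≡ ⟨
      p * S - q * q
        ≡⟨ distances ⟩
      q * ((p - + 1) * R)
        ≡⟨ solve₃ q p R ⟩
      (p - + 1) * (q * R) ∎)
    where
    q≡ : q ≡ X + (p - + 1) * (y + z)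
    q≡ = ℤ.*-cancelˡ-≡ (+ 2) _ _ (≡.trans (double q X) (≡.trans (cong (λ s → s + + 2 * X) (≡.sym linear)) (expand p X y z)))
      where
      double : ∀ q X → + 2 * q ≡ + 2 * (q - X) + + 2 * X
      double = ℤ-Solver.solve-∀
      expand : ∀ p X y z → (p - + 1) * (+ 2 * y + + 2 * z) + + 2 * X ≡ + 2 * (X + (p - + 1) * (y + z))
      expand = ℤ-Solver.solve-∀

    S≡ : S ≡ X * X + + 2 * (p - + 1) * (y * y + z * z)
    S≡ = ℤ.*-cancelˡ-≡ (+ 2) _ _ (≡.trans (double S X) (≡.trans (cong (λ s → s + + 2 * (X * X)) (≡.sym quadratic)) (expand p X y z)))
      where
      double : ∀ S X → + 2 * S ≡ + 2 * (S - X * X) + + 2 * (X * X)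
      double = ℤ-Solver.solve-∀
      expand : ∀ p X y z → (p - + 1) * (+ 2 * y * (+ 2 * y) + + 2 * z * (+ 2 * z)) + + 2 * (X * X) ≡
                           + 2 * (X * X + + 2 * (p - + 1) * (y * y + z * z))
      expand = ℤ-Solver.solve-∀

    solve₁ : ∀ p X y z → p * X - (X + (p - + 1) * (y + z)) ≡ (p - + 1) * (X - (y + z))
    solve₁ = ℤ-Solver.solve-∀
    solve₂ : ∀ p X y z → (p - + 1) * ((X - (y + z)) * (X - (y + z)) + p * ((y - z) * (y - z))) ≡
      p * (X * X + + 2 * (p - + 1) * (y * y + z * z)) - (X + (p - + 1) * (y + z)) * (X + (p - + 1) * (y + z))
    solve₂ = ℤ-Solver.solve-∀
    solve₃ : ∀ q p R → q * ((p - + 1) * R) ≡ (p - + 1) * (q * R)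
    solve₃ = ℤ-Solver.solve-∀

-- Parity, and descent for a² + p b² = pⁿ

odd≢even : ∀ a b → a ℕ.* 2 ℕ.+ 1 ≢ b ℕ.+ b
odd≢even zero    (suc b) eq = ℕ.0≢1+n (≡.trans (ℕ.suc-injective eq) (ℕ.+-suc b b))
odd≢even (suc a) (suc b) eq = odd≢even a b (ℕ.suc-injective (≡.trans (ℕ.suc-injective eq) (ℕ.+-suc b b)))

-- For m = 2h + 1 and a radical of size p^d this singles out d = 1 as the only dimension in which
-- p^(m+d) is a square, with root p^(h+1).
odd+≤2 : ∀ h {d} → d ℕ.≤ 2 → ∀ j → h ℕ.* 2 ℕ.+ 1 ℕ.+ d ≡ j ℕ.+ j → d ≡ 1 × j ≡ suc h
odd+≤2 h {0} _ j eq = contradiction (≡.trans (≡.sym (ℕ.+-identityʳ _)) eq) (odd≢even h j)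
odd+≤2 h {1} _ j eq = ≡.refl , halve j (suc h) (≡.trans (≡.sym eq) (double h))
  where
  double : ∀ h → h ℕ.* 2 ℕ.+ 1 ℕ.+ 1 ≡ suc h ℕ.+ suc h
  double = ℕ-Solver.solve-∀

  halve : ∀ i j → i ℕ.+ i ≡ j ℕ.+ j → i ≡ j
  halve i j eq = ℕ.*-cancelˡ-≡ i j 2
    (≡.trans (cong (i ℕ.+_) (ℕ.+-identityʳ i)) (≡.trans eq (≡.sym (cong (j ℕ.+_) (ℕ.+-identityʳ j)))))
odd+≤2 h {2} _ j eq = contradiction (≡.trans (≡.sym (shift h)) eq) (odd≢even (suc h) j)
  where
  shift : ∀ h → h ℕ.* 2 ℕ.+ 1 ℕ.+ 2 ≡ suc h ℕ.* 2 ℕ.+ 1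
  shift = ℕ-Solver.solve-∀
odd+≤2 h {suc (suc (suc d))} (ℕ.s≤s (ℕ.s≤s ())) j eq

module Descent {p : ℕ} (p-prime : Prime p) where

  open ≡-Reasoning
  private instance
    p-nonZero = prime⇒nonZero p-prime

  sum-zeroʳ : ∀ {a b} → a ℕ.+ p ℕ.* (b ℕ.* b) ≡ 1 → b ≡ 0
  sum-zeroʳ {a} {zero}  eq = ≡.refl
  sum-zeroʳ {a} {suc b} eq = contradiction (ℕ.≤-trans (prime>1 p-prime)
    (ℕ.≤-trans (ℕ.m≤m*n p (suc b ℕ.* suc b)) (ℕ.≤-trans (ℕ.m≤n+m _ a) (ℕ.≤-reflexive eq)))) ℕ.1+n≰n

  prime∣square : ∀ {a} → p ∣ a ℕ.* a → p ∣ a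
  prime∣square {a} p∣aa with euclidsLemma a a p-prime p∣aa
  ... | inj₁ p∣a = p∣a
  ... | inj₂ p∣a = p∣a

  -- If a² + p b² = pⁿ⁺¹, then a = p a′ and b² + p a′² = pⁿ.
  descent : ∀ n a b → a ℕ.* a ℕ.+ p ℕ.* (b ℕ.* b) ≡ p ℕ.^ n → a ≡ 0 ⊎ b ≡ 0
  descent zero    a b eq = inj₂ (sum-zeroʳ {a ℕ.* a} eq)
  descent (suc n) a b eq with prime∣square {a} (ℕ.∣m+n∣m⇒∣n {m = p ℕ.* (b ℕ.* b)} {n = a ℕ.* a}
                                (subst (p ∣_) (≡.trans (≡.sym eq) (ℕ.+-comm (a ℕ.* a) _)) (ℕ.m∣m*n (p ℕ.^ n))) (ℕ.m∣m*n (b ℕ.* b)))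
  ... | ℕ.divides a′ ≡.refl with descent n b a′ (ℕ.*-cancelˡ-≡ _ _ p (≡.trans (rearrange p a′ b) eq))
    where
    rearrange : ∀ p a b → p ℕ.* (b ℕ.* b ℕ.+ p ℕ.* (a ℕ.* a)) ≡ a ℕ.* p ℕ.* (a ℕ.* p) ℕ.+ p ℕ.* (b ℕ.* b)
    rearrange = ℕ-Solver.solve-∀
  ...   | inj₁ b≡0  = inj₂ b≡0
  ...   | inj₂ a′≡0 = inj₁ (cong (ℕ._* p) a′≡0)

  -- Since p divides x, both sides can be divided by p²; the exponent 1 cannot remain, as it would
  -- make p a divisor of 1.
  square-of-power : ∀ n x → x ℕ.* x ≡ p ℕ.^ n → ∃[ j ] n ≡ j ℕ.+ j × x ≡ p ℕ.^ j
  square-of-power zero    x eq = 0 , ≡.refl , ℕ.m*n≡1⇒m≡1 x x eq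
  square-of-power (suc n) x eq with prime∣square {x} (subst (p ∣_) (≡.sym eq) (ℕ.m∣m*n (p ℕ.^ n)))
  square-of-power (suc zero)    _ eq | ℕ.divides y ≡.refl =
    contradiction (ℕ.m*n≡1⇒n≡1 (y ℕ.* y) p (ℕ.*-cancelˡ-≡ _ _ p (≡.trans (rearrange p y) eq))) (ℕ.<⇒≢ (prime>1 p-prime) ∘ ≡.sym)
    where
    rearrange : ∀ p y → p ℕ.* (y ℕ.* y ℕ.* p) ≡ y ℕ.* p ℕ.* (y ℕ.* p)
    rearrange = ℕ-Solver.solve-∀
  square-of-power (suc (suc n)) _ eq | ℕ.divides y ≡.refl =
    let (j , n≡ , y≡) = square-of-power n y (ℕ.*-cancelˡ-≡ _ _ p (ℕ.*-cancelˡ-≡ _ _ p (≡.trans (rearrange p y) eq)))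
    in suc j , cong suc (≡.trans (cong suc n≡) (≡.sym (ℕ.+-suc j j))) , ≡.trans (ℕ.*-comm y p) (cong (p ℕ.*_) y≡)
    where
    rearrange : ∀ p y → p ℕ.* (p ℕ.* (y ℕ.* y)) ≡ y ℕ.* p ℕ.* (y ℕ.* p)
    rearrange = ℕ-Solver.solve-∀

  square-abs : ∀ a → a ℤ.* a ≡ + (ℤ.∣ a ∣ ℕ.* ℤ.∣ a ∣)
  square-abs (+ n)    = ≡.sym (ℤ.pos-* n n)
  square-abs -[1+ n ] = ≡.refl

  ℤ-descent : ∀ n a b → a ℤ.* a ℤ.+ + p ℤ.* (b ℤ.* b) ≡ + (p ℕ.^ n) →
              a ≡ + 0 ⊎ ∃[ j ] n ≡ j ℕ.+ j × (a ≡ + (p ℕ.^ j) ⊎ a ≡ ℤ.- + (p ℕ.^ j))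
  ℤ-descent n a b eq with descent n ℤ.∣ a ∣ ℤ.∣ b ∣ abs-eq
    where
    abs-eq : ℤ.∣ a ∣ ℕ.* ℤ.∣ a ∣ ℕ.+ p ℕ.* (ℤ.∣ b ∣ ℕ.* ℤ.∣ b ∣) ≡ p ℕ.^ n
    abs-eq = ℤ.+-injective (begin
      + (ℤ.∣ a ∣ ℕ.* ℤ.∣ a ∣) ℤ.+ + (p ℕ.* (ℤ.∣ b ∣ ℕ.* ℤ.∣ b ∣))
        ≡⟨ cong₂ ℤ._+_ (≡.sym (square-abs a)) (≡.trans (ℤ.pos-* p _) (cong (+ p ℤ.*_) (≡.sym (square-abs b)))) ⟩
      a ℤ.* a ℤ.+ + p ℤ.* (b ℤ.* b)
        ≡⟨ eq ⟩
      + (p ℕ.^ n) ∎)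
  ... | inj₁ ∣a∣≡0 = inj₁ (ℤ.∣i∣≡0⇒i≡0 ∣a∣≡0)
  ... | inj₂ ∣b∣≡0 = inj₂ (signs (square-of-power n ℤ.∣ a ∣ (ℤ.+-injective (begin
    + (ℤ.∣ a ∣ ℕ.* ℤ.∣ a ∣) ≡⟨ square-abs a ⟨
    a ℤ.* a ≡⟨ ℤ.+-identityʳ _ ⟨
    a ℤ.* a ℤ.+ + 0 ≡⟨ cong (λ z → a ℤ.* a ℤ.+ z) (ℤ.*-zeroʳ (+ p)) ⟨
    a ℤ.* a ℤ.+ + p ℤ.* (+ 0 ℤ.* + 0) ≡⟨ cong (λ b → a ℤ.* a ℤ.+ + p ℤ.* (b ℤ.* b)) (ℤ.∣i∣≡0⇒i≡0 {b} ∣b∣≡0) ⟨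
    a ℤ.* a ℤ.+ + p ℤ.* (b ℤ.* b) ≡⟨ eq ⟩
    + (p ℕ.^ n) ∎))))
    where
    signs : ∃[ j ] n ≡ j ℕ.+ j × ℤ.∣ a ∣ ≡ p ℕ.^ j → ∃[ j ] n ≡ j ℕ.+ j × (a ≡ + (p ℕ.^ j) ⊎ a ≡ ℤ.- + (p ℕ.^ j))
    signs (j , n≡ , ∣a∣≡) = j , n≡ , sign a ∣a∣≡
      where
      sign : ∀ a → ℤ.∣ a ∣ ≡ p ℕ.^ j → a ≡ + (p ℕ.^ j) ⊎ a ≡ ℤ.- + (p ℕ.^ j)
      sign (+ n)    n≡ = inj₁ (cong (λ z → + z) n≡)
      sign -[1+ n ] n≡ = inj₂ (cong (λ z → ℤ.- + z) n≡)

-- Functions with values 0, w, -w and two known moments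

module ThreeValued {n : ℕ} (w : ℤ) (w≢0 : w ≢ + 0) (f : Fin n → ℤ)
                   (values : ∀ x → f x ≡ + 0 ⊎ f x ≡ w ⊎ f x ≡ ℤ.- w) where

  open import Data.Integer.Base using (_+_; _*_; _-_)
  open IntegerSums
  open ≡-Reasoning

  n₀ n₊ n₋ : ℤ
  n₀ = ∑ (λ x → 𝟙 (f x ℤ.≟ + 0))
  n₊ = ∑ (λ x → 𝟙 (f x ℤ.≟ w))
  n₋ = ∑ (λ x → 𝟙 (f x ℤ.≟ ℤ.- w))

  -w≢0 : ℤ.- w ≢ + 0
  -w≢0 eq = w≢0 (≡.trans (≡.sym (ℤ.neg-involutive w)) (cong (ℤ.-_) eq))

  w≢-w : w ≢ ℤ.- w
  w≢-w eq = ⊎.[ (λ ()) , w≢0 ] (ℤ.i*j≡0⇒i≡0∨j≡0 (+ 2) (≡.trans (double w) (≡.trans (cong (λ z → w + z) eq) (ℤ.+-inverseʳ w))))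
    where
    double : ∀ w → + 2 * w ≡ w + w
    double = ℤ-Solver.solve-∀

  -- A function on three points is a combination of their indicators. Different choices of G turn
  -- this one identity into the cardinality, both moments and the convolution below.
  expand : ∀ (G : ℤ → ℤ) {z} → z ≡ + 0 ⊎ z ≡ w ⊎ z ≡ ℤ.- w →
           G z ≡ 𝟙 (z ℤ.≟ + 0) * G (+ 0) + 𝟙 (z ℤ.≟ w) * G w + 𝟙 (z ℤ.≟ ℤ.- w) * G (ℤ.- w)
  expand G (inj₁ ≡.refl)
    rewrite 𝟙-no (+ 0 ℤ.≟ w) (w≢0 ∘ ≡.sym) | 𝟙-no (+ 0 ℤ.≟ ℤ.- w) (-w≢0 ∘ ≡.sym) = first (G (+ 0)) (G w) (G (ℤ.- w))
    where
    first : ∀ a b c → a ≡ + 1 * a + + 0 * b + + 0 * c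
    first = ℤ-Solver.solve-∀
  expand G (inj₂ (inj₁ ≡.refl))
    rewrite 𝟙-no (w ℤ.≟ + 0) w≢0 | 𝟙-yes (w ℤ.≟ w) ≡.refl | 𝟙-no (w ℤ.≟ ℤ.- w) w≢-w = second (G (+ 0)) (G w) (G (ℤ.- w))
    where
    second : ∀ a b c → b ≡ + 0 * a + + 1 * b + + 0 * c
    second = ℤ-Solver.solve-∀
  expand G (inj₂ (inj₂ ≡.refl))
    rewrite 𝟙-no (ℤ.- w ℤ.≟ + 0) -w≢0 | 𝟙-no (ℤ.- w ℤ.≟ w) (w≢-w ∘ ≡.sym) | 𝟙-yes (ℤ.- w ℤ.≟ ℤ.- w) ≡.refl =
      third (G (+ 0)) (G w) (G (ℤ.- w))
    where
    third : ∀ a b c → c ≡ + 0 * a + + 0 * b + + 1 * c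
    third = ℤ-Solver.solve-∀

  ∑-expand : (G : ℤ → ℤ) → ∑ (λ x → G (f x)) ≡ n₀ * G (+ 0) + n₊ * G w + n₋ * G (ℤ.- w)
  ∑-expand G = begin
    ∑ (λ x → G (f x))
      ≡⟨ ∑-cong (λ x → expand G (values x)) ⟩
    ∑ (λ x → 𝟙 (f x ℤ.≟ + 0) * G (+ 0) + 𝟙 (f x ℤ.≟ w) * G w + 𝟙 (f x ℤ.≟ ℤ.- w) * G (ℤ.- w))
      ≡⟨ ∑-+ (λ x → 𝟙 (f x ℤ.≟ + 0) * G (+ 0) + 𝟙 (f x ℤ.≟ w) * G w) (λ x → 𝟙 (f x ℤ.≟ ℤ.- w) * G (ℤ.- w)) ⟩
    ∑ (λ x → 𝟙 (f x ℤ.≟ + 0) * G (+ 0) + 𝟙 (f x ℤ.≟ w) * G w) + ∑ (λ x → 𝟙 (f x ℤ.≟ ℤ.- w) * G (ℤ.- w))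
      ≡⟨ cong (_+ ∑ (λ x → 𝟙 (f x ℤ.≟ ℤ.- w) * G (ℤ.- w)))
           (∑-+ (λ x → 𝟙 (f x ℤ.≟ + 0) * G (+ 0)) (λ x → 𝟙 (f x ℤ.≟ w) * G w)) ⟩
    ∑ (λ x → 𝟙 (f x ℤ.≟ + 0) * G (+ 0)) + ∑ (λ x → 𝟙 (f x ℤ.≟ w) * G w) + ∑ (λ x → 𝟙 (f x ℤ.≟ ℤ.- w) * G (ℤ.- w))
      ≡⟨ cong₂ _+_ (cong₂ _+_ (∑-*ʳ (G (+ 0)) (λ x → 𝟙 (f x ℤ.≟ + 0))) (∑-*ʳ (G w) (λ x → 𝟙 (f x ℤ.≟ w))))
           (∑-*ʳ (G (ℤ.- w)) (λ x → 𝟙 (f x ℤ.≟ ℤ.- w))) ⟩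
    n₀ * G (+ 0) + n₊ * G w + n₋ * G (ℤ.- w) ∎

  -- The self-convolution of the distribution of f, tested against G: the sums w + (-w) fall on 0,
  -- which accounts for the term 2 n₊ n₋.
  pairs : (G : ℤ → ℤ) → ∑ (λ x → ∑ (λ y → G (f x + f y))) ≡
    (n₀ * n₀ + + 2 * n₊ * n₋) * G (+ 0) + + 2 * n₀ * n₊ * G w + + 2 * n₀ * n₋ * G (ℤ.- w)
      + n₊ * n₊ * G (w + w) + n₋ * n₋ * G (ℤ.- w + ℤ.- w)
  pairs G = begin
    ∑ (λ x → ∑ (λ y → G (f x + f y)))
      ≡⟨ ∑-cong (λ x → ∑-expand (λ z → G (f x + z))) ⟩
    ∑ (λ x → inner (f x))
      ≡⟨ ∑-expand inner ⟩
    n₀ * inner (+ 0) + n₊ * inner w + n₋ * inner (ℤ.- w)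
      ≡⟨ cong₂ (λ a b → n₀ * a + n₊ * b + n₋ * inner (ℤ.- w))
           (cong₂ (λ a b → n₀ * G (+ 0) + n₊ * a + n₋ * b) (cong G (ℤ.+-identityˡ w)) (cong G (ℤ.+-identityˡ (ℤ.- w))))
           (cong₂ (λ a b → n₀ * a + n₊ * G (w + w) + n₋ * b) (cong G (ℤ.+-identityʳ w)) (cong G (ℤ.+-inverseʳ w))) ⟩
    n₀ * (n₀ * G (+ 0) + n₊ * G w + n₋ * G (ℤ.- w)) + n₊ * (n₀ * G w + n₊ * G (w + w) + n₋ * G (+ 0)) + n₋ * inner (ℤ.- w)
      ≡⟨ cong (λ z → n₀ * (n₀ * G (+ 0) + n₊ * G w + n₋ * G (ℤ.- w)) + n₊ * (n₀ * G w + n₊ * G (w + w) + n₋ * G (+ 0)) + n₋ * z)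
           (cong₂ (λ a b → n₀ * a + n₊ * b + n₋ * G (ℤ.- w + ℤ.- w)) (cong G (ℤ.+-identityʳ (ℤ.- w))) (cong G (ℤ.+-inverseˡ w))) ⟩
    n₀ * (n₀ * G (+ 0) + n₊ * G w + n₋ * G (ℤ.- w)) + n₊ * (n₀ * G w + n₊ * G (w + w) + n₋ * G (+ 0))
      + n₋ * (n₀ * G (ℤ.- w) + n₊ * G (+ 0) + n₋ * G (ℤ.- w + ℤ.- w))
      ≡⟨ collect n₀ n₊ n₋ (G (+ 0)) (G w) (G (ℤ.- w)) (G (w + w)) (G (ℤ.- w + ℤ.- w)) ⟩
    (n₀ * n₀ + + 2 * n₊ * n₋) * G (+ 0) + + 2 * n₀ * n₊ * G w + + 2 * n₀ * n₋ * G (ℤ.- w)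
      + n₊ * n₊ * G (w + w) + n₋ * n₋ * G (ℤ.- w + ℤ.- w) ∎
    where
    inner : ℤ → ℤ
    inner z = n₀ * G (z + + 0) + n₊ * G (z + w) + n₋ * G (z + ℤ.- w)

    collect : ∀ a b c g₀ g₊ g₋ g₊₊ g₋₋ →
      a * (a * g₀ + b * g₊ + c * g₋) + b * (a * g₊ + b * g₊₊ + c * g₀) + c * (a * g₋ + b * g₀ + c * g₋₋) ≡
      (a * a + + 2 * b * c) * g₀ + + 2 * a * b * g₊ + + 2 * a * c * g₋ + b * b * g₊₊ + c * c * g₋₋
    collect = ℤ-Solver.solve-∀

  module _ (H : ℤ) (sum≡ : ∑ f ≡ w * H) (squares≡ : ∑ (λ x → f x * f x) ≡ w * w * (H * H)) where

    n₊-n₋ : n₊ - n₋ ≡ H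
    n₊-n₋ = ℤ.*-cancelˡ-≡ w _ _ {{ℤ.≢-nonZero w≢0}} (begin
      w * (n₊ - n₋) ≡⟨ rearrange n₀ n₊ n₋ w ⟩
      n₀ * + 0 + n₊ * w + n₋ * (ℤ.- w) ≡⟨ ∑-expand id ⟨
      ∑ f ≡⟨ sum≡ ⟩
      w * H ∎)
      where
      rearrange : ∀ a b c w → w * (b - c) ≡ a * + 0 + b * w + c * (ℤ.- w)
      rearrange = ℤ-Solver.solve-∀

    n₊+n₋ : n₊ + n₋ ≡ H * H
    n₊+n₋ = ℤ.*-cancelˡ-≡ w _ _ {{ℤ.≢-nonZero w≢0}} (ℤ.*-cancelˡ-≡ w _ _ {{ℤ.≢-nonZero w≢0}} (begin
      w * (w * (n₊ + n₋)) ≡⟨ rearrange n₀ n₊ n₋ w ⟩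
      n₀ * (+ 0 * + 0) + n₊ * (w * w) + n₋ * (ℤ.- w * ℤ.- w) ≡⟨ ∑-expand (λ z → z * z) ⟨
      ∑ (λ x → f x * f x) ≡⟨ squares≡ ⟩
      w * w * (H * H) ≡⟨ ℤ.*-assoc w w (H * H) ⟩
      w * (w * (H * H)) ∎))
      where
      rearrange : ∀ a b c w → w * (w * (b + c)) ≡ a * (+ 0 * + 0) + b * (w * w) + c * (ℤ.- w * ℤ.- w)
      rearrange = ℤ-Solver.solve-∀

    -- Kept doubled so that no division by 2 occurs in ℤ.
    2n₊ : + 2 * n₊ ≡ H * H + H
    2n₊ = ≡.trans (rearrange n₊ n₋) (cong₂ _+_ n₊+n₋ n₊-n₋)
      where
      rearrange : ∀ a b → + 2 * a ≡ a + b + (a - b)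
      rearrange = ℤ-Solver.solve-∀

    2n₋ : + 2 * n₋ ≡ H * H - H
    2n₋ = ≡.trans (rearrange n₊ n₋) (cong₂ _-_ n₊+n₋ n₊-n₋)
      where
      rearrange : ∀ a b → + 2 * b ≡ a + b - (a - b)
      rearrange = ℤ-Solver.solve-∀

    n₀≡ : n₀ ≡ + n - H * H
    n₀≡ = begin
      n₀ ≡⟨ rearrange n₀ n₊ n₋ ⟩
      n₀ * + 1 + n₊ * + 1 + n₋ * + 1 - (n₊ + n₋) ≡⟨ cong₂ _-_ (≡.sym (∑-expand (λ _ → + 1))) n₊+n₋ ⟩
      ∑ {n} (λ _ → + 1) - H * H ≡⟨ cong (_- H * H) (≡.trans (∑-const n (+ 1)) (ℤ.*-identityʳ (+ n))) ⟩
      + n - H * H ∎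
      where
      rearrange : ∀ a b c → a ≡ a * + 1 + b * + 1 + c * + 1 - (b + c)
      rearrange = ℤ-Solver.solve-∀

-- Functions vanishing off one point, as T(·,0) does

module Spike {n : ℕ} (o : Fin n) (f : Fin n → ℤ) (V : ℤ)
             (fo≡V : f o ≡ V) (f≡0 : ∀ x → x ≢ o → f x ≡ + 0) where

  open import Data.Integer.Base using (_+_; _*_; _-_)
  open IntegerSums
  open ≡-Reasoning

  ∑-spike : (G : ℤ → ℤ) → ∑ (λ x → G (f x)) ≡ G V + (+ n - + 1) * G (+ 0)
  ∑-spike G = begin
    ∑ (λ x → G (f x))
      ≡⟨ ∑-cong pointwise ⟩
    ∑ (λ x → 𝟙 (x Fin.≟ o) * (G V - G (+ 0)) + G (+ 0))
      ≡⟨ ∑-+ (λ x → 𝟙 (x Fin.≟ o) * (G V - G (+ 0))) (λ _ → G (+ 0)) ⟩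
    ∑ (λ x → 𝟙 (x Fin.≟ o) * (G V - G (+ 0))) + ∑ {n} (λ _ → G (+ 0))
      ≡⟨ cong₂ _+_ (∑-δ o (λ _ → G V - G (+ 0))) (∑-const n (G (+ 0))) ⟩
    G V - G (+ 0) + + n * G (+ 0)
      ≡⟨ rearrange (G V) (G (+ 0)) (+ n) ⟩
    G V + (+ n - + 1) * G (+ 0) ∎
    where
    pointwise : ∀ x → G (f x) ≡ 𝟙 (x Fin.≟ o) * (G V - G (+ 0)) + G (+ 0)
    pointwise x with x Fin.≟ o
    ... | yes ≡.refl = ≡.trans (cong G fo≡V) (at (G V) (G (+ 0)))
      where
      at : ∀ a b → a ≡ + 1 * (a - b) + b
      at = ℤ-Solver.solve-∀
    ... | no x≢o = ≡.trans (cong G (f≡0 x x≢o)) (off (G V) (G (+ 0)))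
      where
      off : ∀ a b → b ≡ + 0 * (a - b) + b
      off = ℤ-Solver.solve-∀

    rearrange : ∀ a b n → a - b + n * b ≡ a + (n - + 1) * b
    rearrange = ℤ-Solver.solve-∀

  spikePairs : (G : ℤ → ℤ) → ∑ (λ x → ∑ (λ y → G (f x + f y))) ≡
               G (V + V) + + 2 * (+ n - + 1) * G V + (+ n - + 1) * (+ n - + 1) * G (+ 0)
  spikePairs G = begin
    ∑ (λ x → ∑ (λ y → G (f x + f y)))
      ≡⟨ ∑-cong (λ x → ∑-spike (λ z → G (f x + z))) ⟩
    ∑ (λ x → G (f x + V) + (+ n - + 1) * G (f x + + 0))
      ≡⟨ ∑-spike (λ z → G (z + V) + (+ n - + 1) * G (z + + 0)) ⟩
    G (V + V) + (+ n - + 1) * G (V + + 0) + (+ n - + 1) * (G (+ 0 + V) + (+ n - + 1) * G (+ 0))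
      ≡⟨ cong₂ (λ a b → G (V + V) + (+ n - + 1) * a + (+ n - + 1) * (b + (+ n - + 1) * G (+ 0)))
           (cong G (ℤ.+-identityʳ V)) (cong G (ℤ.+-identityˡ V)) ⟩
    G (V + V) + (+ n - + 1) * G V + (+ n - + 1) * (G V + (+ n - + 1) * G (+ 0))
      ≡⟨ rearrange (G (V + V)) (G V) (G (+ 0)) (+ n) ⟩
    G (V + V) + + 2 * (+ n - + 1) * G V + (+ n - + 1) * (+ n - + 1) * G (+ 0) ∎
    where
    rearrange : ∀ a b c n → a + (n - + 1) * b + (n - + 1) * (b + (n - + 1) * c) ≡
                a + + 2 * (n - + 1) * b + (n - + 1) * (n - + 1) * c
    rearrange = ℤ-Solver.solve-∀

-- Integers inside the rationals

module IntegersInRationals where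

  open ≡-Reasoning

  ι : ℤ → ℚ
  ι z = z ℚ./ 1

  private
    ιᵘ : ℤ → ℚᵘ.ℚᵘ
    ιᵘ z = ℚᵘ.mkℚᵘ z 0

    toℚᵘ-ι : ∀ z → ℚ.toℚᵘ (ι z) ℚᵘ.≃ ιᵘ z
    toℚᵘ-ι z = ℚ.toℚᵘ-fromℚᵘ (ιᵘ z)

  ι-+ : ∀ x y → ι (x ℤ.+ y) ≡ ι x ℚ.+ ι y
  ι-+ x y = ℚ.toℚᵘ-injective (ℚᵘ.≃-trans (toℚᵘ-ι (x ℤ.+ y)) (ℚᵘ.≃-trans (ℚᵘ.*≡* (numerators x y)) (ℚᵘ.≃-sym
    (ℚᵘ.≃-trans (ℚ.toℚᵘ-homo-+ (ι x) (ι y)) (ℚᵘ.+-cong (toℚᵘ-ι x) (toℚᵘ-ι y))))))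
    where
    numerators : ∀ x y → (x ℤ.+ y) ℤ.* + 1 ≡ (x ℤ.* + 1 ℤ.+ y ℤ.* + 1) ℤ.* + 1
    numerators = ℤ-Solver.solve-∀

  ι-* : ∀ x y → ι (x ℤ.* y) ≡ ι x ℚ.* ι y
  ι-* x y = ℚ.toℚᵘ-injective (ℚᵘ.≃-trans (toℚᵘ-ι (x ℤ.* y)) (ℚᵘ.≃-sym
    (ℚᵘ.≃-trans (ℚ.toℚᵘ-homo-* (ι x) (ι y)) (ℚᵘ.*-cong (toℚᵘ-ι x) (toℚᵘ-ι y)))))

  ι-neg : ∀ x → ι (ℤ.- x) ≡ ℚ.- ι x
  ι-neg x = ℚ.toℚᵘ-injective (ℚᵘ.≃-trans (toℚᵘ-ι (ℤ.- x)) (ℚᵘ.≃-sym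
    (ℚᵘ.≃-trans (ℚ.toℚᵘ-homo‿- (ι x)) (ℚᵘ.-‿cong (toℚᵘ-ι x)))))

  ι-- : ∀ x y → ι (x ℤ.- y) ≡ ι x ℚ.- ι y
  ι-- x y = ≡.trans (ι-+ x (ℤ.- y)) (cong (ι x ℚ.+_) (ι-neg y))

  quarter : ∀ {x y} → + 4 ℤ.* x ≡ y → ι x ≡ (+ 1 ℚ./ 4) ℚ.* ι y
  quarter {x} {y} 4x≡y = begin
    ι x ≡⟨ ℚ-Solver.solve 1 (λ x → x := con (+ 1 ℚ./ 4) :* (con (+ 4 ℚ./ 1) :* x)) ≡.refl (ι x) ⟩
    (+ 1 ℚ./ 4) ℚ.* (ι (+ 4) ℚ.* ι x) ≡⟨ cong ((+ 1 ℚ./ 4) ℚ.*_) (≡.trans (≡.sym (ι-* (+ 4) x)) (cong ι 4x≡y)) ⟩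
    (+ 1 ℚ./ 4) ℚ.* ι y ∎
    where open ℚ-Solver using (_:=_; con; _:*_)

  -- One syntax read both in ℤ and in ℚ: `ι-value` then carries `ι` through a whole frequency
  -- formula down to its literals.
  data Expr : Set where
    lit         : ℤ → Expr
    _⊞_ _⊟_ _⊠_ : Expr → Expr → Expr

  infixl 6 _⊞_ _⊟_
  infixl 7 _⊠_

  valueℤ : Expr → ℤ
  valueℤ (lit z) = z
  valueℤ (a ⊞ b) = valueℤ a ℤ.+ valueℤ b
  valueℤ (a ⊟ b) = valueℤ a ℤ.- valueℤ b
  valueℤ (a ⊠ b) = valueℤ a ℤ.* valueℤ b

  valueℚ : Expr → ℚ
  valueℚ (lit z) = ι z
  valueℚ (a ⊞ b) = valueℚ a ℚ.+ valueℚ b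
  valueℚ (a ⊟ b) = valueℚ a ℚ.- valueℚ b
  valueℚ (a ⊠ b) = valueℚ a ℚ.* valueℚ b

  ι-value : ∀ a → ι (valueℤ a) ≡ valueℚ a
  ι-value (lit z) = ≡.refl
  ι-value (a ⊞ b) = ≡.trans (ι-+ (valueℤ a) (valueℤ b)) (cong₂ ℚ._+_ (ι-value a) (ι-value b))
  ι-value (a ⊟ b) = ≡.trans (ι-- (valueℤ a) (valueℤ b)) (cong₂ ℚ._-_ (ι-value a) (ι-value b))
  ι-value (a ⊠ b) = ≡.trans (ι-* (valueℤ a) (valueℤ b)) (cong₂ ℚ._*_ (ι-value a) (ι-value b))

-- Frobenius powers and the prime subfield

module Galois {p m : ℕ} (p-prime : Prime p) (0<m : 0 ℕ.< m) (𝔽 : FieldOn (p ℕ.^ m)) where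

  open Field 𝔽 public
  open IntegerSums public
  open ≡-Reasoning
  private module RΣ = Sum semiring

  q : ℕ
  q = p ℕ.^ m

  A : Set
  A = Fin q

  private instance
    p-nonZero = prime⇒nonZero p-prime

  0<p : 0 ℕ.< p
  0<p = ℕ.<-trans (ℕ.n<1+n 0) (prime>1 p-prime)

  -- The m-th power of `p · 1#` is `q · 1#`, which is 0, and a field has no nilpotents.
  p·1≡0 : p · 1# ≡ 0#
  p·1≡0 with p · 1# ≟ 0#
  ... | yes p·1≡0 = p·1≡0
  ... | no  p·1≢0 = contradiction (≡.trans (≡.sym (^·1 m)) q·1≡0) (^-nonzero m p·1≢0)
    where
    ^·1 : ∀ n → (p ℕ.^ n) · 1# ≡ (p · 1#) ^ n
    ^·1 zero    = +-identityʳ 1#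
    ^·1 (suc n) = ≡.trans (×1-homo-* p (p ℕ.^ n)) (cong (p · 1# *_) (^·1 n))

  open Mult semiring using (×-assocˡ; ×-assoc-*; ×-congʳ)

  multiple·≡0 : ∀ {n} → p ∣ n → ∀ x → n · x ≡ 0#
  multiple·≡0 (ℕ.divides k ≡.refl) x = begin
    (k ℕ.* p) · x ≡⟨ ×-assocˡ x k p ⟨
    k · (p · x) ≡⟨ cong (λ z → k · (p · z)) (*-identityˡ x) ⟨
    k · (p · (1# * x)) ≡⟨ cong (k ·_) (×-assoc-* p 1# x) ⟨
    k · (p · 1# * x) ≡⟨ cong (λ z → k · (z * x)) p·1≡0 ⟩
    k · (0# * x) ≡⟨ cong (k ·_) (zeroˡ x) ⟩
    k · 0# ≡⟨ RΣ.sum-replicate k ⟨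
    RΣ.sum {k} (λ _ → 0#) ≡⟨ RΣ.sum-replicate-zero k ⟩
    0# ∎

  ^p-+ : ∀ x y → (x + y) ^ p ≡ x ^ p + y ^ p
  ^p-+ x y = expand p 0<p (λ k 0<k k<p → multiple·≡0 (prime∣choose p-prime k 0<k k<p))
    where
    open Binomial commutativeSemiring using (theorem)

    -- Generalised from p to n so that n can be matched with `suc n′`, which splits off the first
    -- and the last binomial term.
    expand : ∀ n → 0 ℕ.< n → (∀ k → 0 ℕ.< k → k ℕ.< n → ∀ z → (n C k) · z ≡ 0#) →
             (x + y) ^ n ≡ x ^ n + y ^ n
    expand n@(suc n′) _ vanish = begin
      (x + y) ^ n
        ≡⟨ theorem n x y ⟩
      RΣ.sum {suc n} (λ k → term (toℕ k))
        ≡⟨⟩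
      term 0 + RΣ.sum {n} (λ k → term (suc (toℕ k)))
        ≡⟨ cong (λ z → term 0 + z) (RΣ.sum-init-last {n′} (λ k → term (suc (toℕ k)))) ⟩
      term 0 + (RΣ.sum {n′} (λ k → term (suc (toℕ (Fin.inject₁ k)))) + term (suc (toℕ (Fin.fromℕ n′))))
        ≡⟨ cong₂ (λ u v → term 0 + (u + v))
             (≡.trans (RΣ.sum-cong-≗ {n′} middle) (RΣ.sum-replicate-zero n′)) (≡.trans (cong (term ∘ suc) (Fin.toℕ-fromℕ n′)) last) ⟩
      term 0 + (0# + x ^ n)
        ≡⟨ cong (_+ (0# + x ^ n)) (≡.trans (+-identityʳ _) (*-identityˡ _)) ⟩
      y ^ n + (0# + x ^ n)
        ≡⟨ solve 2 (λ u v → v :+ (con (+ 0) :+ u) := u :+ v) ≡.refl (x ^ n) (y ^ n) ⟩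
      x ^ n + y ^ n ∎
      where
      term : ℕ → A
      term k = (n C k) · (x ^ k * y ^ (n ℕ.∸ k))

      middle : ∀ (k : Fin n′) → term (suc (toℕ (Fin.inject₁ k))) ≡ 0#
      middle k = vanish _ (ℕ.s≤s ℕ.z≤n) (ℕ.s≤s (subst (ℕ._< n′) (≡.sym (Fin.toℕ-inject₁ k)) (Fin.toℕ<n k))) _

      last : term n ≡ x ^ n
      last = begin
        (n C n) · (x ^ n * y ^ (n ℕ.∸ n)) ≡⟨ cong₂ (λ u v → u · (x ^ n * y ^ v)) (nCn≡1 n) (ℕ.n∸n≡0 n) ⟩
        1 · (x ^ n * 1#) ≡⟨ +-identityʳ _ ⟩
        x ^ n * 1# ≡⟨ *-identityʳ _ ⟩
        x ^ n ∎

  frob : ℕ → A → A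
  frob n x = x ^ (p ℕ.^ n)

  frob-suc : ∀ n x → frob (suc n) x ≡ frob n (x ^ p)
  frob-suc n x = ≡.sym (^-assocʳ x p (p ℕ.^ n))

  frob-1 : ∀ x → frob 1 x ≡ x ^ p
  frob-1 x = cong (x ^_) (ℕ.*-identityʳ p)

  frob-∘ : ∀ i j x → frob i (frob j x) ≡ frob (j ℕ.+ i) x
  frob-∘ i j x = ≡.trans (^-assocʳ x (p ℕ.^ j) (p ℕ.^ i)) (cong (x ^_) (≡.sym (ℕ.^-distribˡ-+-* p j i)))

  frob-m : ∀ x → frob m x ≡ x
  frob-m = x^q≡x

  frob-+ : ∀ n x y → frob n (x + y) ≡ frob n x + frob n y
  frob-+ zero    x y = distribʳ 1# x y
  frob-+ (suc n) x y = begin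
    frob (suc n) (x + y) ≡⟨ frob-suc n (x + y) ⟩
    frob n ((x + y) ^ p) ≡⟨ cong (frob n) (^p-+ x y) ⟩
    frob n (x ^ p + y ^ p) ≡⟨ frob-+ n (x ^ p) (y ^ p) ⟩
    frob n (x ^ p) + frob n (y ^ p) ≡⟨ cong₂ _+_ (frob-suc n x) (frob-suc n y) ⟨
    frob (suc n) x + frob (suc n) y ∎

  frob-* : ∀ n x y → frob n (x * y) ≡ frob n x * frob n y
  frob-* n x y = ^-distrib-* x y (p ℕ.^ n)

  0<p^ : ∀ n → 0 ℕ.< p ℕ.^ n
  0<p^ n = ℕ.m^n>0 p n

  frob-0 : ∀ n → frob n 0# ≡ 0#
  frob-0 n = 0^n≡0 (p ℕ.^ n) (0<p^ n)

  frob-neg : ∀ n x → frob n (- x) ≡ - frob n x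
  frob-neg n x = +-cancelˡ (frob n x) (begin
    frob n x + frob n (- x) ≡⟨ frob-+ n x (- x) ⟨
    frob n (x - x) ≡⟨ cong (frob n) (-‿inverseʳ x) ⟩
    frob n 0# ≡⟨ frob-0 n ⟩
    0# ≡⟨ -‿inverseʳ (frob n x) ⟨
    frob n x - frob n x ∎)

  frob-- : ∀ n x y → frob n (x - y) ≡ frob n x - frob n y
  frob-- n x y = ≡.trans (frob-+ n x (- y)) (cong (λ z → frob n x + z) (frob-neg n y))

  frob-period : ∀ n j x → frob n x ≡ x → frob (j ℕ.* n) x ≡ x
  frob-period n zero    x fixed = *-identityʳ x
  frob-period n (suc j) x fixed = begin
    frob (n ℕ.+ j ℕ.* n) x ≡⟨ frob-∘ (j ℕ.* n) n x ⟨
    frob (j ℕ.* n) (frob n x) ≡⟨ cong (frob (j ℕ.* n)) fixed ⟩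
    frob (j ℕ.* n) x ≡⟨ frob-period n j x fixed ⟩
    x ∎

  infix 4 _∈𝔽p _∈𝔽p*
  -- The prime subfield as the fixed points of Frobenius, which makes membership decidable and its
  -- closure properties immediate; `fp-onto` identifies it with the multiples of `1#`.
  _∈𝔽p _∈𝔽p* : A → Set
  x ∈𝔽p  = x ^ p ≡ x
  x ∈𝔽p* = x ∈𝔽p × x ≢ 0#

  𝔽p? : ∀ x → Dec (x ∈𝔽p)
  𝔽p? x = x ^ p ≟ x

  𝔽p*? : ∀ x → Dec (x ∈𝔽p*)
  𝔽p*? x = 𝔽p? x ×-dec ¬? (x ≟ 0#)

  -- x is fixed by the n-th and, as every element is, by the m-th power of Frobenius, hence by the
  -- power gcd m n = 1. Bézout over ℕ comes with either sign, whence the two cases.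
  fixed⇒∈𝔽p : ∀ n → gcd m n ≡ 1 → ∀ x → frob n x ≡ x → x ∈𝔽p
  fixed⇒∈𝔽p n gcd≡1 x fixed with coprime-Bézout (gcd≡1⇒coprime gcd≡1)
  ... | Bézout.+- i j 1+jn≡im = begin
    x ^ p ≡⟨ frob-1 x ⟨
    frob 1 x ≡⟨ cong (frob 1) (frob-period n j x fixed) ⟨
    frob 1 (frob (j ℕ.* n) x) ≡⟨ frob-∘ 1 (j ℕ.* n) x ⟩
    frob (j ℕ.* n ℕ.+ 1) x ≡⟨ cong (λ e → frob e x) (≡.trans (ℕ.+-comm (j ℕ.* n) 1) 1+jn≡im) ⟩
    frob (i ℕ.* m) x ≡⟨ frob-period m i x (frob-m x) ⟩
    x ∎
  ... | Bézout.-+ i j 1+im≡jn = begin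
    x ^ p ≡⟨ frob-1 x ⟨
    frob 1 x ≡⟨ cong (frob 1) (frob-period m i x (frob-m x)) ⟨
    frob 1 (frob (i ℕ.* m) x) ≡⟨ frob-∘ 1 (i ℕ.* m) x ⟩
    frob (i ℕ.* m ℕ.+ 1) x ≡⟨ cong (λ e → frob e x) (≡.trans (ℕ.+-comm (i ℕ.* m) 1) 1+im≡jn) ⟩
    frob (j ℕ.* n) x ≡⟨ frob-period n j x fixed ⟩
    x ∎

  ∈𝔽p⇒fixed : ∀ n {x} → x ∈𝔽p → frob n x ≡ x
  ∈𝔽p⇒fixed n {x} x∈ = subst (λ e → frob e x ≡ x) (ℕ.*-identityʳ n)
    (frob-period 1 n x (≡.trans (frob-1 x) x∈))

  0∈𝔽p : 0# ∈𝔽p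
  0∈𝔽p = 0^n≡0 p 0<p

  1∈𝔽p : 1# ∈𝔽p
  1∈𝔽p = 1^n≡1 p

  +-∈𝔽p : ∀ {x y} → x ∈𝔽p → y ∈𝔽p → x + y ∈𝔽p
  +-∈𝔽p x∈ y∈ = ≡.trans (^p-+ _ _) (cong₂ _+_ x∈ y∈)

  *-∈𝔽p : ∀ {x y} → x ∈𝔽p → y ∈𝔽p → x * y ∈𝔽p
  *-∈𝔽p x∈ y∈ = ≡.trans (^-distrib-* _ _ p) (cong₂ _*_ x∈ y∈)

  neg-∈𝔽p : ∀ {x} → x ∈𝔽p → - x ∈𝔽p
  neg-∈𝔽p {x} x∈ = ≡.trans (≡.sym (frob-1 (- x))) (≡.trans (frob-neg 1 x) (cong -_ (≡.trans (frob-1 x) x∈)))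

  factor-∈𝔽p : ∀ {x y} → x ≢ 0# → x ∈𝔽p → x * y ∈𝔽p → y ∈𝔽p
  factor-∈𝔽p {x} {y} x≢0 x∈ xy∈ = *-cancelˡ x≢0 (begin
    x * y ^ p ≡⟨ cong (_* y ^ p) x∈ ⟨
    x ^ p * y ^ p ≡⟨ ^-distrib-* x y p ⟨
    (x * y) ^ p ≡⟨ xy∈ ⟩
    x * y ∎)

  inverse-∈𝔽p : ∀ {x y} → x ≢ 0# → x ∈𝔽p → x * y ≡ 1# → y ∈𝔽p
  inverse-∈𝔽p x≢0 x∈ xy≡1 = factor-∈𝔽p x≢0 x∈ (subst _∈𝔽p (≡.sym xy≡1) 1∈𝔽p)

  fp : Fin p → A
  fp j = toℕ j · 1#

  n·1∈𝔽p : ∀ n → n · 1# ∈𝔽p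
  n·1∈𝔽p zero    = 0∈𝔽p
  n·1∈𝔽p (suc n) = +-∈𝔽p 1∈𝔽p (n·1∈𝔽p n)

  -- n is coprime to p, so Bézout together with p · 1# = 0# would give 1# = 0#.
  n·1≢0 : ∀ n → 0 ℕ.< n → n ℕ.< p → n · 1# ≢ 0#
  n·1≢0 n@(suc _) 0<n n<p n·1≡0 with coprime-Bézout (prime⇒coprime p-prime n<p)
  ... | Bézout.+- i j 1+jn≡ip = 1≢0 (begin
    1# ≡⟨ +-identityʳ 1# ⟨
    1# + 0# ≡⟨ cong (λ z → 1# + z) (zeroʳ (j · 1#)) ⟨
    1# + (j · 1#) * 0# ≡⟨ cong (λ z → 1# + (j · 1#) * z) n·1≡0 ⟨
    1# + (j · 1#) * (n · 1#) ≡⟨ cong (λ z → 1# + z) (×1-homo-* j n) ⟨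
    suc (j ℕ.* n) · 1# ≡⟨ cong (_· 1#) 1+jn≡ip ⟩
    (i ℕ.* p) · 1# ≡⟨ multiple·≡0 (ℕ.n∣m*n i) 1# ⟩
    0# ∎)
  ... | Bézout.-+ i j 1+ip≡jn = 1≢0 (begin
    1# ≡⟨ +-identityʳ 1# ⟨
    1# + 0# ≡⟨ cong (λ z → 1# + z) (multiple·≡0 (ℕ.n∣m*n i) 1#) ⟨
    suc (i ℕ.* p) · 1# ≡⟨ cong (_· 1#) 1+ip≡jn ⟩
    (j ℕ.* n) · 1# ≡⟨ ×1-homo-* j n ⟩
    (j · 1#) * (n · 1#) ≡⟨ cong (j · 1# *_) n·1≡0 ⟩
    (j · 1#) * 0# ≡⟨ zeroʳ _ ⟩
    0# ∎)

  ·1-distinct : ∀ {i j} → i ℕ.< j → j ℕ.< p → i · 1# ≢ j · 1#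
  ·1-distinct {i} {j} i<j j<p eq =
    n·1≢0 (j ℕ.∸ i) (ℕ.m<n⇒0<n∸m i<j) (ℕ.≤-<-trans (ℕ.m∸n≤m j i) j<p) (+-cancelˡ (i · 1#) (begin
      i · 1# + (j ℕ.∸ i) · 1# ≡⟨ ×-homo-+ 1# i (j ℕ.∸ i) ⟨
      (i ℕ.+ (j ℕ.∸ i)) · 1# ≡⟨ cong (_· 1#) (ℕ.m+[n∸m]≡n (ℕ.<⇒≤ i<j)) ⟩
      j · 1# ≡⟨ eq ⟨
      i · 1# ≡⟨ +-identityʳ _ ⟨
      i · 1# + 0# ∎))

  ·1-injective : ∀ {i j} → i ℕ.< p → j ℕ.< p → i · 1# ≡ j · 1# → i ≡ j
  ·1-injective {i} {j} i<p j<p eq with ℕ.<-cmp i j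
  ... | tri< i<j _ _ = contradiction eq (·1-distinct i<j j<p)
  ... | tri≈ _ i≡j _ = i≡j
  ... | tri> _ _ j<i = contradiction (≡.sym eq) (·1-distinct j<i i<p)

  fp-injective : ∀ {i j} → fp i ≡ fp j → i ≡ j
  fp-injective {i} {j} eq = Fin.toℕ-injective (·1-injective (Fin.toℕ<n i) (Fin.toℕ<n j) eq)

  -- The p elements `fp i` are roots of y^p - y; a fixed point outside them would be one root too
  -- many for degree p.
  fp-onto : ∀ x → x ∈𝔽p → ∃[ i ] fp i ≡ x
  fp-onto x x∈ with Fin.any? (λ i → fp i ≟ x)
  ... | yes found = found
  ... | no absent = contradiction roots (root-bound polynomial 1+0≢0 ρ ρ-injective)
    where
    f : A → A
    f y = y ^ p + (- 1#) * y ^ 1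

    polynomial : IsPolynomial p (1# + 0#) f
    polynomial = polynomial-+ (polynomial-^ p)
      (polynomial-lower (prime>1 p-prime) (polynomial-* (- 1#) (polynomial-^ 1)))

    1+0≢0 : 1# + 0# ≢ 0#
    1+0≢0 eq = 1≢0 (≡.trans (≡.sym (+-identityʳ 1#)) eq)

    ρ : Fin (suc p) → A
    ρ zero    = x
    ρ (suc i) = fp i

    ρ-injective : ∀ {i j} → ρ i ≡ ρ j → i ≡ j
    ρ-injective {zero}  {zero}  eq = ≡.refl
    ρ-injective {zero}  {suc j} eq = contradiction (j , ≡.sym eq) absent
    ρ-injective {suc i} {zero}  eq = contradiction (i , eq) absent
    ρ-injective {suc i} {suc j} eq = cong suc (fp-injective eq)

    root : ∀ {y} → y ∈𝔽p → f y ≡ 0#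
    root {y} y∈ = ≡.trans (cong (_+ (- 1#) * y ^ 1) y∈)
      -- The solver reads `con (+ 1)` as 1# + 0#, so 1# is passed to it as a variable and y is first
      -- written as 1# * y.
      (≡.trans (cong (λ z → y + (- 1#) * z) (*-identityʳ y)) (≡.trans (cong (λ z → z + (- 1#) * y) (≡.sym (*-identityˡ y)))
        (solve 2 (λ y o → o :* y :+ (:- o) :* y := con (+ 0)) ≡.refl y 1#)))

    roots : ∀ i → f (ρ i) ≡ 0#
    roots zero    = root x∈
    roots (suc i) = root (n·1∈𝔽p (toℕ i))

  ∑-𝔽p : ∀ (f : A → ℤ) → ∑ (λ x → 𝟙 (𝔽p? x) ℤ.* f x) ≡ ∑ (λ i → f (fp i))
  ∑-𝔽p = ∑-image 𝔽p? fp fp-injective (λ i → n·1∈𝔽p (toℕ i)) fp-onto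

-- The trace and the integers `e t`

module Trace {p m : ℕ} (p-prime : Prime p) (0<m : 0 ℕ.< m) (𝔽 : FieldOn (p ℕ.^ m)) where

  open Galois p-prime 0<m 𝔽 public
  open ≡-Reasoning
  private module RΣ = Sum semiring

  powerSum : ℕ → (ℕ → ℕ) → A → A
  powerSum n e x = RΣ.sum {n} (λ i → x ^ e (toℕ i))

  Tr : A → A
  Tr = powerSum m (p ℕ.^_)

  -- Stated for any increasing exponents, since removing the first summand replaces `e` by
  -- `e ∘ suc`, which no longer has the form of powers of p starting at 1.
  powerSum-polynomial : ∀ n e → (∀ {i j} → i ℕ.< j → e i ℕ.< e j) → IsPolynomial (e n) 1# (powerSum (suc n) e)
  powerSum-polynomial zero e e-mono =
    subst (λ l → IsPolynomial (e 0) l (powerSum 1 e)) (+-identityʳ 1#)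
      (polynomial-+ (polynomial-^ (e 0)) (zero-polynomial (e 0)))
    where
    zero-polynomial : ∀ n → IsPolynomial n 0# (λ _ → 0#)
    zero-polynomial zero    = constant λ _ → ≡.refl
    zero-polynomial (suc n) = polynomial-raise (zero-polynomial n)
  powerSum-polynomial (suc n) e e-mono =
    subst (λ l → IsPolynomial (e (suc n)) l (powerSum (suc (suc n)) e)) (+-identityˡ 1#)
      (polynomial-+ (polynomial-lower (e-mono (ℕ.s≤s ℕ.z≤n)) (polynomial-^ (e 0)))
                    (powerSum-polynomial n (e ∘ suc) (e-mono ∘ ℕ.s≤s)))

  p^-mono : ∀ {i j} → i ℕ.< j → p ℕ.^ i ℕ.< p ℕ.^ j
  p^-mono = ℕ.^-monoʳ-< p (prime>1 p-prime)

  -- The trace is a monic polynomial of degree p^(m-1) < q, so it cannot vanish at all elements;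
  -- p^(m-1) + 1 of them already give a contradiction.
  Tr-nonzero : ∃[ z ] Tr z ≢ 0#
  Tr-nonzero with Fin.any? (λ z → ¬? (Tr z ≟ 0#))
  ... | yes found = found
  ... | no absent = contradiction (λ i → Tr≡0 (ρ i))
                      (root-bound polynomial 1≢0 ρ (Fin.inject≤-injective _ _ _ _))
    where
    m′ : ℕ
    m′ = ℕ.pred m

    m≡ : suc m′ ≡ m
    m≡ = ℕ.suc-pred m {{ℕ.>-nonZero 0<m}}

    polynomial : IsPolynomial (p ℕ.^ m′) 1# Tr
    polynomial = subst (λ n → IsPolynomial (p ℕ.^ m′) 1# (powerSum n (p ℕ.^_))) m≡
                   (powerSum-polynomial m′ (p ℕ.^_) p^-mono)

    ρ : Fin (suc (p ℕ.^ m′)) → A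
    ρ i = Fin.inject≤ i (p^-mono (ℕ.≤-reflexive m≡))

    Tr≡0 : ∀ z → Tr z ≡ 0#
    Tr≡0 z with Tr z ≟ 0#
    ... | yes Trz≡0 = Trz≡0
    ... | no Trz≢0  = contradiction (z , Trz≢0) absent

  Tr-+ : ∀ x y → Tr (x + y) ≡ Tr x + Tr y
  Tr-+ x y = ≡.trans (RΣ.sum-cong-≗ {m} (λ i → frob-+ (toℕ i) x y))
                     (RΣ.∑-distrib-+ {m} (λ i → frob (toℕ i) x) (λ i → frob (toℕ i) y))

  Tr-0 : Tr 0# ≡ 0#
  Tr-0 = ≡.trans (RΣ.sum-cong-≗ {m} (λ i → frob-0 (toℕ i))) (RΣ.sum-replicate-zero m)

  Tr-neg : ∀ x → Tr (- x) ≡ - Tr x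
  Tr-neg x = +-cancelˡ (Tr x) (begin
    Tr x + Tr (- x) ≡⟨ Tr-+ x (- x) ⟨
    Tr (x - x) ≡⟨ cong Tr (-‿inverseʳ x) ⟩
    Tr 0# ≡⟨ Tr-0 ⟩
    0# ≡⟨ -‿inverseʳ (Tr x) ⟨
    Tr x - Tr x ∎)

  Tr-- : ∀ x y → Tr (x - y) ≡ Tr x - Tr y
  Tr-- x y = ≡.trans (Tr-+ x (- y)) (cong (λ z → Tr x + z) (Tr-neg y))

  Tr-scale : ∀ {t} → t ∈𝔽p → ∀ x → Tr (t * x) ≡ t * Tr x
  Tr-scale {t} t∈ x = ≡.trans
    (RΣ.sum-cong-≗ {m} (λ i → ≡.trans (frob-* (toℕ i) t x) (cong (_* frob (toℕ i) x) (∈𝔽p⇒fixed (toℕ i) t∈))))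
    (≡.sym (RΣ.*-distribˡ-sum {m} t (λ i → frob (toℕ i) x)))

  ^p-sum : ∀ n (f : Fin n → A) → RΣ.sum f ^ p ≡ RΣ.sum (λ i → f i ^ p)
  ^p-sum zero    f = 0^n≡0 p 0<p
  ^p-sum (suc n) f = ≡.trans (^p-+ (f zero) (RΣ.sum (f ∘ suc))) (cong (λ z → f zero ^ p + z) (^p-sum n (f ∘ suc)))

  sum-shift : ∀ n (g : ℕ → A) →
              g 0 + RΣ.sum {n} (λ i → g (suc (toℕ i))) ≡ RΣ.sum {n} (λ i → g (toℕ i)) + g n
  sum-shift zero    g = +-comm (g 0) 0#
  sum-shift (suc n) g = ≡.trans (cong (λ z → g 0 + z) (sum-shift n (g ∘ suc))) (≡.sym (+-assoc _ _ _))

  -- Replacing x by x^p shifts the summands cyclically, because x^(p^m) = x.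
  Tr-^p : ∀ x → Tr (x ^ p) ≡ Tr x
  Tr-^p x = +-cancelˡ (frob 0 x) (begin
    frob 0 x + Tr (x ^ p)
      ≡⟨ cong (λ z → frob 0 x + z) (RΣ.sum-cong-≗ {m} (λ i → ≡.sym (frob-suc (toℕ i) x))) ⟩
    frob 0 x + RΣ.sum {m} (λ i → frob (suc (toℕ i)) x)
      ≡⟨ sum-shift m (λ i → frob i x) ⟩
    Tr x + frob m x
      ≡⟨ cong (λ z → Tr x + z) (≡.trans (frob-m x) (≡.sym (*-identityʳ x))) ⟩
    Tr x + frob 0 x
      ≡⟨ +-comm _ _ ⟩
    frob 0 x + Tr x ∎)

  Tr-frob : ∀ n x → Tr (frob n x) ≡ Tr x
  Tr-frob zero    x = cong Tr (*-identityʳ x)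
  Tr-frob (suc n) x = ≡.trans (cong Tr (frob-suc n x)) (≡.trans (Tr-frob n (x ^ p)) (Tr-^p x))

  Tr∈𝔽p : ∀ x → Tr x ∈𝔽p
  Tr∈𝔽p x = begin
    Tr x ^ p ≡⟨ ^p-sum m (λ i → frob (toℕ i) x) ⟩
    RΣ.sum {m} (λ i → frob (toℕ i) x ^ p) ≡⟨ RΣ.sum-cong-≗ {m} (λ i → ^-swap x (p ℕ.^ toℕ i)) ⟩
    Tr (x ^ p) ≡⟨ Tr-^p x ⟩
    Tr x ∎
    where
    ^-swap : ∀ x n → (x ^ n) ^ p ≡ (x ^ p) ^ n
    ^-swap x n = ≡.trans (^-assocʳ x n p) (≡.trans (cong (x ^_) (ℕ.*-comm n p)) (≡.sym (^-assocʳ x p n)))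

  Tr-onto : ∀ {t} → t ∈𝔽p → ∃[ z ] Tr z ≡ t
  Tr-onto {t} t∈ =
    let (z , Trz≢0) = Tr-nonzero
        (r , Trz*r≡1) = inverse (Tr z) Trz≢0
    in t * r * z , (begin
      Tr (t * r * z) ≡⟨ Tr-scale (*-∈𝔽p t∈ (inverse-∈𝔽p Trz≢0 (Tr∈𝔽p z) Trz*r≡1)) z ⟩
      t * r * Tr z ≡⟨ solve 3 (λ t r u → t :* r :* u := t :* (u :* r)) ≡.refl t r (Tr z) ⟩
      t * (Tr z * r) ≡⟨ cong (t *_) Trz*r≡1 ⟩
      t * 1# ≡⟨ *-identityʳ t ⟩
      t ∎)

  ∑-translate : ∀ a (f : A → ℤ) → ∑ (λ x → f (x + a)) ≡ ∑ f
  ∑-translate a f = ∑-permute f (translation a)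

  ∑-dilate : ∀ {a} → a ≢ 0# → ∀ (f : A → ℤ) → ∑ (λ x → f (a * x)) ≡ ∑ f
  ∑-dilate {a} a≢0 f = ∑-permute f (dilation a a≢0)

  ∑-fibres : (g : A → A) (f : A → ℤ) → ∑ (λ t → ∑ (λ x → 𝟙 (t ≟ g x) ℤ.* f x)) ≡ ∑ f
  ∑-fibres g f = ≡.trans (∑-swap (λ t x → 𝟙 (t ≟ g x) ℤ.* f x)) (∑-cong λ x → ∑-δ (g x) (λ _ → f x))

  traceFibre : A → ℤ
  traceFibre t = ∑ (λ z → 𝟙 (Tr z ≟ t))

  -- Translation by a preimage of t carries the kernel of the trace onto the fibre over t.
  traceFibre-constant : ∀ {t} → t ∈𝔽p → traceFibre t ≡ traceFibre 0#
  traceFibre-constant {t} t∈ = let (z₀ , Trz₀≡t) = Tr-onto t∈ in begin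
    ∑ (λ z → 𝟙 (Tr z ≟ t)) ≡⟨ ∑-translate z₀ (λ z → 𝟙 (Tr z ≟ t)) ⟨
    ∑ (λ z → 𝟙 (Tr (z + z₀) ≟ t)) ≡⟨ ∑-cong (λ z → 𝟙-cong (Tr (z + z₀) ≟ t) (Tr z ≟ 0#)
       (λ eq → +-cancelˡ t (begin
          t + Tr z ≡⟨ +-comm t (Tr z) ⟩
          Tr z + t ≡⟨ cong (λ u → Tr z + u) Trz₀≡t ⟨
          Tr z + Tr z₀ ≡⟨ Tr-+ z z₀ ⟨
          Tr (z + z₀) ≡⟨ eq ⟩
          t ≡⟨ +-identityʳ t ⟨
          t + 0# ∎))
       (λ eq → ≡.trans (Tr-+ z z₀) (≡.trans (cong₂ _+_ eq Trz₀≡t) (+-identityˡ t)))) ⟩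
    ∑ (λ z → 𝟙 (Tr z ≟ 0#)) ∎

  p*traceFibre : ∀ {t} → t ∈𝔽p → + p ℤ.* traceFibre t ≡ + q
  p*traceFibre {t} t∈ = begin
    + p ℤ.* traceFibre t ≡⟨ ∑-const p (traceFibre t) ⟨
    ∑ {p} (λ _ → traceFibre t) ≡⟨ ∑-𝔽p (λ _ → traceFibre t) ⟨
    ∑ (λ s → 𝟙 (𝔽p? s) ℤ.* traceFibre t) ≡⟨ ∑-cong (λ s → 𝟙-*-congˡ (𝔽p? s) (λ s∈ →
                                                                ≡.trans (traceFibre-constant t∈) (≡.sym (traceFibre-constant s∈)))) ⟩
    ∑ (λ s → 𝟙 (𝔽p? s) ℤ.* ∑ (λ z → 𝟙 (Tr z ≟ s))) ≡⟨ ∑-cong (λ s → ∑-*ˡ (𝟙 (𝔽p? s)) (λ z → 𝟙 (Tr z ≟ s))) ⟨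
    ∑ (λ s → ∑ (λ z → 𝟙 (𝔽p? s) ℤ.* 𝟙 (Tr z ≟ s))) ≡⟨ ∑-cong (λ s → ∑-cong (λ z → pointwise s z)) ⟩
    ∑ (λ s → ∑ (λ z → 𝟙 (s ≟ Tr z) ℤ.* + 1)) ≡⟨ ∑-fibres Tr (λ _ → + 1) ⟩
    ∑ {q} (λ _ → + 1) ≡⟨ ∑-const q (+ 1) ⟩
    + q ℤ.* + 1 ≡⟨ ℤ.*-identityʳ (+ q) ⟩
    + q ∎
    where
    pointwise : ∀ s z → 𝟙 (𝔽p? s) ℤ.* 𝟙 (Tr z ≟ s) ≡ 𝟙 (s ≟ Tr z) ℤ.* + 1
    pointwise s z with s ≟ Tr z
    ... | yes ≡.refl = cong₂ ℤ._*_ (𝟙-yes (𝔽p? s) (Tr∈𝔽p z)) (𝟙-yes (s ≟ s) ≡.refl)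
    ... | no s≢      = ≡.trans (cong (𝟙 (𝔽p? s) ℤ.*_) (𝟙-no (Tr z ≟ s) (s≢ ∘ ≡.sym))) (ℤ.*-zeroʳ (𝟙 (𝔽p? s)))

  -- e(t) is the sum of χ(yt) over y ∈ 𝔽p*, for t ∈ 𝔽p and χ a nontrivial additive character.
  opaque
    e : A → ℤ
    e t = + p ℤ.* 𝟙 (t ≟ 0#) ℤ.- + 1

    e-def : ∀ t → e t ≡ + p ℤ.* 𝟙 (t ≟ 0#) ℤ.- + 1
    e-def t = ≡.refl

  e-0 : e 0# ≡ + p ℤ.- + 1
  e-0 = ≡.trans (e-def 0#) $ cong (ℤ._- + 1) (≡.trans (cong (+ p ℤ.*_) (𝟙-yes (0# ≟ 0#) ≡.refl)) (ℤ.*-identityʳ (+ p)))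

  e-nonzero : ∀ {t} → t ≢ 0# → e t ≡ ℤ.- + 1
  e-nonzero {t} t≢0 = ≡.trans (e-def t) $ cong (ℤ._- + 1) (≡.trans (cong (+ p ℤ.*_) (𝟙-no (t ≟ 0#) t≢0)) (ℤ.*-zeroʳ (+ p)))

  e-scale : ∀ {a} → a ≢ 0# → ∀ t → e (a * t) ≡ e t
  e-scale {a} a≢0 t = ≡.trans (e-def (a * t)) (≡.trans (cong (λ z → + p ℤ.* z ℤ.- + 1)
    (𝟙-cong (a * t ≟ 0#) (t ≟ 0#) (λ at≡0 → *-nonzeroˡ at≡0 a≢0) (λ t≡0 → ≡.trans (cong (a *_) t≡0) (zeroʳ a))))
    (≡.sym (e-def t)))

  ∑-e : ∀ {n} (f : Fin n → A) → ∑ (λ x → e (f x)) ≡ + p ℤ.* ∑ (λ x → 𝟙 (f x ≟ 0#)) ℤ.- + n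
  ∑-e {n} f = begin
    ∑ (λ x → e (f x)) ≡⟨ ∑-cong (λ x → e-def (f x)) ⟩
    ∑ (λ x → + p ℤ.* 𝟙 (f x ≟ 0#) ℤ.- + 1) ≡⟨ ∑-- (λ x → + p ℤ.* 𝟙 (f x ≟ 0#)) (λ _ → + 1) ⟩
    ∑ (λ x → + p ℤ.* 𝟙 (f x ≟ 0#)) ℤ.- ∑ {n} (λ _ → + 1)
      ≡⟨ cong₂ ℤ._-_ (∑-*ˡ (+ p) (λ x → 𝟙 (f x ≟ 0#))) (≡.trans (∑-const n (+ 1)) (ℤ.*-identityʳ (+ n))) ⟩
    + p ℤ.* ∑ (λ x → 𝟙 (f x ≟ 0#)) ℤ.- + n ∎

  -- Orthogonality of characters without characters: for w ≠ 0 the map z ↦ Tr (w z) meets each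
  -- element of 𝔽p equally often, and the values of `e` over 𝔽p sum to (p - 1) - (p - 1).
  ∑-e-linear : ∀ {w t} → w ≢ 0# → t ∈𝔽p → ∑ (λ z → e (Tr (w * z) + t)) ≡ + 0
  ∑-e-linear {w} {t} w≢0 t∈ = begin
    ∑ (λ z → e (Tr (w * z) + t)) ≡⟨ ∑-dilate w≢0 (λ z → e (Tr z + t)) ⟩
    ∑ (λ z → e (Tr z + t)) ≡⟨ ∑-e (λ z → Tr z + t) ⟩
    + p ℤ.* ∑ (λ z → 𝟙 (Tr z + t ≟ 0#)) ℤ.- + q ≡⟨ cong (λ s → + p ℤ.* s ℤ.- + q) (∑-cong λ z →
       𝟙-cong (Tr z + t ≟ 0#) (Tr z ≟ - t)
         (λ eq → x-y≡0⇒x≡y (≡.trans (solve 2 (λ x t → x :- (:- t) := x :+ t) ≡.refl (Tr z) t) eq))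
         (λ eq → ≡.trans (cong (_+ t) eq) (-‿inverseˡ t))) ⟩
    + p ℤ.* traceFibre (- t) ℤ.- + q ≡⟨ cong (ℤ._- + q) (p*traceFibre (neg-∈𝔽p t∈)) ⟩
    + q ℤ.- + q ≡⟨ ℤ.+-inverseʳ (+ q) ⟩
    + 0 ∎

  ∑-e-linear′ : ∀ w {t} → t ∈𝔽p → ∑ (λ z → e (Tr (w * z) + t)) ≡ 𝟙 (w ≟ 0#) ℤ.* (+ q ℤ.* e t)
  ∑-e-linear′ w {t} t∈ with w ≟ 0#
  ... | no w≢0     = ∑-e-linear w≢0 t∈
  ... | yes ≡.refl = begin
    ∑ (λ z → e (Tr (0# * z) + t)) ≡⟨ ∑-cong (λ z → cong e (≡.trans (cong (_+ t) (≡.trans (cong Tr (zeroˡ z)) Tr-0)) (+-identityˡ t))) ⟩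
    ∑ {q} (λ _ → e t) ≡⟨ ∑-const q (e t) ⟩
    + q ℤ.* e t ≡⟨ ℤ.*-identityˡ _ ⟨
    + 1 ℤ.* (+ q ℤ.* e t) ∎

  𝟙𝔽p* : ∀ x → 𝟙 (𝔽p*? x) ≡ 𝟙 (𝔽p? x) ℤ.- 𝟙 (x ≟ 0#)
  𝟙𝔽p* x with 𝔽p? x | x ≟ 0#
  ... | yes _   | yes _      = ≡.refl
  ... | yes _   | no _       = ≡.refl
  ... | no x∉   | yes ≡.refl = contradiction 0∈𝔽p x∉
  ... | no _    | no _       = ≡.refl

  ∑-𝔽p* : (f : A → ℤ) → ∑ (λ x → 𝟙 (𝔽p*? x) ℤ.* f x) ≡ ∑ (λ x → 𝟙 (𝔽p? x) ℤ.* f x) ℤ.- f 0#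
  ∑-𝔽p* f = begin
    ∑ (λ x → 𝟙 (𝔽p*? x) ℤ.* f x)
      ≡⟨ ∑-cong (λ x → ≡.trans (cong (ℤ._* f x) (𝟙𝔽p* x)) (distrib (𝟙 (𝔽p? x)) (𝟙 (x ≟ 0#)) (f x))) ⟩
    ∑ (λ x → 𝟙 (𝔽p? x) ℤ.* f x ℤ.- 𝟙 (x ≟ 0#) ℤ.* f x)
      ≡⟨ ∑-- (λ x → 𝟙 (𝔽p? x) ℤ.* f x) (λ x → 𝟙 (x ≟ 0#) ℤ.* f x) ⟩
    ∑ (λ x → 𝟙 (𝔽p? x) ℤ.* f x) ℤ.- ∑ (λ x → 𝟙 (x ≟ 0#) ℤ.* f x)
      ≡⟨ cong (λ s → ∑ (λ x → 𝟙 (𝔽p? x) ℤ.* f x) ℤ.- s) (∑-δ 0# f) ⟩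
    ∑ (λ x → 𝟙 (𝔽p? x) ℤ.* f x) ℤ.- f 0# ∎
    where
    distrib : ∀ a b c → (a ℤ.- b) ℤ.* c ≡ a ℤ.* c ℤ.- b ℤ.* c
    distrib = ℤ-Solver.solve-∀

  ∑-𝔽p-const : ∀ c → ∑ (λ x → 𝟙 (𝔽p? x) ℤ.* c) ≡ + p ℤ.* c
  ∑-𝔽p-const c = ≡.trans (∑-𝔽p (λ _ → c)) (∑-const p c)

  ∑-𝔽p*-const : ∀ c → ∑ (λ x → 𝟙 (𝔽p*? x) ℤ.* c) ≡ (+ p ℤ.- + 1) ℤ.* c
  ∑-𝔽p*-const c = ≡.trans (∑-𝔽p* (λ _ → c)) (≡.trans (cong (ℤ._- c) (∑-𝔽p-const c)) (factor (+ p) c))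
    where
    factor : ∀ p c → p ℤ.* c ℤ.- c ≡ (p ℤ.- + 1) ℤ.* c
    factor = ℤ-Solver.solve-∀

  -- As character sums: substitute z′ = z y in Σ_z χ(zt) Σ_z′ χ(z′t′).
  e-* : ∀ {t t′} → t ∈𝔽p → t′ ∈𝔽p → e t ℤ.* e t′ ≡ ∑ (λ y → 𝟙 (𝔽p*? y) ℤ.* e (t + y * t′))
  e-* {t} {t′} t∈ t′∈ with t′ ≟ 0#
  ... | yes ≡.refl = begin
    e t ℤ.* e 0# ≡⟨ cong (e t ℤ.*_) e-0 ⟩
    e t ℤ.* (+ p ℤ.- + 1) ≡⟨ ℤ.*-comm (e t) _ ⟩
    (+ p ℤ.- + 1) ℤ.* e t ≡⟨ ∑-𝔽p*-const (e t) ⟨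
    ∑ (λ y → 𝟙 (𝔽p*? y) ℤ.* e t) ≡⟨ ∑-cong (λ y → cong (λ z → 𝟙 (𝔽p*? y) ℤ.* e z)
                                                            (≡.sym (≡.trans (cong (λ z → t + z) (zeroʳ y)) (+-identityʳ t)))) ⟩
    ∑ (λ y → 𝟙 (𝔽p*? y) ℤ.* e (t + y * 0#)) ∎
  ... | no t′≢0 = begin
    e t ℤ.* e t′ ≡⟨ cong (e t ℤ.*_) (e-nonzero t′≢0) ⟩
    e t ℤ.* (ℤ.- + 1) ≡⟨ negate (+ p) (e t) ⟩
    -- The sum over all y in 𝔽p is p · 1 - p · 1 = 0, because exactly one y makes the argument
    -- vanish; discarding y = 0 then leaves - e t.
    (+ p ℤ.* + 1 ℤ.- + p ℤ.* + 1) ℤ.- e t ≡⟨ cong₂ ℤ._-_ (≡.sym total) (cong e (≡.sym (≡.trans (cong (λ z → t + z) (zeroˡ t′)) (+-identityʳ t)))) ⟩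
    ∑ (λ y → 𝟙 (𝔽p? y) ℤ.* e (t + y * t′)) ℤ.- e (t + 0# * t′) ≡⟨ ∑-𝔽p* (λ y → e (t + y * t′)) ⟨
    ∑ (λ y → 𝟙 (𝔽p*? y) ℤ.* e (t + y * t′)) ∎
    where
    negate : ∀ p x → x ℤ.* (ℤ.- + 1) ≡ (p ℤ.* + 1 ℤ.- p ℤ.* + 1) ℤ.- x
    negate = ℤ-Solver.solve-∀

    r y₀ : A
    r = proj₁ (inverse t′ t′≢0)
    y₀ = - t * r

    t′r≡1 : t′ * r ≡ 1#
    t′r≡1 = proj₂ (inverse t′ t′≢0)

    y₀∈ : y₀ ∈𝔽p
    y₀∈ = *-∈𝔽p (neg-∈𝔽p t∈) (inverse-∈𝔽p t′≢0 t′∈ t′r≡1)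

    root : t + y₀ * t′ ≡ 0#
    root = begin
      t + - t * r * t′ ≡⟨ solve 3 (λ t r u → t :+ (:- t) :* r :* u := t :- t :* (u :* r)) ≡.refl t r t′ ⟩
      t - t * (t′ * r) ≡⟨ cong (λ z → t - t * z) t′r≡1 ⟩
      t - t * 1# ≡⟨ cong (λ z → t - z) (*-identityʳ t) ⟩
      t - t ≡⟨ -‿inverseʳ t ⟩
      0# ∎

    unique : ∀ y → t + y * t′ ≡ 0# → y ≡ y₀
    unique y eq = *-cancelˡ t′≢0 (≡.trans (*-comm t′ y)
      (≡.trans (+-cancelˡ t (≡.trans eq (≡.sym root))) (*-comm y₀ t′)))

    pointwise : ∀ y → 𝟙 (𝔽p? y) ℤ.* e (t + y * t′) ≡ + p ℤ.* (𝟙 (y ≟ y₀) ℤ.* 𝟙 (𝔽p? y)) ℤ.- 𝟙 (𝔽p? y) ℤ.* + 1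
    pointwise y = ≡.trans
      (cong (𝟙 (𝔽p? y) ℤ.*_) (≡.trans (e-def (t + y * t′)) $ cong (λ z → + p ℤ.* z ℤ.- + 1) $
        𝟙-cong (t + y * t′ ≟ 0#) (y ≟ y₀) (unique y) (λ { ≡.refl → root })))
      (expand (+ p) (𝟙 (𝔽p? y)) (𝟙 (y ≟ y₀)))
      where
      expand : ∀ p a b → a ℤ.* (p ℤ.* b ℤ.- + 1) ≡ p ℤ.* (b ℤ.* a) ℤ.- a ℤ.* + 1
      expand = ℤ-Solver.solve-∀

    total : ∑ (λ y → 𝟙 (𝔽p? y) ℤ.* e (t + y * t′)) ≡ + p ℤ.* + 1 ℤ.- + p ℤ.* + 1
    total = begin
      ∑ (λ y → 𝟙 (𝔽p? y) ℤ.* e (t + y * t′))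
        ≡⟨ ∑-cong pointwise ⟩
      ∑ (λ y → + p ℤ.* (𝟙 (y ≟ y₀) ℤ.* 𝟙 (𝔽p? y)) ℤ.- 𝟙 (𝔽p? y) ℤ.* + 1)
        ≡⟨ ∑-- (λ y → + p ℤ.* (𝟙 (y ≟ y₀) ℤ.* 𝟙 (𝔽p? y))) (λ y → 𝟙 (𝔽p? y) ℤ.* + 1) ⟩
      ∑ (λ y → + p ℤ.* (𝟙 (y ≟ y₀) ℤ.* 𝟙 (𝔽p? y))) ℤ.- ∑ (λ y → 𝟙 (𝔽p? y) ℤ.* + 1)
        ≡⟨ cong₂ ℤ._-_ (∑-*ˡ (+ p) (λ y → 𝟙 (y ≟ y₀) ℤ.* 𝟙 (𝔽p? y))) (∑-𝔽p-const (+ 1)) ⟩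
      + p ℤ.* ∑ (λ y → 𝟙 (y ≟ y₀) ℤ.* 𝟙 (𝔽p? y)) ℤ.- + p ℤ.* + 1
        ≡⟨ cong (λ z → + p ℤ.* z ℤ.- + p ℤ.* + 1) (≡.trans (∑-δ y₀ (λ y → 𝟙 (𝔽p? y))) (𝟙-yes (𝔽p? y₀) y₀∈)) ⟩
      + p ℤ.* + 1 ℤ.- + p ℤ.* + 1 ∎

-- The forms Tr(α x² + c x σ(x)) and the moments of T

module QuadraticForms {p m : ℕ} (p-prime : Prime p) (2<p : 2 ℕ.< p) (h : ℕ) (m≡2h+1 : m ≡ h ℕ.* 2 ℕ.+ 1) (0<m : 0 ℕ.< m)
               (𝔽 : FieldOn (p ℕ.^ m)) (k : ℕ) where

  open Trace p-prime 0<m 𝔽 public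
  open ≡-Reasoning

  doubling-injective : ∀ {x} → x + x ≡ 0# → x ≡ 0#
  doubling-injective {x} x+x≡0 = *-nonzeroˡ (begin
    (1# + (1# + 0#)) * x ≡⟨ solve 2 (λ x o → (o :+ (o :+ con (+ 0))) :* x := o :* x :+ o :* x) ≡.refl x 1# ⟩
    1# * x + 1# * x ≡⟨ cong₂ _+_ (*-identityˡ x) (*-identityˡ x) ⟩
    x + x ≡⟨ x+x≡0 ⟩
    0# ∎) (n·1≢0 2 (ℕ.s≤s ℕ.z≤n) 2<p)

  x*x≡0⇒x≡0 : ∀ {x} → x * x ≡ 0# → x ≡ 0#
  x*x≡0⇒x≡0 {x} xx≡0 with x ≟ 0#
  ... | yes x≡0 = x≡0
  ... | no  x≢0 = *-nonzeroˡ xx≡0 x≢0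

  -- A square root of an element of 𝔽p lies in 𝔽p² ∩ 𝔽q, which is 𝔽p as m is odd.
  sqrt-∈𝔽p : ∀ {t} → t * t ∈𝔽p → t ∈𝔽p
  sqrt-∈𝔽p {t} tt∈ with t ^ p - t ≟ 0#
  ... | yes eq = x-y≡0⇒x≡y eq
  ... | no neq = subst _∈𝔽p (≡.sym t≡0) 0∈𝔽p
    where
    t^p≡-t : t ^ p ≡ - t
    t^p≡-t = x-y≡0⇒x≡y (*-nonzeroˡ (begin
      (t ^ p - t) * (t ^ p - - t) ≡⟨ solve 2 (λ u t → (u :- t) :* (u :- (:- t)) := u :* u :- t :* t) ≡.refl (t ^ p) t ⟩
      t ^ p * t ^ p - t * t ≡⟨ cong (_- t * t) (≡.trans (≡.sym (^-distrib-* t t p)) tt∈) ⟩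
      t * t - t * t ≡⟨ -‿inverseʳ (t * t) ⟩
      0# ∎) neq)

    frob2 : frob 2 t ≡ t
    frob2 = begin
      frob 2 t ≡⟨ frob-suc 1 t ⟩
      frob 1 (t ^ p) ≡⟨ cong (frob 1) t^p≡-t ⟩
      frob 1 (- t) ≡⟨ frob-neg 1 t ⟩
      - frob 1 t ≡⟨ cong -_ (≡.trans (frob-1 t) t^p≡-t) ⟩
      - - t ≡⟨ solve 1 (λ t → :- (:- t) := t) ≡.refl t ⟩
      t ∎

    t≡-t : t ≡ - t
    t≡-t = begin
      t ≡⟨ frob-m t ⟨
      frob m t ≡⟨ cong (λ n → frob n t) m≡2h+1 ⟩
      frob (h ℕ.* 2 ℕ.+ 1) t ≡⟨ frob-∘ 1 (h ℕ.* 2) t ⟨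
      frob 1 (frob (h ℕ.* 2) t) ≡⟨ cong (frob 1) (frob-period 2 h t frob2) ⟩
      frob 1 t ≡⟨ ≡.trans (frob-1 t) t^p≡-t ⟩
      - t ∎

    t≡0 : t ≡ 0#
    t≡0 = doubling-injective (≡.trans (cong (λ z → t + z) t≡-t) (-‿inverseʳ t))

  σ : A → A
  σ = frob k

  Q : A → A → A → A
  Q α c x = Tr (α * (x * x) + c * (x * σ x))

  Q∈𝔽p : ∀ α c x → Q α c x ∈𝔽p
  Q∈𝔽p α c x = Tr∈𝔽p _

  T : A → A → ℤ
  T α c = ∑ (λ x → e (Q α c x))

  Tr-0* : ∀ {u} c → u ≡ 0# → Tr (c * u) ≡ 0#
  Tr-0* c ≡.refl = ≡.trans (cong Tr (zeroʳ c)) Tr-0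

  -- Q is linear in α with coefficient x², so by orthogonality only x = 0 contributes to the sum
  -- over α.
  first-moment : ∀ c → ∑ (λ α → T α c) ≡ + q ℤ.* (+ p ℤ.- + 1)
  first-moment c = begin
    ∑ (λ α → ∑ (λ x → e (Q α c x)))
      ≡⟨ ∑-swap (λ α x → e (Q α c x)) ⟩
    ∑ (λ x → ∑ (λ α → e (Q α c x)))
      ≡⟨ ∑-cong (λ x → ∑-cong (λ α → cong e (≡.trans (Tr-+ _ _) (cong (λ z → Tr z + Tr (c * (x * σ x))) (*-comm α (x * x)))))) ⟩
    ∑ (λ x → ∑ (λ α → e (Tr (x * x * α) + Tr (c * (x * σ x)))))
      ≡⟨ ∑-cong (λ x → ∑-e-linear′ (x * x) (Tr∈𝔽p _)) ⟩
    ∑ (λ x → 𝟙 (x * x ≟ 0#) ℤ.* (+ q ℤ.* e (Tr (c * (x * σ x)))))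
      ≡⟨ ∑-cong (λ x → cong (ℤ._* (+ q ℤ.* e (Tr (c * (x * σ x)))))
           (𝟙-cong (x * x ≟ 0#) (x ≟ 0#) x*x≡0⇒x≡0 (λ { ≡.refl → zeroˡ 0# }))) ⟩
    ∑ (λ x → 𝟙 (x ≟ 0#) ℤ.* (+ q ℤ.* e (Tr (c * (x * σ x)))))
      ≡⟨ ∑-δ 0# (λ x → + q ℤ.* e (Tr (c * (x * σ x)))) ⟩
    + q ℤ.* e (Tr (c * (0# * σ 0#)))
      ≡⟨ cong (λ z → + q ℤ.* z) (≡.trans (cong e (Tr-0* c (zeroˡ (σ 0#)))) e-0) ⟩
    + q ℤ.* (+ p ℤ.- + 1) ∎

  -- This makes the second moment independent of c. With x = x′ t the hypothesis reads t² = -y, so t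
  -- is in 𝔽p and fixed by σ; both expressions then contain the same factor t² + y.
  isotropic : ∀ {y} → y ∈𝔽p → ∀ x x′ → x * x + y * (x′ * x′) ≡ 0# → x * σ x + y * (x′ * σ x′) ≡ 0#
  isotropic {y} y∈ x x′ eq with x′ ≟ 0#
  ... | yes ≡.refl = begin
    x * σ x + y * (0# * σ 0#) ≡⟨ cong (λ z → z * σ z + y * (0# * σ 0#)) x≡0 ⟩
    0# * σ 0# + y * (0# * σ 0#) ≡⟨ solve 2 (λ y s → con (+ 0) :* s :+ y :* (con (+ 0) :* s) := con (+ 0)) ≡.refl y (σ 0#) ⟩
    0# ∎
    where
    x≡0 : x ≡ 0#
    x≡0 = x*x≡0⇒x≡0 (≡.trans (solve 2 (λ x y → x :* x := x :* x :+ y :* (con (+ 0) :* con (+ 0))) ≡.refl x y) eq)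
  ... | no x′≢0 = begin
    x * σ x + y * (x′ * σ x′) ≡⟨ cong (λ z → z * σ z + y * (x′ * σ x′)) x≡x′t ⟩
    x′ * t * σ (x′ * t) + y * (x′ * σ x′) ≡⟨ cong (λ z → x′ * t * z + y * (x′ * σ x′)) (≡.trans (frob-* k x′ t) (cong (σ x′ *_) (∈𝔽p⇒fixed k t∈))) ⟩
    x′ * t * (σ x′ * t) + y * (x′ * σ x′) ≡⟨ solve 4 (λ x t s y → x :* t :* (s :* t) :+ y :* (x :* s) := x :* s :* (t :* t :+ y)) ≡.refl x′ t (σ x′) y ⟩
    x′ * σ x′ * (t * t + y) ≡⟨ cong (x′ * σ x′ *_) tt+y≡0 ⟩
    x′ * σ x′ * 0# ≡⟨ zeroʳ _ ⟩
    0# ∎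
    where
    r t : A
    r = proj₁ (inverse x′ x′≢0)
    t = r * x

    x≡x′t : x ≡ x′ * t
    x≡x′t = begin
      x ≡⟨ *-identityˡ x ⟨
      1# * x ≡⟨ cong (_* x) (proj₂ (inverse x′ x′≢0)) ⟨
      x′ * r * x ≡⟨ *-assoc x′ r x ⟩
      x′ * t ∎

    tt+y≡0 : t * t + y ≡ 0#
    tt+y≡0 = *-nonzeroˡ (begin
      x′ * x′ * (t * t + y) ≡⟨ solve 3 (λ x t y → x :* x :* (t :* t :+ y) := x :* t :* (x :* t) :+ y :* (x :* x)) ≡.refl x′ t y ⟩
      x′ * t * (x′ * t) + y * (x′ * x′) ≡⟨ cong (λ z → z * z + y * (x′ * x′)) x≡x′t ⟨
      x * x + y * (x′ * x′) ≡⟨ eq ⟩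
      0# ∎) (*-nonzero x′≢0 x′≢0)

    t∈ : t ∈𝔽p
    t∈ = sqrt-∈𝔽p (subst _∈𝔽p (x-y≡0⇒x≡y (≡.trans (solve 2 (λ t y → (:- y) :- t :* t := :- (t :* t :+ y)) ≡.refl t y)
           (≡.trans (cong -_ tt+y≡0) (solve 0 (:- con (+ 0) := con (+ 0)) ≡.refl)))) (neg-∈𝔽p y∈))

  -- For x′ ≠ 0 the solutions are x = x′ t, y = - t² with t in 𝔽p*. For x′ = 0 they are x = 0 with y
  -- arbitrary. Both cases give p - 1.
  isotropic-count : ∀ x′ → ∑ (λ x → ∑ (λ y → 𝟙 (𝔽p*? y) ℤ.* 𝟙 (x * x + y * (x′ * x′) ≟ 0#))) ≡ + p ℤ.- + 1
  isotropic-count x′ with x′ ≟ 0#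
  ... | yes ≡.refl = begin
    ∑ (λ x → ∑ (λ y → 𝟙 (𝔽p*? y) ℤ.* 𝟙 (x * x + y * (0# * 0#) ≟ 0#)))
      ≡⟨ ∑-cong (λ x → ∑-cong (λ y → cong (𝟙 (𝔽p*? y) ℤ.*_) (𝟙-cong (x * x + y * (0# * 0#) ≟ 0#) (x ≟ 0#)
           (λ eq → x*x≡0⇒x≡0 (≡.trans (≡.sym (simplify x y)) eq))
           (λ { ≡.refl → ≡.trans (simplify 0# y) (zeroˡ 0#) })))) ⟩
    ∑ (λ x → ∑ (λ y → 𝟙 (𝔽p*? y) ℤ.* 𝟙 (x ≟ 0#)))
      ≡⟨ ∑-cong (λ x → ≡.trans (∑-𝔽p*-const (𝟙 (x ≟ 0#))) (ℤ.*-comm (+ p ℤ.- + 1) _)) ⟩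
    ∑ (λ x → 𝟙 (x ≟ 0#) ℤ.* (+ p ℤ.- + 1))
      ≡⟨ ∑-δ 0# (λ _ → + p ℤ.- + 1) ⟩
    + p ℤ.- + 1 ∎
    where
    simplify : ∀ x y → x * x + y * (0# * 0#) ≡ x * x
    simplify x y = solve 2 (λ x y → x :* x :+ y :* (con (+ 0) :* con (+ 0)) := x :* x) ≡.refl x y
  ... | no x′≢0 = begin
    ∑ (λ x → ∑ (λ y → 𝟙 (𝔽p*? y) ℤ.* 𝟙 (x * x + y * (x′ * x′) ≟ 0#)))
      ≡⟨ ∑-dilate x′≢0 (λ x → ∑ (λ y → 𝟙 (𝔽p*? y) ℤ.* 𝟙 (x * x + y * (x′ * x′) ≟ 0#))) ⟨
    ∑ (λ t → ∑ (λ y → 𝟙 (𝔽p*? y) ℤ.* 𝟙 (x′ * t * (x′ * t) + y * (x′ * x′) ≟ 0#)))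
      ≡⟨ ∑-cong (λ t → ∑-cong (λ y → ≡.trans (cong (𝟙 (𝔽p*? y) ℤ.*_)
           (𝟙-cong (x′ * t * (x′ * t) + y * (x′ * x′) ≟ 0#) (y ≟ - (t * t)) (toRoot t y) (fromRoot t y)))
           (ℤ.*-comm (𝟙 (𝔽p*? y)) _))) ⟩
    ∑ (λ t → ∑ (λ y → 𝟙 (y ≟ - (t * t)) ℤ.* 𝟙 (𝔽p*? y)))
      ≡⟨ ∑-cong (λ t → ∑-δ (- (t * t)) (λ y → 𝟙 (𝔽p*? y))) ⟩
    ∑ (λ t → 𝟙 (𝔽p*? (- (t * t))))
      ≡⟨ ∑-cong (λ t → ≡.trans (𝟙-cong (𝔽p*? (- (t * t))) (𝔽p*? t) (rootUnit t) (unitRoot t)) (≡.sym (ℤ.*-identityʳ _))) ⟩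
    ∑ (λ t → 𝟙 (𝔽p*? t) ℤ.* + 1)
      ≡⟨ ≡.trans (∑-𝔽p*-const (+ 1)) (ℤ.*-identityʳ _) ⟩
    + p ℤ.- + 1 ∎
    where
    collect : ∀ t y → x′ * t * (x′ * t) + y * (x′ * x′) ≡ x′ * x′ * (y - - (t * t))
    collect t y = solve 3 (λ x t y → x :* t :* (x :* t) :+ y :* (x :* x) := x :* x :* (y :- (:- (t :* t)))) ≡.refl x′ t y

    toRoot : ∀ t y → x′ * t * (x′ * t) + y * (x′ * x′) ≡ 0# → y ≡ - (t * t)
    toRoot t y eq = x-y≡0⇒x≡y (*-nonzeroˡ (≡.trans (≡.sym (collect t y)) eq) (*-nonzero x′≢0 x′≢0))

    fromRoot : ∀ t y → y ≡ - (t * t) → x′ * t * (x′ * t) + y * (x′ * x′) ≡ 0#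
    fromRoot t _ ≡.refl = ≡.trans (collect t _) (≡.trans (cong (x′ * x′ *_) (-‿inverseʳ _)) (zeroʳ _))

    rootUnit : ∀ t → - (t * t) ∈𝔽p* → t ∈𝔽p*
    rootUnit t (-tt∈ , -tt≢0) = sqrt-∈𝔽p (subst _∈𝔽p (solve 1 (λ t → :- (:- (t :* t)) := t :* t) ≡.refl t) (neg-∈𝔽p -tt∈)) ,
      λ { ≡.refl → -tt≢0 (solve 0 (:- (con (+ 0) :* con (+ 0)) := con (+ 0)) ≡.refl) }

    unitRoot : ∀ t → t ∈𝔽p* → - (t * t) ∈𝔽p*
    unitRoot t (t∈ , t≢0) = neg-∈𝔽p (*-∈𝔽p t∈ t∈) , λ -tt≡0 → *-nonzero t≢0 t≢0
      (≡.trans (solve 1 (λ t → t :* t := :- (:- (t :* t))) ≡.refl t) (≡.trans (cong -_ -tt≡0) (solve 0 (:- con (+ 0) := con (+ 0)) ≡.refl)))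

  ∑-product : ∀ {a b} (f : Fin a → ℤ) (g : Fin b → ℤ) → ∑ f ℤ.* ∑ g ≡ ∑ (λ x → ∑ (λ y → f x ℤ.* g y))
  ∑-product f g = ≡.trans (≡.sym (∑-*ʳ (∑ g) f)) (∑-cong λ x → ≡.sym (∑-*ˡ (f x) g))

  -- `e-*` merges the two factors into one value of e at Q x + y Q x′, which is again linear in α.
  -- Orthogonality leaves the isotropic pairs, and `isotropic` makes the surviving value e 0.
  second-moment : ∀ c → ∑ (λ α → T α c ℤ.* T α c) ≡ + q ℤ.* (+ p ℤ.- + 1) ℤ.* (+ q ℤ.* (+ p ℤ.- + 1))
  second-moment c = begin
    ∑ (λ α → T α c ℤ.* T α c)
      ≡⟨ ∑-cong (λ α → ∑-product (λ x → e (Q α c x)) (λ x → e (Q α c x))) ⟩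
    ∑ (λ α → ∑ (λ x → ∑ (λ x′ → e (Q α c x) ℤ.* e (Q α c x′))))
      ≡⟨ ∑-cong (λ α → ∑-cong (λ x → ∑-cong (λ x′ → e-* (Q∈𝔽p α c x) (Q∈𝔽p α c x′)))) ⟩
    ∑ (λ α → ∑ (λ x → ∑ (λ x′ → ∑ (λ y → 𝟙 (𝔽p*? y) ℤ.* e (Q α c x + y * Q α c x′)))))
      ≡⟨ ∑-swap (λ α x → ∑ (λ x′ → ∑ (λ y → 𝟙 (𝔽p*? y) ℤ.* e (Q α c x + y * Q α c x′)))) ⟩
    ∑ (λ x → ∑ (λ α → ∑ (λ x′ → ∑ (λ y → 𝟙 (𝔽p*? y) ℤ.* e (Q α c x + y * Q α c x′)))))
      ≡⟨ ∑-cong (λ x → ∑-swap (λ α x′ → ∑ (λ y → 𝟙 (𝔽p*? y) ℤ.* e (Q α c x + y * Q α c x′)))) ⟩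
    ∑ (λ x → ∑ (λ x′ → ∑ (λ α → ∑ (λ y → 𝟙 (𝔽p*? y) ℤ.* e (Q α c x + y * Q α c x′)))))
      ≡⟨ ∑-cong (λ x → ∑-cong (λ x′ → ∑-swap (λ α y → 𝟙 (𝔽p*? y) ℤ.* e (Q α c x + y * Q α c x′)))) ⟩
    ∑ (λ x → ∑ (λ x′ → ∑ (λ y → ∑ (λ α → 𝟙 (𝔽p*? y) ℤ.* e (Q α c x + y * Q α c x′)))))
      ≡⟨ ∑-cong (λ x → ∑-cong (λ x′ → ∑-cong (λ y → ≡.trans (∑-*ˡ (𝟙 (𝔽p*? y)) (λ α → e (Q α c x + y * Q α c x′)))
           (𝟙-*-congˡ (𝔽p*? y) (innerSum x x′ y))))) ⟩
    ∑ (λ x → ∑ (λ x′ → ∑ (λ y → 𝟙 (𝔽p*? y) ℤ.* (𝟙 (x * x + y * (x′ * x′) ≟ 0#) ℤ.* (+ q ℤ.* (+ p ℤ.- + 1))))))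
      ≡⟨ ∑-swap (λ x x′ → ∑ (λ y → 𝟙 (𝔽p*? y) ℤ.* (𝟙 (x * x + y * (x′ * x′) ≟ 0#) ℤ.* (+ q ℤ.* (+ p ℤ.- + 1))))) ⟩
    ∑ (λ x′ → ∑ (λ x → ∑ (λ y → 𝟙 (𝔽p*? y) ℤ.* (𝟙 (x * x + y * (x′ * x′) ≟ 0#) ℤ.* (+ q ℤ.* (+ p ℤ.- + 1))))))
      ≡⟨ ∑-cong (λ x′ → ≡.trans (≡.trans (∑-cong (λ x → ≡.trans
           (∑-cong (λ y → ≡.sym (ℤ.*-assoc (𝟙 (𝔽p*? y)) (𝟙 (x * x + y * (x′ * x′) ≟ 0#)) _)))
           (∑-*ʳ (+ q ℤ.* (+ p ℤ.- + 1)) (λ y → 𝟙 (𝔽p*? y) ℤ.* 𝟙 (x * x + y * (x′ * x′) ≟ 0#)))))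
           (∑-*ʳ (+ q ℤ.* (+ p ℤ.- + 1)) (λ x → ∑ (λ y → 𝟙 (𝔽p*? y) ℤ.* 𝟙 (x * x + y * (x′ * x′) ≟ 0#)))))
           (cong (ℤ._* (+ q ℤ.* (+ p ℤ.- + 1))) (isotropic-count x′))) ⟩
    ∑ {q} (λ x′ → (+ p ℤ.- + 1) ℤ.* (+ q ℤ.* (+ p ℤ.- + 1)))
      ≡⟨ ∑-const q _ ⟩
    + q ℤ.* ((+ p ℤ.- + 1) ℤ.* (+ q ℤ.* (+ p ℤ.- + 1)))
      ≡⟨ ℤ.*-assoc (+ q) (+ p ℤ.- + 1) _ ⟨
    + q ℤ.* (+ p ℤ.- + 1) ℤ.* (+ q ℤ.* (+ p ℤ.- + 1)) ∎
    where
    combine : ∀ x x′ {y} → y ∈𝔽p → ∀ α → Q α c x + y * Q α c x′ ≡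
              Tr ((x * x + y * (x′ * x′)) * α) + Tr (c * (x * σ x + y * (x′ * σ x′)))
    combine x x′ {y} y∈ α = begin
      Q α c x + y * Q α c x′
        ≡⟨ cong (λ z → Q α c x + z) (Tr-scale y∈ _) ⟨
      Q α c x + Tr (y * (α * (x′ * x′) + c * (x′ * σ x′)))
        ≡⟨ Tr-+ _ _ ⟨
      Tr (α * (x * x) + c * (x * σ x) + y * (α * (x′ * x′) + c * (x′ * σ x′)))
        ≡⟨ cong Tr (solve 7 (λ α c y x s x′ s′ → α :* (x :* x) :+ c :* (x :* s) :+ y :* (α :* (x′ :* x′) :+ c :* (x′ :* s′))
             := (x :* x :+ y :* (x′ :* x′)) :* α :+ c :* (x :* s :+ y :* (x′ :* s′))) ≡.refl α c y x (σ x) x′ (σ x′)) ⟩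
      Tr ((x * x + y * (x′ * x′)) * α + c * (x * σ x + y * (x′ * σ x′)))
        ≡⟨ Tr-+ _ _ ⟩
      Tr ((x * x + y * (x′ * x′)) * α) + Tr (c * (x * σ x + y * (x′ * σ x′))) ∎

    innerSum : ∀ x x′ y → y ∈𝔽p* → ∑ (λ α → e (Q α c x + y * Q α c x′)) ≡
               𝟙 (x * x + y * (x′ * x′) ≟ 0#) ℤ.* (+ q ℤ.* (+ p ℤ.- + 1))
    innerSum x x′ y (y∈ , _) = begin
      ∑ (λ α → e (Q α c x + y * Q α c x′))
        ≡⟨ ∑-cong (λ α → cong e (combine x x′ y∈ α)) ⟩
      ∑ (λ α → e (Tr ((x * x + y * (x′ * x′)) * α) + Tr (c * (x * σ x + y * (x′ * σ x′)))))
        ≡⟨ ∑-e-linear′ (x * x + y * (x′ * x′)) (Tr∈𝔽p _) ⟩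
      𝟙 (x * x + y * (x′ * x′) ≟ 0#) ℤ.* (+ q ℤ.* e (Tr (c * (x * σ x + y * (x′ * σ x′)))))
        ≡⟨ 𝟙-*-congˡ (x * x + y * (x′ * x′) ≟ 0#) (λ eq → cong (λ z → + q ℤ.* z)
             (≡.trans (cong e (Tr-0* c (isotropic y∈ x x′ eq))) e-0)) ⟩
      𝟙 (x * x + y * (x′ * x′) ≟ 0#) ℤ.* (+ q ℤ.* (+ p ℤ.- + 1)) ∎

  -- The two square classes of 𝔽p*

  module SquareClasses (u : A) (u∈ : u ∈𝔽p) (u-nonsquare : ∀ s → s ∈𝔽p → s * s ≢ u) where

    u≢0 : u ≢ 0#
    u≢0 u≡0 = u-nonsquare 0# 0∈𝔽p (≡.trans (zeroˡ 0#) (≡.sym u≡0))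

    s*s∈ : ∀ {s} → s ∈𝔽p* → s * s ∈𝔽p*
    s*s∈ (s∈ , s≢0) = *-∈𝔽p s∈ s∈ , *-nonzero s≢0 s≢0

    u*s*s∈ : ∀ {s} → s ∈𝔽p* → u * (s * s) ∈𝔽p*
    u*s*s∈ s∈ = *-∈𝔽p u∈ (proj₁ (s*s∈ s∈)) , *-nonzero u≢0 (proj₂ (s*s∈ s∈))

    classesDisjoint : ∀ {s s′} → s ∈𝔽p* → s′ ∈𝔽p* → s * s ≢ u * (s′ * s′)
    classesDisjoint {s} {s′} (s∈ , s≢0) (s′∈ , s′≢0) eq =
      u-nonsquare (s * r) (*-∈𝔽p s∈ (inverse-∈𝔽p s′≢0 s′∈ s′r≡1)) (begin
        s * r * (s * r) ≡⟨ solve 2 (λ s r → s :* r :* (s :* r) := s :* s :* (r :* r)) ≡.refl s r ⟩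
        s * s * (r * r) ≡⟨ cong (_* (r * r)) eq ⟩
        u * (s′ * s′) * (r * r) ≡⟨ solve 3 (λ u s r → u :* (s :* s) :* (r :* r) := u :* (s :* r :* (s :* r))) ≡.refl u s′ r ⟩
        u * (s′ * r * (s′ * r)) ≡⟨ cong (λ z → u * (z * z)) s′r≡1 ⟩
        u * (1# * 1#) ≡⟨ cong (u *_) (*-identityˡ 1#) ⟩
        u * 1# ≡⟨ *-identityʳ u ⟩
        u ∎)
      where
      r : A
      r = proj₁ (inverse s′ s′≢0)

      s′r≡1 : s′ * r ≡ 1#
      s′r≡1 = proj₂ (inverse s′ s′≢0)

    squares-equal : ∀ {s s′} → s * s ≡ s′ * s′ → s ≡ s′ ⊎ s ≡ - s′
    squares-equal {s} {s′} eq with s - s′ ≟ 0#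
    ... | yes s-s′≡0 = inj₁ (x-y≡0⇒x≡y s-s′≡0)
    ... | no s-s′≢0  = inj₂ (x-y≡0⇒x≡y (*-nonzeroˡ (begin
      (s - s′) * (s - - s′) ≡⟨ solve 2 (λ s t → (s :- t) :* (s :- (:- t)) := s :* s :- t :* t) ≡.refl s s′ ⟩
      s * s - s′ * s′ ≡⟨ cong (_- s′ * s′) eq ⟩
      s′ * s′ - s′ * s′ ≡⟨ -‿inverseʳ _ ⟩
      0# ∎) s-s′≢0))

    Represents : A → A → Set
    Represents j s = s * s ≡ j ⊎ u * (s * s) ≡ j

    represents-unique : ∀ {j s s′} → s ∈𝔽p* → s′ ∈𝔽p* → Represents j s → Represents j s′ → s ≡ s′ ⊎ s ≡ - s′
    represents-unique s∈ s′∈ (inj₁ eq) (inj₁ eq′) = squares-equal (≡.trans eq (≡.sym eq′))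
    represents-unique s∈ s′∈ (inj₁ eq) (inj₂ eq′) = contradiction (≡.trans eq (≡.sym eq′)) (classesDisjoint s∈ s′∈)
    represents-unique s∈ s′∈ (inj₂ eq) (inj₁ eq′) = contradiction (≡.trans eq′ (≡.sym eq)) (classesDisjoint s′∈ s∈)
    represents-unique s∈ s′∈ (inj₂ eq) (inj₂ eq′) = squares-equal (*-cancelˡ u≢0 (≡.trans eq (≡.sym eq′)))

    representations : A → A → ℤ
    representations j s = 𝟙 (𝔽p*? s) ℤ.* (𝟙 (j ≟ s * s) ℤ.+ 𝟙 (j ≟ u * (s * s)))

    representations-none : ∀ j s → ¬ (s ∈𝔽p* × Represents j s) → representations j s ≡ + 0
    representations-none j s none with 𝔽p*? s | j ≟ s * s | j ≟ u * (s * s)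
    ... | no _   | _      | _      = ≡.refl
    ... | yes s∈ | yes eq | _      = contradiction (s∈ , inj₁ (≡.sym eq)) none
    ... | yes s∈ | no _   | yes eq = contradiction (s∈ , inj₂ (≡.sym eq)) none
    ... | yes s∈ | no _   | no _   = ≡.refl

    representations≤1 : ∀ j s → representations j s ℤ.≤ + 1
    representations≤1 j s with 𝔽p*? s | j ≟ s * s | j ≟ u * (s * s)
    ... | no _   | _      | _      = ℤ.+≤+ ℕ.z≤n
    ... | yes s∈ | yes eq | yes eq′ = contradiction (≡.trans (≡.sym eq) eq′) (classesDisjoint s∈ s∈)
    ... | yes s∈ | yes _  | no _   = ℤ.≤-refl
    ... | yes s∈ | no _   | yes _  = ℤ.≤-refl
    ... | yes s∈ | no _   | no _   = ℤ.+≤+ ℕ.z≤n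

    totalRepresentations : A → ℤ
    totalRepresentations j = ∑ (representations j)

    -- All representations of j belong to one square class, as the classes are disjoint, and within
    -- a class s is determined up to sign.
    totalRepresentations≤2 : ∀ j → totalRepresentations j ℤ.≤ + 2
    totalRepresentations≤2 j with Fin.any? (λ s → 𝔽p*? s ×-dec (s * s ≟ j ⊎-dec u * (s * s) ≟ j))
    ... | no none = subst (ℤ._≤ + 2)
      (≡.sym (≡.trans (∑-cong (λ s → representations-none j s (λ r → none (s , r)))) (∑-0 q))) (ℤ.+≤+ ℕ.z≤n)
    ... | yes (s₀ , s₀∈ , rep₀) = subst (totalRepresentations j ℤ.≤_)
      (≡.trans (∑-+ (λ s → 𝟙 (s ≟ s₀)) (λ s → 𝟙 (s ≟ - s₀))) (cong₂ ℤ._+_ (∑-𝟙≟ s₀) (∑-𝟙≟ (- s₀))))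
      (∑-≤ bound)
      where
      bound : ∀ s → representations j s ℤ.≤ 𝟙 (s ≟ s₀) ℤ.+ 𝟙 (s ≟ - s₀)
      bound s with s ≟ s₀ | s ≟ - s₀
      ... | yes _ | yes _ = ℤ.≤-trans (representations≤1 j s) (ℤ.+≤+ (ℕ.s≤s ℕ.z≤n))
      ... | yes _ | no _  = representations≤1 j s
      ... | no _  | yes _ = representations≤1 j s
      ... | no s≢s₀ | no s≢-s₀ = ℤ.≤-reflexive (representations-none j s λ (s∈ , rep) →
        ⊎.[ s≢s₀ , s≢-s₀ ] (represents-unique s∈ s₀∈ rep rep₀))

    ∑-classes : (g : A → ℤ) → ∑ (λ j → totalRepresentations j ℤ.* g j) ≡
                ∑ (λ s → 𝟙 (𝔽p*? s) ℤ.* (g (s * s) ℤ.+ g (u * (s * s))))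
    ∑-classes g = begin
      ∑ (λ j → ∑ (representations j) ℤ.* g j)
        ≡⟨ ∑-cong (λ j → ∑-*ʳ (g j) (representations j)) ⟨
      ∑ (λ j → ∑ (λ s → representations j s ℤ.* g j))
        ≡⟨ ∑-swap (λ j s → representations j s ℤ.* g j) ⟩
      ∑ (λ s → ∑ (λ j → representations j s ℤ.* g j))
        ≡⟨ ∑-cong (λ s → ≡.trans (∑-cong (λ j → distrib (𝟙 (𝔽p*? s)) (𝟙 (j ≟ s * s)) (𝟙 (j ≟ u * (s * s))) (g j)))
             (∑-*ˡ (𝟙 (𝔽p*? s)) (λ j → 𝟙 (j ≟ s * s) ℤ.* g j ℤ.+ 𝟙 (j ≟ u * (s * s)) ℤ.* g j))) ⟩
      ∑ (λ s → 𝟙 (𝔽p*? s) ℤ.* ∑ (λ j → 𝟙 (j ≟ s * s) ℤ.* g j ℤ.+ 𝟙 (j ≟ u * (s * s)) ℤ.* g j))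
        ≡⟨ ∑-cong (λ s → cong (𝟙 (𝔽p*? s) ℤ.*_) (≡.trans (∑-+ (λ j → 𝟙 (j ≟ s * s) ℤ.* g j) (λ j → 𝟙 (j ≟ u * (s * s)) ℤ.* g j))
             (cong₂ ℤ._+_ (∑-δ (s * s) g) (∑-δ (u * (s * s)) g)))) ⟩
      ∑ (λ s → 𝟙 (𝔽p*? s) ℤ.* (g (s * s) ℤ.+ g (u * (s * s)))) ∎
      where
      distrib : ∀ a b c g → a ℤ.* (b ℤ.+ c) ℤ.* g ≡ a ℤ.* (b ℤ.* g ℤ.+ c ℤ.* g)
      distrib = ℤ-Solver.solve-∀

    -- Every j ∈ 𝔽p* is represented at most twice, and the total number of
    -- representations is 2(p-1), so every j is represented exactly twice.
    represented-twice : ∀ {j} → j ∈𝔽p* → totalRepresentations j ≡ + 2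
    represented-twice {j} j∈ = ≡.sym (ℤ.i-j≡0⇒i≡j (+ 2) (totalRepresentations j) (begin
      + 2 ℤ.- totalRepresentations j ≡⟨ ℤ.*-identityˡ _ ⟨
      + 1 ℤ.* (+ 2 ℤ.- totalRepresentations j) ≡⟨ cong (ℤ._* (+ 2 ℤ.- totalRepresentations j)) (𝟙-yes (𝔽p*? j) j∈) ⟨
      𝟙 (𝔽p*? j) ℤ.* (+ 2 ℤ.- totalRepresentations j) ≡⟨ ∑-zero⇒zero deficit deficit≥0 ∑deficit≡0 j ⟩
      + 0 ∎))
      where
      deficit : A → ℤ
      deficit j = 𝟙 (𝔽p*? j) ℤ.* (+ 2 ℤ.- totalRepresentations j)

      deficit≥0 : ∀ j → + 0 ℤ.≤ deficit j
      deficit≥0 j with 𝔽p*? j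
      ... | yes _ = subst (+ 0 ℤ.≤_) (≡.sym (ℤ.*-identityˡ _)) (ℤ.i≤j⇒0≤j-i (totalRepresentations≤2 j))
      ... | no _  = ℤ.≤-refl

      ∑deficit≡0 : ∑ deficit ≡ + 0
      ∑deficit≡0 = begin
        ∑ (λ j → 𝟙 (𝔽p*? j) ℤ.* (+ 2 ℤ.- totalRepresentations j))
          ≡⟨ ∑-cong (λ j → distrib (𝟙 (𝔽p*? j)) (totalRepresentations j)) ⟩
        ∑ (λ j → 𝟙 (𝔽p*? j) ℤ.* + 2 ℤ.- totalRepresentations j ℤ.* 𝟙 (𝔽p*? j))
          ≡⟨ ∑-- (λ j → 𝟙 (𝔽p*? j) ℤ.* + 2) (λ j → totalRepresentations j ℤ.* 𝟙 (𝔽p*? j)) ⟩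
        ∑ (λ j → 𝟙 (𝔽p*? j) ℤ.* + 2) ℤ.- ∑ (λ j → totalRepresentations j ℤ.* 𝟙 (𝔽p*? j))
          ≡⟨ cong (λ z → ∑ (λ j → 𝟙 (𝔽p*? j) ℤ.* + 2) ℤ.- z) (≡.trans (∑-classes (λ j → 𝟙 (𝔽p*? j)))
               (∑-cong (λ s → 𝟙-*-congˡ (𝔽p*? s) (λ s∈ → cong₂ ℤ._+_ (𝟙-yes (𝔽p*? (s * s)) (s*s∈ s∈)) (𝟙-yes (𝔽p*? (u * (s * s))) (u*s*s∈ s∈)))))) ⟩
        ∑ (λ j → 𝟙 (𝔽p*? j) ℤ.* + 2) ℤ.- ∑ (λ j → 𝟙 (𝔽p*? j) ℤ.* + 2)
          ≡⟨ ℤ.+-inverseʳ (∑ (λ j → 𝟙 (𝔽p*? j) ℤ.* + 2)) ⟩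
        + 0 ∎
        where
        distrib : ∀ a t → a ℤ.* (+ 2 ℤ.- t) ≡ a ℤ.* + 2 ℤ.- t ℤ.* a
        distrib = ℤ-Solver.solve-∀

    -- Parametrises 𝔽p* two-to-one by the values s² and u s², so that a sum over it splits into
    -- square classes with no choice of representatives and no quadratic character.
    ∑-𝔽p*-classes : (g : A → ℤ) → ∑ (λ s → 𝟙 (𝔽p*? s) ℤ.* (g (s * s) ℤ.+ g (u * (s * s)))) ≡
                    + 2 ℤ.* ∑ (λ j → 𝟙 (𝔽p*? j) ℤ.* g j)
    ∑-𝔽p*-classes g = begin
      ∑ (λ s → 𝟙 (𝔽p*? s) ℤ.* (g (s * s) ℤ.+ g (u * (s * s))))
        -- `represented-twice` speaks of 𝔽p* only, so g is first cut off outside it.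
        ≡⟨ ∑-cong (λ s → 𝟙-*-congˡ (𝔽p*? s) (λ s∈ → ≡.sym (cong₂ ℤ._+_ (restrict (s*s∈ s∈)) (restrict (u*s*s∈ s∈))))) ⟩
      ∑ (λ s → 𝟙 (𝔽p*? s) ℤ.* (g* (s * s) ℤ.+ g* (u * (s * s))))
        ≡⟨ ∑-classes g* ⟨
      ∑ (λ j → totalRepresentations j ℤ.* (𝟙 (𝔽p*? j) ℤ.* g j))
        ≡⟨ ∑-cong (λ j → ≡.trans (rearrange (totalRepresentations j) (𝟙 (𝔽p*? j)) (g j))
             (≡.trans (𝟙-*-congˡ (𝔽p*? j) (λ j∈ → cong (ℤ._* g j) (represented-twice j∈))) (rearrange′ (𝟙 (𝔽p*? j)) (g j)))) ⟩
      ∑ (λ j → + 2 ℤ.* (𝟙 (𝔽p*? j) ℤ.* g j))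
        ≡⟨ ∑-*ˡ (+ 2) (λ j → 𝟙 (𝔽p*? j) ℤ.* g j) ⟩
      + 2 ℤ.* ∑ (λ j → 𝟙 (𝔽p*? j) ℤ.* g j) ∎
      where
      g* : A → ℤ
      g* j = 𝟙 (𝔽p*? j) ℤ.* g j

      restrict : ∀ {j} → j ∈𝔽p* → g* j ≡ g j
      restrict {j} j∈ = ≡.trans (cong (ℤ._* g j) (𝟙-yes (𝔽p*? j) j∈)) (ℤ.*-identityˡ (g j))

      rearrange : ∀ t a g → t ℤ.* (a ℤ.* g) ≡ a ℤ.* (t ℤ.* g)
      rearrange = ℤ-Solver.solve-∀

      rearrange′ : ∀ a g → a ℤ.* (+ 2 ℤ.* g) ≡ + 2 ℤ.* (a ℤ.* g)
      rearrange′ = ℤ-Solver.solve-∀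

  -- Polar form, radical and the norm equation

  k′ : ℕ
  k′ = k ℕ.* ℕ.pred m

  -- The inverse of σ written as a power of Frobenius: k′ + k is a multiple of the period m.
  τ : A → A
  τ = frob k′

  k′+k≡k*m : k′ ℕ.+ k ≡ k ℕ.* m
  k′+k≡k*m = ≡.trans (ℕ.+-comm k′ k) (≡.trans (≡.sym (ℕ.*-suc k (ℕ.pred m))) (cong (k ℕ.*_) (ℕ.suc-pred m {{ℕ.>-nonZero 0<m}})))

  τσ : ∀ x → τ (σ x) ≡ x
  τσ x = ≡.trans (frob-∘ k′ k x) (≡.trans (cong (λ n → frob n x) (≡.trans (ℕ.+-comm k k′) k′+k≡k*m)) (frob-period m k x (frob-m x)))

  στ : ∀ x → σ (τ x) ≡ x
  στ x = ≡.trans (frob-∘ k k′ x) (≡.trans (cong (λ n → frob n x) k′+k≡k*m) (frob-period m k x (frob-m x)))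

  module _ (α c : A) where

    -- The polar form of Q is (v , x) ↦ Tr (L v * x).
    L : A → A
    L v = α * v + α * v + c * σ v + τ (c * v)

    radicalSize : ℤ
    radicalSize = ∑ (λ v → 𝟙 (L v ≟ 0#))

    -- The trace is invariant under τ, so σ passes from one factor to its inverse on the other.
    Tr-adjoint : ∀ v x → Tr (c * (v * σ x)) ≡ Tr (τ (c * v) * x)
    Tr-adjoint v x = begin
      Tr (c * (v * σ x)) ≡⟨ Tr-frob k′ _ ⟨
      Tr (τ (c * (v * σ x))) ≡⟨ cong (Tr ∘ τ) (*-assoc c v (σ x)) ⟨
      Tr (τ (c * v * σ x)) ≡⟨ cong Tr (frob-* k′ (c * v) (σ x)) ⟩
      Tr (τ (c * v) * τ (σ x)) ≡⟨ cong (λ z → Tr (τ (c * v) * z)) (τσ x) ⟩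
      Tr (τ (c * v) * x) ∎

    Q-difference : ∀ v x → Q α c (x + v) - Q α c x ≡ Tr (L v * x) + Q α c v
    Q-difference v x = begin
      Q α c (x + v) - Q α c x
        ≡⟨ cong (λ z → Tr (α * ((x + v) * (x + v)) + c * ((x + v) * z)) - Q α c x) (frob-+ k x v) ⟩
      Tr (α * ((x + v) * (x + v)) + c * ((x + v) * (σ x + σ v))) - Q α c x
        ≡⟨ Tr-- _ _ ⟨
      Tr (α * ((x + v) * (x + v)) + c * ((x + v) * (σ x + σ v)) - (α * (x * x) + c * (x * σ x)))
        ≡⟨ cong Tr (solve 6 (λ α c x v s t →
             α :* ((x :+ v) :* (x :+ v)) :+ c :* ((x :+ v) :* (s :+ t)) :- (α :* (x :* x) :+ c :* (x :* s)) :=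
             (α :* v :+ α :* v :+ c :* t) :* x :+ c :* (v :* s) :+ (α :* (v :* v) :+ c :* (v :* t))) ≡.refl α c x v (σ x) (σ v)) ⟩
      Tr ((α * v + α * v + c * σ v) * x + c * (v * σ x) + (α * (v * v) + c * (v * σ v)))
        ≡⟨ Tr-+ _ _ ⟩
      Tr ((α * v + α * v + c * σ v) * x + c * (v * σ x)) + Q α c v
        ≡⟨ cong (_+ Q α c v) (polar v x) ⟩
      Tr (L v * x) + Q α c v ∎
      where
      polar : ∀ v x → Tr ((α * v + α * v + c * σ v) * x + c * (v * σ x)) ≡ Tr (L v * x)
      polar v x = begin
        Tr ((α * v + α * v + c * σ v) * x + c * (v * σ x)) ≡⟨ Tr-+ _ _ ⟩
        Tr ((α * v + α * v + c * σ v) * x) + Tr (c * (v * σ x)) ≡⟨ cong (λ z → Tr ((α * v + α * v + c * σ v) * x) + z) (Tr-adjoint v x) ⟩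
        Tr ((α * v + α * v + c * σ v) * x) + Tr (τ (c * v) * x) ≡⟨ Tr-+ _ _ ⟨
        Tr ((α * v + α * v + c * σ v) * x + τ (c * v) * x) ≡⟨ cong Tr (distribʳ x _ _) ⟨
        Tr (L v * x) ∎

    -- 2 Q(v) is the polar form at (v , v), and 2 is invertible.
    Q-radical : ∀ v → L v ≡ 0# → Q α c v ≡ 0#
    Q-radical v Lv≡0 = doubling-injective (begin
      Q α c v + Q α c v
        ≡⟨ Tr-+ _ _ ⟨
      Tr (α * (v * v) + c * (v * σ v) + (α * (v * v) + c * (v * σ v)))
        ≡⟨ cong Tr (solve 4 (λ α c v s → α :* (v :* v) :+ c :* (v :* s) :+ (α :* (v :* v) :+ c :* (v :* s)) :=
             (α :* v :+ α :* v :+ c :* s) :* v :+ c :* (v :* s)) ≡.refl α c v (σ v)) ⟩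
      Tr ((α * v + α * v + c * σ v) * v + c * (v * σ v))
        ≡⟨ ≡.trans (Tr-+ _ _) (≡.trans (cong (λ z → Tr ((α * v + α * v + c * σ v) * v) + z) (Tr-adjoint v v)) (≡.sym (Tr-+ _ _))) ⟩
      Tr ((α * v + α * v + c * σ v) * v + τ (c * v) * v)
        ≡⟨ cong Tr (distribʳ v _ _) ⟨
      Tr (L v * v)
        ≡⟨ cong (λ z → Tr (z * v)) Lv≡0 ⟩
      Tr (0# * v)
        ≡⟨ ≡.trans (cong Tr (zeroˡ v)) Tr-0 ⟩
      0# ∎)

    N : A → ℤ
    N j = ∑ (λ x → 𝟙 (j ≟ Q α c x))

    ∑-values : (G : A → ℤ) → ∑ (λ j → 𝟙 (𝔽p? j) ℤ.* (N j ℤ.* G j)) ≡ ∑ (λ x → G (Q α c x))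
    ∑-values G = begin
      ∑ (λ j → 𝟙 (𝔽p? j) ℤ.* (∑ (λ x → 𝟙 (j ≟ Q α c x)) ℤ.* G j))
        ≡⟨ ∑-cong (λ j → ≡.trans (rearrange (𝟙 (𝔽p? j)) (N j) (G j)) (≡.sym (∑-*ʳ (𝟙 (𝔽p? j) ℤ.* G j) (λ x → 𝟙 (j ≟ Q α c x))))) ⟩
      ∑ (λ j → ∑ (λ x → 𝟙 (j ≟ Q α c x) ℤ.* (𝟙 (𝔽p? j) ℤ.* G j)))
        ≡⟨ ∑-swap (λ j x → 𝟙 (j ≟ Q α c x) ℤ.* (𝟙 (𝔽p? j) ℤ.* G j)) ⟩
      ∑ (λ x → ∑ (λ j → 𝟙 (j ≟ Q α c x) ℤ.* (𝟙 (𝔽p? j) ℤ.* G j)))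
        ≡⟨ ∑-cong (λ x → ≡.trans (∑-δ (Q α c x) (λ j → 𝟙 (𝔽p? j) ℤ.* G j))
             (≡.trans (cong (ℤ._* G (Q α c x)) (𝟙-yes (𝔽p? (Q α c x)) (Q∈𝔽p α c x))) (ℤ.*-identityˡ _))) ⟩
      ∑ (λ x → G (Q α c x)) ∎
      where
      rearrange : ∀ a n g → a ℤ.* (n ℤ.* g) ≡ n ℤ.* (a ℤ.* g)
      rearrange = ℤ-Solver.solve-∀

    ∑N≡q : ∑ (λ j → 𝟙 (𝔽p? j) ℤ.* N j) ≡ + q
    ∑N≡q = begin
      ∑ (λ j → 𝟙 (𝔽p? j) ℤ.* N j) ≡⟨ ∑-cong (λ j → cong (𝟙 (𝔽p? j) ℤ.*_) (≡.sym (ℤ.*-identityʳ (N j)))) ⟩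
      ∑ (λ j → 𝟙 (𝔽p? j) ℤ.* (N j ℤ.* + 1)) ≡⟨ ∑-values (λ _ → + 1) ⟩
      ∑ {q} (λ _ → + 1) ≡⟨ ∑-const q (+ 1) ⟩
      + q ℤ.* + 1 ≡⟨ ℤ.*-identityʳ (+ q) ⟩
      + q ∎

    N² : ℤ
    N² = ∑ (λ j → 𝟙 (𝔽p? j) ℤ.* (N j ℤ.* N j))

    -- Both sides evaluate the sum of e(Q y - Q x) over all x and y. Grouping by the values of Q
    -- gives the left side. Putting y = x + v makes the argument affine in x with slope `L v`, so
    -- only v in the radical survive, each contributing q (p - 1).
    distances : + p ℤ.* N² ℤ.- + q ℤ.* + q ≡ + q ℤ.* ((+ p ℤ.- + 1) ℤ.* radicalSize)
    distances = begin
      + p ℤ.* N² ℤ.- + q ℤ.* + q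
        ≡⟨ cong (λ z → + p ℤ.* z ℤ.- + q ℤ.* + q) (∑-values N) ⟩
      + p ℤ.* ∑ (λ x → N (Q α c x)) ℤ.- + q ℤ.* + q
        ≡⟨ cong₂ ℤ._-_ (≡.sym (∑-*ˡ (+ p) (λ x → N (Q α c x)))) (≡.sym (∑-const q (+ q))) ⟩
      ∑ (λ x → + p ℤ.* N (Q α c x)) ℤ.- ∑ {q} (λ x → + q)
        ≡⟨ ∑-- (λ x → + p ℤ.* N (Q α c x)) (λ _ → + q) ⟨
      ∑ (λ x → + p ℤ.* N (Q α c x) ℤ.- + q)
        ≡⟨ ∑-cong (λ x → cong (λ z → + p ℤ.* z ℤ.- + q) (∑-cong (λ y → 𝟙-cong (Q α c x ≟ Q α c y) (Q α c y - Q α c x ≟ 0#)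
             (λ eq → ≡.trans (cong (_- Q α c x) (≡.sym eq)) (-‿inverseʳ _)) (λ eq → ≡.sym (x-y≡0⇒x≡y eq))))) ⟩
      ∑ (λ x → + p ℤ.* ∑ (λ y → 𝟙 (Q α c y - Q α c x ≟ 0#)) ℤ.- + q)
        ≡⟨ ∑-cong (λ x → ∑-e (λ y → Q α c y - Q α c x)) ⟨
      ∑ (λ x → ∑ (λ y → e (Q α c y - Q α c x)))
        ≡⟨ ∑-cong (λ x → ≡.trans (≡.sym (∑-translate x (λ y → e (Q α c y - Q α c x))))
             (∑-cong (λ v → cong e (≡.trans (cong (λ z → Q α c z - Q α c x) (+-comm v x)) (Q-difference v x))))) ⟩
      ∑ (λ x → ∑ (λ v → e (Tr (L v * x) + Q α c v)))
        ≡⟨ ∑-swap (λ x v → e (Tr (L v * x) + Q α c v)) ⟩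
      ∑ (λ v → ∑ (λ x → e (Tr (L v * x) + Q α c v)))
        ≡⟨ ∑-cong (λ v → ≡.trans (∑-e-linear′ (L v) (Q∈𝔽p α c v))
             (𝟙-*-congˡ (L v ≟ 0#) (λ Lv≡0 → cong (λ z → + q ℤ.* z) (≡.trans (cong e (Q-radical v Lv≡0)) e-0)))) ⟩
      ∑ (λ v → 𝟙 (L v ≟ 0#) ℤ.* (+ q ℤ.* (+ p ℤ.- + 1)))
        ≡⟨ ∑-*ʳ (+ q ℤ.* (+ p ℤ.- + 1)) (λ v → 𝟙 (L v ≟ 0#)) ⟩
      radicalSize ℤ.* (+ q ℤ.* (+ p ℤ.- + 1))
        ≡⟨ rearrange radicalSize (+ q) (+ p ℤ.- + 1) ⟩
      + q ℤ.* ((+ p ℤ.- + 1) ℤ.* radicalSize) ∎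
      where
      rearrange : ∀ r q s → r ℤ.* (q ℤ.* s) ≡ q ℤ.* (s ℤ.* r)
      rearrange = ℤ-Solver.solve-∀

    Q-scale : ∀ {s} → s ∈𝔽p → ∀ x → Q α c (s * x) ≡ s * s * Q α c x
    Q-scale {s} s∈ x = begin
      Tr (α * (s * x * (s * x)) + c * (s * x * σ (s * x)))
        ≡⟨ cong (λ z → Tr (α * (s * x * (s * x)) + c * (s * x * z))) (≡.trans (frob-* k s x) (cong (_* σ x) (∈𝔽p⇒fixed k s∈))) ⟩
      Tr (α * (s * x * (s * x)) + c * (s * x * (s * σ x)))
        ≡⟨ cong Tr (solve 5 (λ α c s x t → α :* (s :* x :* (s :* x)) :+ c :* (s :* x :* (s :* t)) :=
             s :* s :* (α :* (x :* x) :+ c :* (x :* t))) ≡.refl α c s x (σ x)) ⟩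
      Tr (s * s * (α * (x * x) + c * (x * σ x)))
        ≡⟨ Tr-scale (*-∈𝔽p s∈ s∈) _ ⟩
      s * s * Q α c x ∎

    N-scale : ∀ {s} → s ∈𝔽p* → ∀ j → N (s * s * j) ≡ N j
    N-scale {s} (s∈ , s≢0) j = begin
      ∑ (λ x → 𝟙 (s * s * j ≟ Q α c x)) ≡⟨ ∑-dilate s≢0 (λ x → 𝟙 (s * s * j ≟ Q α c x)) ⟨
      ∑ (λ x → 𝟙 (s * s * j ≟ Q α c (s * x))) ≡⟨ ∑-cong (λ x → 𝟙-cong (s * s * j ≟ Q α c (s * x)) (j ≟ Q α c x)
                                                        (λ eq → *-cancelˡ (*-nonzero s≢0 s≢0) (≡.trans eq (Q-scale s∈ x)))
                                                        (λ eq → ≡.trans (cong (s * s *_) eq) (≡.sym (Q-scale s∈ x)))) ⟩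
      ∑ (λ x → 𝟙 (j ≟ Q α c x)) ∎

    Q-neg : ∀ x → Q α c (- x) ≡ Q α c x
    Q-neg x = cong Tr (≡.trans (cong (λ z → α * (- x * - x) + c * (- x * z)) (frob-neg k x))
      (solve 4 (λ α c x s → α :* (:- x :* :- x) :+ c :* (:- x :* :- s) := α :* (x :* x) :+ c :* (x :* s)) ≡.refl α c x (σ x)))

    Q-0 : Q α c 0# ≡ 0#
    Q-0 = ≡.trans (cong Tr (solve 3 (λ α c s → α :* (con (+ 0) :* con (+ 0)) :+ c :* (con (+ 0) :* s) := con (+ 0)) ≡.refl α c (σ 0#))) Tr-0

    -- For j ≢ 0 the solutions of Q x ≡ j come in pairs ± x; one of each pair is
    -- selected by the order on Fin q.
    N-even : ∀ {j} → j ≢ 0# → ∃[ n ] N j ≡ + 2 ℤ.* n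
    N-even {j} j≢0 = positive , (begin
      ∑ (λ x → 𝟙 (j ≟ Q α c x))
        ≡⟨ ∑-cong split ⟩
      ∑ (λ x → 𝟙 (j ≟ Q α c x) ℤ.* 𝟙 (x Fin.<? - x) ℤ.+ 𝟙 (j ≟ Q α c x) ℤ.* 𝟙 (- x Fin.<? x))
        ≡⟨ ∑-+ (λ x → 𝟙 (j ≟ Q α c x) ℤ.* 𝟙 (x Fin.<? - x)) (λ x → 𝟙 (j ≟ Q α c x) ℤ.* 𝟙 (- x Fin.<? x)) ⟩
      positive ℤ.+ ∑ (λ x → 𝟙 (j ≟ Q α c x) ℤ.* 𝟙 (- x Fin.<? x))
        ≡⟨ cong (λ z → positive ℤ.+ z) reflected ⟩
      positive ℤ.+ positive
        ≡⟨ double positive ⟩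
      + 2 ℤ.* positive ∎)
      where
      positive : ℤ
      positive = ∑ (λ x → 𝟙 (j ≟ Q α c x) ℤ.* 𝟙 (x Fin.<? - x))

      double : ∀ n → n ℤ.+ n ≡ + 2 ℤ.* n
      double = ℤ-Solver.solve-∀

      neg-neg : ∀ x → - - x ≡ x
      neg-neg x = solve 1 (λ x → :- (:- x) := x) ≡.refl x

      reflected : ∑ (λ x → 𝟙 (j ≟ Q α c x) ℤ.* 𝟙 (- x Fin.<? x)) ≡ positive
      reflected = ≡.trans
        (≡.sym (∑-permute (λ x → 𝟙 (j ≟ Q α c x) ℤ.* 𝟙 (- x Fin.<? x)) (bijection (-_) (-_) neg-neg neg-neg)))
        (∑-cong (λ x → cong₂ (λ u v → 𝟙 (j ≟ u) ℤ.* 𝟙 (v Fin.<? - x)) (Q-neg x) (neg-neg x)))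

      split : ∀ x → 𝟙 (j ≟ Q α c x) ≡ 𝟙 (j ≟ Q α c x) ℤ.* 𝟙 (x Fin.<? - x) ℤ.+ 𝟙 (j ≟ Q α c x) ℤ.* 𝟙 (- x Fin.<? x)
      split x with j ≟ Q α c x
      ... | no _ = ≡.refl
      ... | yes j≡Qx with Fin.<-cmp x (- x)
      ...   | tri< x<-x _ ¬gt = ≡.sym (cong₂ (λ u v → + 1 ℤ.* u ℤ.+ + 1 ℤ.* v) (𝟙-yes (x Fin.<? - x) x<-x) (𝟙-no (- x Fin.<? x) ¬gt))
      ...   | tri> ¬lt _ -x<x = ≡.sym (cong₂ (λ u v → + 1 ℤ.* u ℤ.+ + 1 ℤ.* v) (𝟙-no (x Fin.<? - x) ¬lt) (𝟙-yes (- x Fin.<? x) -x<x))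
      ...   | tri≈ _ x≡-x _ = contradiction (≡.trans j≡Qx (≡.trans (cong (Q α c)
                (doubling-injective (≡.trans (cong (λ z → x + z) x≡-x) (-‿inverseʳ x)))) Q-0)) j≢0

    T≡pN-q : T α c ≡ + p ℤ.* N 0# ℤ.- + q
    T≡pN-q = ≡.trans (∑-e (Q α c)) (cong (λ z → + p ℤ.* z ℤ.- + q) (∑-cong (λ x → 𝟙-cong (Q α c x ≟ 0#) (0# ≟ Q α c x) ≡.sym ≡.sym)))

    norm-equation : (u : A) → u ∈𝔽p → (∀ s → s ∈𝔽p → s * s ≢ u) →
                    ∃[ a ] ∃[ b ] T α c ≡ (+ p ℤ.- + 1) ℤ.* a × a ℤ.* a ℤ.+ + p ℤ.* (b ℤ.* b) ≡ + q ℤ.* radicalSize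
    norm-equation u u∈ u-nonsquare =
      let (y , N1≡2y) = N-even 1≢0
          (z , Nu≡2z) = N-even u≢0
          (a , b , pN-q≡ , norm≡) = NormForm.norm-form (+ p) (+ q) (N 0#) y z N² radicalSize p-1≢0
            (≡.trans (cong₂ (λ v w → (+ p ℤ.- + 1) ℤ.* (v ℤ.+ w)) (≡.sym N1≡2y) (≡.sym Nu≡2z)) (byClasses N (λ s∈ j → N-scale s∈ j) ∑N≡q))
            (≡.trans (cong₂ (λ v w → (+ p ℤ.- + 1) ℤ.* (v ℤ.* v ℤ.+ w ℤ.* w)) (≡.sym N1≡2y) (≡.sym Nu≡2z))
              (byClasses (λ j → N j ℤ.* N j) (λ s∈ j → cong (λ n → n ℤ.* n) (N-scale s∈ j)) ≡.refl))
            distances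
      in a , b , ≡.trans T≡pN-q pN-q≡ , norm≡
      where
      open SquareClasses u u∈ u-nonsquare

      p-1≢0 : + p ℤ.- + 1 ≢ + 0
      p-1≢0 eq = ℕ.<⇒≢ (prime>1 p-prime) (≡.sym (ℤ.+-injective (ℤ.i-j≡0⇒i≡j (+ p) (+ 1) eq)))

      -- Applied to N and to its square: both are unchanged when j is multiplied by a square, so on
      -- 𝔽p* they are determined by their values at 1 and u.
      byClasses : (g : A → ℤ) → (∀ {s} → s ∈𝔽p* → ∀ j → g (s * s * j) ≡ g j) →
                  ∀ {total} → ∑ (λ j → 𝟙 (𝔽p? j) ℤ.* g j) ≡ total →
                  (+ p ℤ.- + 1) ℤ.* (g 1# ℤ.+ g u) ≡ + 2 ℤ.* (total ℤ.- g 0#)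
      byClasses g g-scale {total} ∑g≡total = begin
        (+ p ℤ.- + 1) ℤ.* (g 1# ℤ.+ g u)
          ≡⟨ ∑-𝔽p*-const (g 1# ℤ.+ g u) ⟨
        ∑ (λ s → 𝟙 (𝔽p*? s) ℤ.* (g 1# ℤ.+ g u))
          ≡⟨ ∑-cong (λ s → 𝟙-*-congˡ (𝔽p*? s) (λ s∈ → cong₂ ℤ._+_
               (≡.trans (≡.sym (g-scale s∈ 1#)) (cong g (*-identityʳ (s * s))))
               (≡.trans (≡.sym (g-scale s∈ u)) (cong g (*-comm (s * s) u))))) ⟩
        ∑ (λ s → 𝟙 (𝔽p*? s) ℤ.* (g (s * s) ℤ.+ g (u * (s * s))))
          ≡⟨ ∑-𝔽p*-classes g ⟩
        + 2 ℤ.* ∑ (λ j → 𝟙 (𝔽p*? j) ℤ.* g j)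
          ≡⟨ cong (+ 2 ℤ.*_) (≡.trans (∑-𝔽p* g) (cong (ℤ._- g 0#) ∑g≡total)) ⟩
        + 2 ℤ.* (total ℤ.- g 0#) ∎

-- The size of the radical, by a recurrence of order two

module JointValues {p m : ℕ} (p-prime : Prime p) (2<p : 2 ℕ.< p) (h : ℕ) (m≡2h+1 : m ≡ h ℕ.* 2 ℕ.+ 1) (0<m : 0 ℕ.< m) (0<h : 0 ℕ.< h)
                   (𝔽 : FieldOn (p ℕ.^ m)) (k : ℕ) (gcd≡1 : gcd m k ≡ 1) where

  open QuadraticForms p-prime 2<p h m≡2h+1 0<m 𝔽 k public
  open ≡-Reasoning

  σ-fixed⇒∈𝔽p : ∀ {x} → σ x ≡ x → x ∈𝔽p
  σ-fixed⇒∈𝔽p {x} = fixed⇒∈𝔽p k gcd≡1 x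

  -- W x y is the Casoratian of x and y: for x ≢ 0 it vanishes exactly when y ∈ 𝔽p x,
  -- and σ multiplies it by c / σ c when x and y lie in the radical of Q α c.
  W : A → A → A
  W x y = x * σ y - y * σ x

  W-scale : ∀ x t → W x (x * t) ≡ x * σ x * (σ t - t)
  W-scale x t = ≡.trans (cong (λ z → x * z - x * t * σ x) (frob-* k x t))
    (solve 4 (λ x t s r → x :* (s :* r) :- x :* t :* s := x :* s :* (r :- t)) ≡.refl x t (σ x) (σ t))

  W-+ : ∀ x y z → W x (y + z) ≡ W x y + W x z
  W-+ x y z = ≡.trans (cong (λ w → x * w - (y + z) * σ x) (frob-+ k y z))
    (solve 6 (λ x y z s t w → x :* (t :+ w) :- (y :+ z) :* s := x :* t :- y :* s :+ (x :* w :- z :* s)) ≡.refl x y z (σ x) (σ y) (σ z))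

  W-*ʳ : ∀ x y {t} → t ∈𝔽p → W x (t * y) ≡ t * W x y
  W-*ʳ x y {t} t∈ = ≡.trans
    (cong (λ z → x * z - t * y * σ x) (≡.trans (frob-* k t y) (cong (_* σ y) (∈𝔽p⇒fixed k t∈))))
    (solve 5 (λ x y t s r → x :* (t :* r) :- t :* y :* s := t :* (x :* r :- y :* s)) ≡.refl x y t (σ x) (σ y))

  module Radical (α c : A) where

    private
      L′ : A → A
      L′ = L α c

    L-+ : ∀ x y → L′ (x + y) ≡ L′ x + L′ y
    L-+ x y = ≡.trans
      (cong₂ (λ s t → α * (x + y) + α * (x + y) + c * s + t) (frob-+ k x y)
        (≡.trans (cong τ (distribˡ c x y)) (frob-+ k′ (c * x) (c * y))))
      (solve 8 (λ α c x y s t v w → α :* (x :+ y) :+ α :* (x :+ y) :+ c :* (s :+ t) :+ (v :+ w) :=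
        α :* x :+ α :* x :+ c :* s :+ v :+ (α :* y :+ α :* y :+ c :* t :+ w)) ≡.refl α c x y (σ x) (σ y) (τ (c * x)) (τ (c * y)))

    L-* : ∀ {t} → t ∈𝔽p → ∀ x → L′ (t * x) ≡ t * L′ x
    L-* {t} t∈ x = ≡.trans
      (cong₂ (λ u v → α * (t * x) + α * (t * x) + c * u + v)
        (≡.trans (frob-* k t x) (cong (_* σ x) (∈𝔽p⇒fixed k t∈)))
        (≡.trans (cong τ (solve 3 (λ c t x → c :* (t :* x) := t :* (c :* x)) ≡.refl c t x))
          (≡.trans (frob-* k′ t (c * x)) (cong (_* τ (c * x)) (∈𝔽p⇒fixed k′ t∈)))))
      (solve 6 (λ α c t x s v → α :* (t :* x) :+ α :* (t :* x) :+ c :* (t :* s) :+ t :* v :=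
        t :* (α :* x :+ α :* x :+ c :* s :+ v)) ≡.refl α c t x (σ x) (τ (c * x)))

    -- Applying σ to L x ≡ 0 gives a recurrence of order two for x, σ x, σ² x.
    recurrence : ∀ {x} → L′ x ≡ 0# → σ c * σ (σ x) ≡ - (c * x) - (σ α + σ α) * σ x
    recurrence {x} Lx≡0 = x-y≡0⇒x≡y (begin
      σ c * σ (σ x) - (- (c * x) - (σ α + σ α) * σ x)
        ≡⟨ solve 5 (λ c x a s v → v :- (:- (c :* x) :- (a :+ a) :* s) := a :* s :+ a :* s :+ v :+ c :* x) ≡.refl c x (σ α) (σ x) (σ c * σ (σ x)) ⟩
      σ α * σ x + σ α * σ x + σ c * σ (σ x) + c * x
        ≡⟨ cong₂ _+_ (cong₂ _+_ (cong₂ _+_ (frob-* k α x) (frob-* k α x)) (frob-* k c (σ x))) (στ (c * x)) ⟨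
      σ (α * x) + σ (α * x) + σ (c * σ x) + σ (τ (c * x))
        ≡⟨ cong (λ z → z + σ (c * σ x) + σ (τ (c * x))) (frob-+ k _ _) ⟨
      σ (α * x + α * x) + σ (c * σ x) + σ (τ (c * x))
        ≡⟨ cong (_+ σ (τ (c * x))) (frob-+ k _ _) ⟨
      σ (α * x + α * x + c * σ x) + σ (τ (c * x))
        ≡⟨ frob-+ k _ _ ⟨
      σ (L′ x)
        ≡⟨ cong σ Lx≡0 ⟩
      σ 0#
        ≡⟨ frob-0 k ⟩
      0# ∎)

    -- The discrete Abel identity: both solutions satisfy the same recurrence, and its middle
    -- coefficient cancels in the determinant.
    W-recurrence : ∀ {x y} → L′ x ≡ 0# → L′ y ≡ 0# → σ c * σ (W x y) ≡ c * W x y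
    W-recurrence {x} {y} Lx≡0 Ly≡0 = begin
      σ c * σ (x * σ y - y * σ x)
        ≡⟨ cong (σ c *_) (≡.trans (frob-- k _ _) (cong₂ _-_ (frob-* k x (σ y)) (frob-* k y (σ x)))) ⟩
      σ c * (σ x * σ (σ y) - σ y * σ (σ x))
        ≡⟨ solve 5 (λ c s t v w → c :* (s :* w :- t :* v) := s :* (c :* w) :- t :* (c :* v)) ≡.refl (σ c) (σ x) (σ y) (σ (σ x)) (σ (σ y)) ⟩
      σ x * (σ c * σ (σ y)) - σ y * (σ c * σ (σ x))
        ≡⟨ cong₂ (λ u v → σ x * u - σ y * v) (recurrence Ly≡0) (recurrence Lx≡0) ⟩
      σ x * (- (c * y) - (σ α + σ α) * σ y) - σ y * (- (c * x) - (σ α + σ α) * σ x)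
        ≡⟨ solve 6 (λ c x y a s t → s :* (:- (c :* y) :- (a :+ a) :* t) :- t :* (:- (c :* x) :- (a :+ a) :* s) := c :* (x :* t :- y :* s))
             ≡.refl c x y (σ α) (σ x) (σ y) ⟩
      c * W x y ∎

    -- By `W-scale` the equation W r (r t) = 0 says σ t = t, so the vectors counted are exactly the
    -- multiples of r by 𝔽p.
    kernelSize : ∀ {r} → r ≢ 0# → L′ r ≡ 0# → ∑ (λ v → 𝟙 (L′ v ≟ 0#) ℤ.* 𝟙 (W r v ≟ 0#)) ≡ + p
    kernelSize {r} r≢0 Lr≡0 = begin
      ∑ (λ v → 𝟙 (L′ v ≟ 0#) ℤ.* 𝟙 (W r v ≟ 0#))
        ≡⟨ ∑-dilate r≢0 (λ v → 𝟙 (L′ v ≟ 0#) ℤ.* 𝟙 (W r v ≟ 0#)) ⟨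
      ∑ (λ t → 𝟙 (L′ (r * t) ≟ 0#) ℤ.* 𝟙 (W r (r * t) ≟ 0#))
        ≡⟨ ∑-cong pointwise ⟩
      ∑ (λ t → 𝟙 (𝔽p? t) ℤ.* + 1)
        ≡⟨ ∑-𝔽p-const (+ 1) ⟩
      + p ℤ.* + 1
        ≡⟨ ℤ.*-identityʳ (+ p) ⟩
      + p ∎
      where
      pointwise : ∀ t → 𝟙 (L′ (r * t) ≟ 0#) ℤ.* 𝟙 (W r (r * t) ≟ 0#) ≡ 𝟙 (𝔽p? t) ℤ.* + 1
      pointwise t with 𝔽p? t
      ... | yes t∈ = cong₂ ℤ._*_
        (𝟙-yes (L′ (r * t) ≟ 0#) (≡.trans (cong L′ (*-comm r t)) (≡.trans (L-* t∈ r) (≡.trans (cong (t *_) Lr≡0) (zeroʳ t)))))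
        (𝟙-yes (W r (r * t) ≟ 0#) (≡.trans (W-scale r t) (≡.trans (cong (λ z → r * σ r * (z - t)) (∈𝔽p⇒fixed k t∈))
          (≡.trans (cong (r * σ r *_) (-‿inverseʳ t)) (zeroʳ _)))))
      ... | no t∉ = ≡.trans (cong (𝟙 (L′ (r * t) ≟ 0#) ℤ.*_) (𝟙-no (W r (r * t) ≟ 0#) (λ W≡0 →
        t∉ (σ-fixed⇒∈𝔽p (x-y≡0⇒x≡y (*-nonzeroˡ (≡.trans (≡.sym (W-scale r t)) W≡0) (*-nonzero r≢0 (^-nonzero (p ℕ.^ k) r≢0))))))))
        (ℤ.*-zeroʳ (𝟙 (L′ (r * t) ≟ 0#)))

    trivialSize : (∀ v → L′ v ≡ 0# → v ≡ 0#) → radicalSize α c ≡ + 1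
    trivialSize trivial = ≡.trans
      (∑-cong (λ v → 𝟙-cong (L′ v ≟ 0#) (v ≟ 0#) (trivial v) (λ { ≡.refl → L-0 })))
      (∑-𝟙≟ 0#)
      where
      L-0 : L′ 0# ≡ 0#
      L-0 = ≡.trans (cong L′ (≡.sym (zeroˡ 0#))) (≡.trans (L-* 0∈𝔽p 0#) (zeroˡ _))

    -- The quotient W r v / W r s is fixed by σ, since numerator and denominator satisfy the same
    -- recurrence of order one. It is thus a coordinate with values in 𝔽p. The fibre over t is the
    -- translate by t s of the line through r, so there are p fibres of size p.
    planeSize : c ≢ 0# → ∀ {r s} → r ≢ 0# → L′ r ≡ 0# → L′ s ≡ 0# → W r s ≢ 0# → radicalSize α c ≡ + p ℤ.* + p
    planeSize c≢0 {r} {s} r≢0 Lr≡0 Ls≡0 W≢0 = begin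
      ∑ (λ v → 𝟙 (L′ v ≟ 0#))
        ≡⟨ ∑-fibres coordinate (λ v → 𝟙 (L′ v ≟ 0#)) ⟨
      ∑ (λ t → ∑ (λ v → 𝟙 (t ≟ coordinate v) ℤ.* 𝟙 (L′ v ≟ 0#)))
        ≡⟨ ∑-cong (λ t → ∑-cong (λ v → ≡.trans (ℤ.*-comm (𝟙 (t ≟ coordinate v)) _) (≡.trans (𝟙-*-congˡ (L′ v ≟ 0#) (restrict t v))
             (rearrange (𝟙 (L′ v ≟ 0#)) (𝟙 (𝔽p? t)) (𝟙 (W r v ≟ t * W r s)))))) ⟩
      ∑ (λ t → ∑ (λ v → 𝟙 (𝔽p? t) ℤ.* (𝟙 (L′ v ≟ 0#) ℤ.* 𝟙 (W r v ≟ t * W r s))))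
        ≡⟨ ∑-cong (λ t → ≡.trans (∑-*ˡ (𝟙 (𝔽p? t)) (λ v → 𝟙 (L′ v ≟ 0#) ℤ.* 𝟙 (W r v ≟ t * W r s)))
             (𝟙-*-congˡ (𝔽p? t) fibreSize)) ⟩
      ∑ (λ t → 𝟙 (𝔽p? t) ℤ.* + p)
        ≡⟨ ∑-𝔽p-const (+ p) ⟩
      + p ℤ.* + p ∎
      where
      w : A
      w = proj₁ (inverse (W r s) W≢0)

      Ww≡1 : W r s * w ≡ 1#
      Ww≡1 = proj₂ (inverse (W r s) W≢0)

      coordinate : A → A
      coordinate v = W r v * w

      rearrange : ∀ a b c → a ℤ.* (b ℤ.* c) ≡ b ℤ.* (a ℤ.* c)
      rearrange = ℤ-Solver.solve-∀

      coordinate-spec : ∀ v → coordinate v * W r s ≡ W r v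
      coordinate-spec v = ≡.trans (solve 3 (λ u w z → u :* w :* z := u :* (z :* w)) ≡.refl (W r v) w (W r s))
        (≡.trans (cong (W r v *_) Ww≡1) (*-identityʳ _))

      coordinate∈ : ∀ v → L′ v ≡ 0# → coordinate v ∈𝔽p
      coordinate∈ v Lv≡0 = σ-fixed⇒∈𝔽p (*-cancelˡ (*-nonzero (^-nonzero (p ℕ.^ k) c≢0) (^-nonzero (p ℕ.^ k) W≢0)) (begin
        σ c * σ (W r s) * σ (coordinate v) ≡⟨ solve 3 (λ c z u → c :* z :* u := c :* (u :* z)) ≡.refl (σ c) (σ (W r s)) (σ (coordinate v)) ⟩
        σ c * (σ (coordinate v) * σ (W r s)) ≡⟨ cong (σ c *_) (≡.trans (≡.sym (frob-* k _ _)) (cong σ (coordinate-spec v))) ⟩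
        σ c * σ (W r v) ≡⟨ W-recurrence Lr≡0 Lv≡0 ⟩
        c * W r v ≡⟨ cong (c *_) (coordinate-spec v) ⟨
        c * (coordinate v * W r s) ≡⟨ solve 3 (λ c u z → c :* (u :* z) := c :* z :* u) ≡.refl c (coordinate v) (W r s) ⟩
        c * W r s * coordinate v ≡⟨ cong (_* coordinate v) (W-recurrence Lr≡0 Ls≡0) ⟨
        σ c * σ (W r s) * coordinate v ∎))

      restrict : ∀ t v → L′ v ≡ 0# → 𝟙 (t ≟ coordinate v) ≡ 𝟙 (𝔽p? t) ℤ.* 𝟙 (W r v ≟ t * W r s)
      restrict t v Lv≡0 with t ≟ coordinate v
      ... | yes ≡.refl = ≡.sym (cong₂ ℤ._*_ (𝟙-yes (𝔽p? t) (coordinate∈ v Lv≡0)) (𝟙-yes (W r v ≟ t * W r s) (≡.sym (coordinate-spec v))))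
      ... | no t≢ = ≡.sym (≡.trans (cong (𝟙 (𝔽p? t) ℤ.*_) (𝟙-no (W r v ≟ t * W r s) (λ eq →
        t≢ (*-cancelˡ W≢0 (≡.trans (*-comm _ t) (≡.trans (≡.sym eq) (≡.trans (≡.sym (coordinate-spec v)) (*-comm _ (W r s)))))))))
        (ℤ.*-zeroʳ (𝟙 (𝔽p? t))))

      fibreSize : ∀ {t} → t ∈𝔽p → ∑ (λ v → 𝟙 (L′ v ≟ 0#) ℤ.* 𝟙 (W r v ≟ t * W r s)) ≡ + p
      fibreSize {t} t∈ = begin
        ∑ (λ v → 𝟙 (L′ v ≟ 0#) ℤ.* 𝟙 (W r v ≟ t * W r s))
          ≡⟨ ∑-translate (t * s) (λ v → 𝟙 (L′ v ≟ 0#) ℤ.* 𝟙 (W r v ≟ t * W r s)) ⟨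
        ∑ (λ v → 𝟙 (L′ (v + t * s) ≟ 0#) ℤ.* 𝟙 (W r (v + t * s) ≟ t * W r s))
          ≡⟨ ∑-cong (λ v → cong₂ ℤ._*_
               (cong (λ z → 𝟙 (z ≟ 0#)) (≡.trans (L-+ v (t * s)) (≡.trans (cong (λ z → L′ v + z)
                 (≡.trans (L-* t∈ s) (≡.trans (cong (t *_) Ls≡0) (zeroʳ t)))) (+-identityʳ (L′ v)))))
               (𝟙-cong (W r (v + t * s) ≟ t * W r s) (W r v ≟ 0#)
                 (λ eq → +-cancelˡ (t * W r s) (≡.trans (+-comm _ (W r v)) (≡.trans (≡.sym (shift v)) (≡.trans eq (≡.sym (+-identityʳ _))))))
                 (λ eq → ≡.trans (shift v) (≡.trans (cong (_+ t * W r s) eq) (+-identityˡ _))))) ⟩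
        ∑ (λ v → 𝟙 (L′ v ≟ 0#) ℤ.* 𝟙 (W r v ≟ 0#))
          ≡⟨ kernelSize r≢0 Lr≡0 ⟩
        + p ∎
        where
        shift : ∀ v → W r (v + t * s) ≡ W r v + t * W r s
        shift v = ≡.trans (W-+ r v (t * s)) (cong (λ z → W r v + z) (W-*ʳ r s t∈))

    radicalSize-power : c ≢ 0# → ∃[ d ] d ℕ.≤ 2 × radicalSize α c ≡ + (p ℕ.^ d)
    radicalSize-power c≢0 with Fin.any? (λ r → ¬? (r ≟ 0#) ×-dec (L′ r ≟ 0#))
    ... | no none = 0 , ℕ.z≤n , trivialSize trivial
      where
      trivial : ∀ v → L′ v ≡ 0# → v ≡ 0#
      trivial v Lv≡0 with v ≟ 0#
      ... | yes v≡0 = v≡0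
      ... | no v≢0  = contradiction (v , v≢0 , Lv≡0) none
    ... | yes (r , r≢0 , Lr≡0) with Fin.any? (λ s → (L′ s ≟ 0#) ×-dec ¬? (W r s ≟ 0#))
    ...   | yes (s , Ls≡0 , W≢0) = 2 , ℕ.≤-refl , ≡.trans (planeSize c≢0 r≢0 Lr≡0 Ls≡0 W≢0)
              (≡.trans (≡.sym (ℤ.pos-* p p)) (cong (λ z → + (p ℕ.* z)) (≡.sym (ℕ.*-identityʳ p))))
    ...   | no none = 1 , ℕ.s≤s ℕ.z≤n , ≡.trans (∑-cong line) (≡.trans (kernelSize r≢0 Lr≡0) (cong (λ z → + z) (≡.sym (ℕ.*-identityʳ p))))
      where
      line : ∀ v → 𝟙 (L′ v ≟ 0#) ≡ 𝟙 (L′ v ≟ 0#) ℤ.* 𝟙 (W r v ≟ 0#)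
      line v with L′ v ≟ 0#
      ... | no _ = ≡.refl
      ... | yes Lv≡0 with W r v ≟ 0#
      ...   | yes _  = ≡.refl
      ...   | no W≢0 = contradiction (v , Lv≡0 , W≢0) none

  -- Substituting a - b for a gives the pair (a , a - 2b), and for fixed a the map b ↦ a - 2b is a
  -- bijection because 2 is invertible.
  ∑∑-sum-difference : (Φ : A → A → ℤ) → ∑ (λ a → ∑ (λ b → Φ (a + b) (a - b))) ≡ ∑ (λ x → ∑ (Φ x))
  ∑∑-sum-difference Φ = begin
    ∑ (λ a → ∑ (λ b → Φ (a + b) (a - b)))
      ≡⟨ ∑-swap (λ a b → Φ (a + b) (a - b)) ⟩
    ∑ (λ b → ∑ (λ a → Φ (a + b) (a - b)))
      ≡⟨ ∑-cong (λ b → ∑-translate (- b) (λ a → Φ (a + b) (a - b))) ⟨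
    ∑ (λ b → ∑ (λ a → Φ (a - b + b) (a - b - b)))
      ≡⟨ ∑-cong (λ b → ∑-cong (λ a → cong₂ Φ
           (solve 2 (λ a b → a :- b :+ b := a) ≡.refl a b)
           (≡.trans (solve 2 (λ a b → a :- b :- b := a :- (b :+ b)) ≡.refl a b) (cong (λ z → a - z) (≡.sym (double b)))))) ⟩
    ∑ (λ b → ∑ (λ a → Φ a (a - (1# + 1#) * b)))
      ≡⟨ ∑-swap (λ b a → Φ a (a - (1# + 1#) * b)) ⟩
    ∑ (λ a → ∑ (λ b → Φ a (a - (1# + 1#) * b)))
      ≡⟨ ∑-cong (λ a → ≡.trans (∑-dilate 2≢0 (λ b → Φ a (a - b)))
           (∑-permute (Φ a) (bijection (λ b → a - b) (λ b → a - b) (reflect a) (reflect a)))) ⟩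
    ∑ (λ x → ∑ (Φ x)) ∎
    where
    double : ∀ b → (1# + 1#) * b ≡ b + b
    double b = ≡.trans (distribʳ b 1# 1#) (cong₂ _+_ (*-identityˡ b) (*-identityˡ b))

    2≢0 : 1# + 1# ≢ 0#
    2≢0 eq = 1≢0 (doubling-injective eq)

    reflect : ∀ a b → a - (a - b) ≡ b
    reflect a b = solve 2 (λ a b → a :- (a :- b) := b) ≡.refl a b

  -- The distribution of T(a+b,c) + T(a-b,c)

  module Distribution (u : A) (u∈ : u ∈𝔽p) (u-nonsquare : ∀ s → s ∈𝔽p → s * s ≢ u) where

    open import Data.Integer.Base using () renaming (_+_ to infixl 6 _⊕_; _*_ to infixl 7 _⊛_; _-_ to infixl 6 _⊖_)
    open IntegersInRationals
    open Descent p-prime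

    w : ℤ
    w = (+ p ℤ.- + 1) ℤ.* + (p ℕ.^ suc h)

    -- The conclusion retains d = 1 next to a nonzero value: this is what excludes nonzero values
    -- when the radical is trivial.
    T-fromSize : ∀ α c d → d ℕ.≤ 2 → radicalSize α c ≡ + (p ℕ.^ d) →
                 T α c ≡ + 0 ⊎ (d ≡ 1 × (T α c ≡ w ⊎ T α c ≡ ℤ.- w))
    T-fromSize α c d d≤2 size≡ = fromNorm (norm-equation α c u u∈ u-nonsquare)
      where
      fromDescent : ∀ {a} → T α c ≡ (+ p ℤ.- + 1) ℤ.* a →
                    a ≡ + 0 ⊎ ∃[ j ] m ℕ.+ d ≡ j ℕ.+ j × (a ≡ + (p ℕ.^ j) ⊎ a ≡ ℤ.- + (p ℕ.^ j)) →
                    T α c ≡ + 0 ⊎ (d ≡ 1 × (T α c ≡ w ⊎ T α c ≡ ℤ.- w))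
      fromDescent T≡ (inj₁ ≡.refl) = inj₁ (≡.trans T≡ (ℤ.*-zeroʳ (+ p ℤ.- + 1)))
      fromDescent {a} T≡ (inj₂ (j , m+d≡j+j , a≡±)) =
        let (d≡1 , j≡) = odd+≤2 h d≤2 j (≡.trans (cong (ℕ._+ d) (≡.sym m≡2h+1)) m+d≡j+j)
        in inj₂ (d≡1 , sign j≡ a≡±)
        where
        sign : j ≡ suc h → a ≡ + (p ℕ.^ j) ⊎ a ≡ ℤ.- + (p ℕ.^ j) → T α c ≡ w ⊎ T α c ≡ ℤ.- w
        sign ≡.refl (inj₁ a≡) = inj₁ (≡.trans T≡ (cong ((+ p ℤ.- + 1) ℤ.*_) a≡))
        sign ≡.refl (inj₂ a≡) = inj₂ (≡.trans T≡ (≡.trans (cong ((+ p ℤ.- + 1) ℤ.*_) a≡) (≡.sym (ℤ.neg-distribʳ-* (+ p ℤ.- + 1) _))))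

      fromNorm : ∃[ a ] ∃[ b ] T α c ≡ (+ p ℤ.- + 1) ℤ.* a × a ℤ.* a ℤ.+ + p ℤ.* (b ℤ.* b) ≡ + q ℤ.* radicalSize α c →
                 T α c ≡ + 0 ⊎ (d ≡ 1 × (T α c ≡ w ⊎ T α c ≡ ℤ.- w))
      fromNorm (a , b , T≡ , norm≡) = fromDescent T≡ (ℤ-descent (m ℕ.+ d) a b (begin
        a ℤ.* a ℤ.+ + p ℤ.* (b ℤ.* b) ≡⟨ norm≡ ⟩
        + q ℤ.* radicalSize α c ≡⟨ cong (+ q ℤ.*_) size≡ ⟩
        + q ℤ.* + (p ℕ.^ d) ≡⟨ ℤ.pos-* q (p ℕ.^ d) ⟨
        + (p ℕ.^ m ℕ.* p ℕ.^ d) ≡⟨ cong (λ z → + z) (ℕ.^-distribˡ-+-* p m d) ⟨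
        + (p ℕ.^ (m ℕ.+ d)) ∎))

    T-values : ∀ α {c} → c ≢ 0# → T α c ≡ + 0 ⊎ T α c ≡ w ⊎ T α c ≡ ℤ.- w
    T-values α {c} c≢0 =
      let (d , d≤2 , size≡) = Radical.radicalSize-power α c c≢0
      in ⊎.map₂ proj₂ (T-fromSize α c d d≤2 size≡)

    -- For c = 0 the map L is multiplication by 2α, so d = 0, whereas a nonzero value needs d = 1.
    T-diagonal : ∀ α → α ≢ 0# → T α 0# ≡ + 0
    T-diagonal α α≢0 = ⊎.[ id , (λ ()) ] (T-fromSize α 0# 0 ℕ.z≤n (Radical.trivialSize α 0# trivial))
      where
      trivial : ∀ v → L α 0# v ≡ 0# → v ≡ 0#
      trivial v Lv≡0 = *-nonzeroˡ (doubling-injective (begin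
        α * v + α * v ≡⟨ +-identityʳ _ ⟨
        α * v + α * v + 0# ≡⟨ cong (λ z → α * v + α * v + z) (zeroˡ (σ v)) ⟨
        α * v + α * v + 0# * σ v ≡⟨ +-identityʳ _ ⟨
        α * v + α * v + 0# * σ v + 0# ≡⟨ cong (λ z → α * v + α * v + 0# * σ v + z)
                                                            (≡.trans (cong τ (zeroˡ v)) (frob-0 k′)) ⟨
        L α 0# v ≡⟨ Lv≡0 ⟩
        0# ∎)) α≢0

    T-zero : T 0# 0# ≡ + q ℤ.* (+ p ℤ.- + 1)
    T-zero = ≡.trans (∑-cong (λ x → ≡.trans (cong e (≡.trans (cong Tr
      (solve 2 (λ x s → con (+ 0) :* (x :* x) :+ con (+ 0) :* (x :* s) := con (+ 0)) ≡.refl x (σ x))) Tr-0)) e-0)) (∑-const q _)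

    -- V = q (p - 1) is both T(0,0) and the first moment for every c. Since q = p^(h+1) p^h it
    -- equals w H, so every value of T is w times one of 0, 1, -1 and H.
    H V : ℤ
    H = + (p ℕ.^ h)
    V = w ⊛ H

    q≡ : q ≡ p ℕ.^ suc h ℕ.* p ℕ.^ h
    q≡ = ≡.trans (cong (p ℕ.^_) (≡.trans m≡2h+1 (arrange h))) (ℕ.^-distribˡ-+-* p (suc h) h)
      where
      arrange : ∀ h → h ℕ.* 2 ℕ.+ 1 ≡ suc h ℕ.+ h
      arrange = ℕ-Solver.solve-∀

    q*[p-1]≡V : + q ⊛ (+ p ⊖ + 1) ≡ V
    q*[p-1]≡V = ≡.trans
      (cong (_⊛ (+ p ⊖ + 1)) (≡.trans (cong (λ z → + z) q≡) (ℤ.pos-* (p ℕ.^ suc h) (p ℕ.^ h))))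
      (rearrange (+ (p ℕ.^ suc h)) H (+ p ⊖ + 1))
      where
      rearrange : ∀ a b c → a ⊛ b ⊛ c ≡ c ⊛ a ⊛ b
      rearrange = ℤ-Solver.solve-∀

    +p^≢0 : ∀ n → + (p ℕ.^ n) ≢ + 0
    +p^≢0 n eq = ℕ.<⇒≢ (0<p^ n) (≡.sym (ℤ.+-injective eq))

    w≢0 : w ≢ + 0
    w≢0 w≡0 = ⊎.[ (λ p-1≡0 → ℕ.<⇒≢ (prime>1 p-prime) (≡.sym (ℤ.+-injective (ℤ.i-j≡0⇒i≡j (+ p) (+ 1) p-1≡0)))) , +p^≢0 (suc h) ]
      (ℤ.i*j≡0⇒i≡0∨j≡0 (+ p ⊖ + 1) w≡0)

    -- With G the indicator of a value this is its frequency. Keeping G arbitrary separates the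
    -- convolution from the comparison of values.
    jointSum : (ℤ → ℤ) → ℤ
    jointSum G = ∑ (λ a → ∑ (λ b → ∑ (λ c → G (T (a + b) c ⊕ T (a - b) c))))

    sliceSum : (ℤ → ℤ) → A → ℤ
    sliceSum G c = ∑ (λ x → ∑ (λ y → G (T x c ⊕ T y c)))

    jointSum≡∑sliceSum : ∀ G → jointSum G ≡ ∑ (sliceSum G)
    jointSum≡∑sliceSum G = begin
      jointSum G
        ≡⟨ ∑∑-sum-difference (λ x y → ∑ (λ c → G (T x c ⊕ T y c))) ⟩
      ∑ (λ x → ∑ (λ y → ∑ (λ c → G (T x c ⊕ T y c))))
        ≡⟨ ∑-cong (λ x → ∑-swap (λ y c → G (T x c ⊕ T y c))) ⟩
      ∑ (λ x → ∑ (λ c → ∑ (λ y → G (T x c ⊕ T y c))))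
        ≡⟨ ∑-swap (λ x c → ∑ (λ y → G (T x c ⊕ T y c))) ⟩
      ∑ (sliceSum G) ∎

    -- For c = 0 one pair takes the value 2V, 2(q - 1) pairs take V and (q - 1)² take 0.
    -- `genericSum` is four times the sum for one c ≠ 0: the counts are n₀ = q - H² and (H² ± H)/2,
    -- and the factor 4 clears the halves.
    diagonalSum genericSum : (ℤ → ℤ) → ℤ
    diagonalSum G = G (V ⊕ V) ⊕ + 2 ⊛ (+ q ⊖ + 1) ⊛ G V ⊕ (+ q ⊖ + 1) ⊛ (+ q ⊖ + 1) ⊛ G (+ 0)
    genericSum G =
      (+ 4 ⊛ (+ q ⊖ H ⊛ H) ⊛ (+ q ⊖ H ⊛ H) ⊕ + 2 ⊛ (H ⊛ H ⊕ H) ⊛ (H ⊛ H ⊖ H)) ⊛ G (+ 0)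
      ⊕ + 4 ⊛ (+ q ⊖ H ⊛ H) ⊛ (H ⊛ H ⊕ H) ⊛ G w ⊕ + 4 ⊛ (+ q ⊖ H ⊛ H) ⊛ (H ⊛ H ⊖ H) ⊛ G (ℤ.- w)
      ⊕ (H ⊛ H ⊕ H) ⊛ (H ⊛ H ⊕ H) ⊛ G (w ⊕ w) ⊕ (H ⊛ H ⊖ H) ⊛ (H ⊛ H ⊖ H) ⊛ G (ℤ.- w ⊕ ℤ.- w)

    sliceSum-zero : ∀ G → sliceSum G 0# ≡ diagonalSum G
    sliceSum-zero = Spike.spikePairs 0# (λ α → T α 0#) V (≡.trans T-zero q*[p-1]≡V) T-diagonal

    sliceSum-nonzero : ∀ G {c} → c ≢ 0# → + 4 ⊛ sliceSum G c ≡ genericSum G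
    sliceSum-nonzero G {c} c≢0 = begin
      + 4 ⊛ sliceSum G c
        ≡⟨ cong (+ 4 ⊛_) (TV.pairs G) ⟩
      + 4 ⊛ ((TV.n₀ ⊛ TV.n₀ ⊕ + 2 ⊛ TV.n₊ ⊛ TV.n₋) ⊛ G (+ 0) ⊕ + 2 ⊛ TV.n₀ ⊛ TV.n₊ ⊛ G w ⊕ + 2 ⊛ TV.n₀ ⊛ TV.n₋ ⊛ G (ℤ.- w)
        ⊕ TV.n₊ ⊛ TV.n₊ ⊛ G (w ⊕ w) ⊕ TV.n₋ ⊛ TV.n₋ ⊛ G (ℤ.- w ⊕ ℤ.- w))
        ≡⟨ double TV.n₀ TV.n₊ TV.n₋ (G (+ 0)) (G w) (G (ℤ.- w)) (G (w ⊕ w)) (G (ℤ.- w ⊕ ℤ.- w)) ⟩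
      combination TV.n₀ (+ 2 ⊛ TV.n₊) (+ 2 ⊛ TV.n₋)
        ≡⟨ cong (combination TV.n₀ (+ 2 ⊛ TV.n₊)) (TV.2n₋ H sum≡ squares≡) ⟩
      combination TV.n₀ (+ 2 ⊛ TV.n₊) (H ⊛ H ⊖ H)
        ≡⟨ cong₂ (λ a b → combination a b (H ⊛ H ⊖ H)) (TV.n₀≡ H sum≡ squares≡) (TV.2n₊ H sum≡ squares≡) ⟩
      genericSum G ∎
      where
      module TV = ThreeValued w w≢0 (λ α → T α c) (λ α → T-values α c≢0)

      sum≡ : ∑ (λ α → T α c) ≡ w ⊛ H
      sum≡ = ≡.trans (first-moment c) q*[p-1]≡V

      squares≡ : ∑ (λ α → T α c ⊛ T α c) ≡ w ⊛ w ⊛ (H ⊛ H)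
      squares≡ = ≡.trans (second-moment c) (≡.trans (cong (λ z → z ⊛ z) q*[p-1]≡V) (rearrange w H))
        where
        rearrange : ∀ w H → w ⊛ H ⊛ (w ⊛ H) ≡ w ⊛ w ⊛ (H ⊛ H)
        rearrange = ℤ-Solver.solve-∀

      combination : ℤ → ℤ → ℤ → ℤ
      combination n₀ 2n₊ 2n₋ = (+ 4 ⊛ n₀ ⊛ n₀ ⊕ + 2 ⊛ 2n₊ ⊛ 2n₋) ⊛ G (+ 0)
        ⊕ + 4 ⊛ n₀ ⊛ 2n₊ ⊛ G w ⊕ + 4 ⊛ n₀ ⊛ 2n₋ ⊛ G (ℤ.- w) ⊕ 2n₊ ⊛ 2n₊ ⊛ G (w ⊕ w) ⊕ 2n₋ ⊛ 2n₋ ⊛ G (ℤ.- w ⊕ ℤ.- w)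

      double : ∀ a b c g₀ g₊ g₋ g₊₊ g₋₋ →
        + 4 ⊛ ((a ⊛ a ⊕ + 2 ⊛ b ⊛ c) ⊛ g₀ ⊕ + 2 ⊛ a ⊛ b ⊛ g₊ ⊕ + 2 ⊛ a ⊛ c ⊛ g₋ ⊕ b ⊛ b ⊛ g₊₊ ⊕ c ⊛ c ⊛ g₋₋) ≡
        (+ 4 ⊛ a ⊛ a ⊕ + 2 ⊛ (+ 2 ⊛ b) ⊛ (+ 2 ⊛ c)) ⊛ g₀ ⊕ + 4 ⊛ a ⊛ (+ 2 ⊛ b) ⊛ g₊ ⊕ + 4 ⊛ a ⊛ (+ 2 ⊛ c) ⊛ g₋
          ⊕ + 2 ⊛ b ⊛ (+ 2 ⊛ b) ⊛ g₊₊ ⊕ + 2 ⊛ c ⊛ (+ 2 ⊛ c) ⊛ g₋₋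
      double = ℤ-Solver.solve-∀

    jointSum-formula : ∀ G → + 4 ⊛ jointSum G ≡ + 4 ⊛ diagonalSum G ⊕ (+ q ⊖ + 1) ⊛ genericSum G
    jointSum-formula G = begin
      + 4 ⊛ jointSum G
        ≡⟨ cong (+ 4 ⊛_) (jointSum≡∑sliceSum G) ⟩
      + 4 ⊛ ∑ (sliceSum G)
        ≡⟨ ∑-*ˡ (+ 4) (sliceSum G) ⟨
      ∑ (λ c → + 4 ⊛ sliceSum G c)
        ≡⟨ ∑-cong slice ⟩
      ∑ (λ c → 𝟙 (c ≟ 0#) ⊛ (+ 4 ⊛ diagonalSum G ⊖ genericSum G) ⊕ genericSum G)
        ≡⟨ ∑-+ (λ c → 𝟙 (c ≟ 0#) ⊛ (+ 4 ⊛ diagonalSum G ⊖ genericSum G)) (λ _ → genericSum G) ⟩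
      ∑ (λ c → 𝟙 (c ≟ 0#) ⊛ (+ 4 ⊛ diagonalSum G ⊖ genericSum G)) ⊕ ∑ {q} (λ _ → genericSum G)
        ≡⟨ cong₂ _⊕_ (∑-δ 0# (λ _ → + 4 ⊛ diagonalSum G ⊖ genericSum G)) (∑-const q (genericSum G)) ⟩
      + 4 ⊛ diagonalSum G ⊖ genericSum G ⊕ + q ⊛ genericSum G
        ≡⟨ rearrange (+ 4 ⊛ diagonalSum G) (genericSum G) (+ q) ⟩
      + 4 ⊛ diagonalSum G ⊕ (+ q ⊖ + 1) ⊛ genericSum G ∎
      where
      at : ∀ a b → a ≡ + 1 ⊛ (a ⊖ b) ⊕ b
      at = ℤ-Solver.solve-∀

      off : ∀ a b → b ≡ + 0 ⊛ (a ⊖ b) ⊕ b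
      off = ℤ-Solver.solve-∀

      slice : ∀ c → + 4 ⊛ sliceSum G c ≡ 𝟙 (c ≟ 0#) ⊛ (+ 4 ⊛ diagonalSum G ⊖ genericSum G) ⊕ genericSum G
      slice c = split (c ≟ 0#)
        where
        split : (c≟0 : Dec (c ≡ 0#)) → + 4 ⊛ sliceSum G c ≡ 𝟙 c≟0 ⊛ (+ 4 ⊛ diagonalSum G ⊖ genericSum G) ⊕ genericSum G
        split (yes ≡.refl) = ≡.trans (cong (+ 4 ⊛_) (sliceSum-zero G)) (at (+ 4 ⊛ diagonalSum G) (genericSum G))
        split (no c≢0)     = ≡.trans (sliceSum-nonzero G c≢0) (off (+ 4 ⊛ diagonalSum G) (genericSum G))

      rearrange : ∀ a b q → a ⊖ b ⊕ q ⊛ b ≡ a ⊕ (q ⊖ + 1) ⊛ b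
      rearrange = ℤ-Solver.solve-∀

    frequency : ℤ → ℤ
    frequency v = jointSum (λ z → 𝟙 (z ℤ.≟ v))

    -- The coefficients of the indicators of the values 2H, H, 0, 1, -1, 2, -2 (times w).
    d₂ d₁ d₀ g₁ g₋₁ g₂ g₋₂ : ℤ → ℤ → ℤ
    d₂  q H = + 4
    d₁  q H = + 8 ⊛ (q ⊖ + 1)
    d₀  q H = (q ⊖ + 1) ⊛ (+ 4 ⊛ (q ⊖ + 1) ⊕ (+ 4 ⊛ (q ⊖ H ⊛ H) ⊛ (q ⊖ H ⊛ H) ⊕ + 2 ⊛ (H ⊛ H ⊕ H) ⊛ (H ⊛ H ⊖ H)))
    g₁  q H = + 4 ⊛ ((q ⊖ + 1) ⊛ (q ⊖ H ⊛ H) ⊛ (H ⊛ H ⊕ H))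
    g₋₁ q H = + 4 ⊛ ((q ⊖ + 1) ⊛ (q ⊖ H ⊛ H) ⊛ (H ⊛ H ⊖ H))
    g₂  q H = (q ⊖ + 1) ⊛ ((H ⊛ H ⊕ H) ⊛ (H ⊛ H ⊕ H))
    g₋₂ q H = (q ⊖ + 1) ⊛ ((H ⊛ H ⊖ H) ⊛ (H ⊛ H ⊖ H))

    combination : (q H a b c d e f g : ℤ) → ℤ
    combination q H a b c d e f g =
      d₂ q H ⊛ a ⊕ d₁ q H ⊛ b ⊕ d₀ q H ⊛ c ⊕ g₁ q H ⊛ d ⊕ g₋₁ q H ⊛ e ⊕ g₂ q H ⊛ f ⊕ g₋₂ q H ⊛ g

    -- Values are compared after division by w, so that only H, 2H and the integers from -2 to 2
    -- have to be told apart.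
    𝟙-w* : ∀ {z} s t → z ≡ w ⊛ s → 𝟙 (z ℤ.≟ w ⊛ t) ≡ 𝟙 (s ℤ.≟ t)
    𝟙-w* {z} s t z≡ws = 𝟙-cong (z ℤ.≟ w ⊛ t) (s ℤ.≟ t)
      (λ z≡wt → ℤ.*-cancelˡ-≡ w s t {{ℤ.≢-nonZero w≢0}} (≡.trans (≡.sym z≡ws) z≡wt))
      (λ s≡t → ≡.trans z≡ws (cong (w ⊛_) s≡t))

    4frequency : ∀ t {a b c d e f g} →
      𝟙 (H ⊕ H ℤ.≟ t) ≡ a → 𝟙 (H ℤ.≟ t) ≡ b → 𝟙 (+ 0 ℤ.≟ t) ≡ c →
      𝟙 (+ 1 ℤ.≟ t) ≡ d → 𝟙 (ℤ.- + 1 ℤ.≟ t) ≡ e → 𝟙 (+ 2 ℤ.≟ t) ≡ f → 𝟙 (ℤ.- + 2 ℤ.≟ t) ≡ g →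
      + 4 ⊛ frequency (w ⊛ t) ≡ combination (+ q) H a b c d e f g
    4frequency t {a} {b} {c} {d} {e} {f} {g} a≡ b≡ c≡ d≡ e≡ f≡ g≡ = begin
      + 4 ⊛ frequency (w ⊛ t)
        ≡⟨ jointSum-formula G ⟩
      + 4 ⊛ diagonalSum G ⊕ (+ q ⊖ + 1) ⊛ genericSum G
        ≡⟨ collect (+ q) H (G (V ⊕ V)) (G V) (G (+ 0)) (G w) (G (ℤ.- w)) (G (w ⊕ w)) (G (ℤ.- w ⊕ ℤ.- w)) ⟩
      combination (+ q) H (G (V ⊕ V)) (G V) (G (+ 0)) (G w) (G (ℤ.- w)) (G (w ⊕ w)) (G (ℤ.- w ⊕ ℤ.- w))
        ≡⟨ cong₇ (combination (+ q) H)
             (≡.trans (𝟙-w* (H ⊕ H) t (≡.sym (ℤ.*-distribˡ-+ w H H))) a≡)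
             (≡.trans (𝟙-w* H t ≡.refl) b≡)
             (≡.trans (𝟙-w* (+ 0) t (≡.sym (ℤ.*-zeroʳ w))) c≡)
             (≡.trans (𝟙-w* (+ 1) t (≡.sym (ℤ.*-identityʳ w))) d≡)
             (≡.trans (𝟙-w* (ℤ.- + 1) t (times-1 w)) e≡)
             (≡.trans (𝟙-w* (+ 2) t (times2 w)) f≡)
             (≡.trans (𝟙-w* (ℤ.- + 2) t (times-2 w)) g≡) ⟩
      combination (+ q) H a b c d e f g ∎
      where
      G : ℤ → ℤ
      G z = 𝟙 (z ℤ.≟ w ⊛ t)

      times-1 : ∀ w → ℤ.- w ≡ w ⊛ (ℤ.- + 1)
      times-1 = ℤ-Solver.solve-∀
      times2 : ∀ w → w ⊕ w ≡ w ⊛ + 2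
      times2 = ℤ-Solver.solve-∀
      times-2 : ∀ w → ℤ.- w ⊕ ℤ.- w ≡ w ⊛ (ℤ.- + 2)
      times-2 = ℤ-Solver.solve-∀

      collect : ∀ q H a b c d e f g →
        + 4 ⊛ (a ⊕ + 2 ⊛ (q ⊖ + 1) ⊛ b ⊕ (q ⊖ + 1) ⊛ (q ⊖ + 1) ⊛ c) ⊕ (q ⊖ + 1) ⊛
          ((+ 4 ⊛ (q ⊖ H ⊛ H) ⊛ (q ⊖ H ⊛ H) ⊕ + 2 ⊛ (H ⊛ H ⊕ H) ⊛ (H ⊛ H ⊖ H)) ⊛ c
          ⊕ + 4 ⊛ (q ⊖ H ⊛ H) ⊛ (H ⊛ H ⊕ H) ⊛ d ⊕ + 4 ⊛ (q ⊖ H ⊛ H) ⊛ (H ⊛ H ⊖ H) ⊛ e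
          ⊕ (H ⊛ H ⊕ H) ⊛ (H ⊛ H ⊕ H) ⊛ f ⊕ (H ⊛ H ⊖ H) ⊛ (H ⊛ H ⊖ H) ⊛ g) ≡
        + 4 ⊛ a ⊕ + 8 ⊛ (q ⊖ + 1) ⊛ b
        ⊕ (q ⊖ + 1) ⊛ (+ 4 ⊛ (q ⊖ + 1) ⊕ (+ 4 ⊛ (q ⊖ H ⊛ H) ⊛ (q ⊖ H ⊛ H) ⊕ + 2 ⊛ (H ⊛ H ⊕ H) ⊛ (H ⊛ H ⊖ H))) ⊛ c
        ⊕ + 4 ⊛ ((q ⊖ + 1) ⊛ (q ⊖ H ⊛ H) ⊛ (H ⊛ H ⊕ H)) ⊛ d ⊕ + 4 ⊛ ((q ⊖ + 1) ⊛ (q ⊖ H ⊛ H) ⊛ (H ⊛ H ⊖ H)) ⊛ e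
        ⊕ (q ⊖ + 1) ⊛ ((H ⊛ H ⊕ H) ⊛ (H ⊛ H ⊕ H)) ⊛ f ⊕ (q ⊖ + 1) ⊛ ((H ⊛ H ⊖ H) ⊛ (H ⊛ H ⊖ H)) ⊛ g
      collect = ℤ-Solver.solve-∀

      cong₇ : ∀ (φ : ℤ → ℤ → ℤ → ℤ → ℤ → ℤ → ℤ → ℤ) {a a′ b b′ c c′ d d′ e e′ f f′ g g′} →
              a ≡ a′ → b ≡ b′ → c ≡ c′ → d ≡ d′ → e ≡ e′ → f ≡ f′ → g ≡ g′ → φ a b c d e f g ≡ φ a′ b′ c′ d′ e′ f′ g′
      cong₇ φ ≡.refl ≡.refl ≡.refl ≡.refl ≡.refl ≡.refl ≡.refl = ≡.refl

    -- Keeps H and 2H apart from 0, ± 1 and ± 2, so that the exceptional values at c = 0 do not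
    -- merge with generic ones. The assumption m ≥ 3 enters here as 0 < h.
    3≤p^h : 3 ℕ.≤ p ℕ.^ h
    3≤p^h = ℕ.≤-trans 2<p (subst (ℕ._≤ p ℕ.^ h) (ℕ.*-identityʳ p) (ℕ.^-monoʳ-≤ p {{prime⇒nonZero p-prime}} 0<h))

    3≤p^h+p^h : 3 ℕ.≤ p ℕ.^ h ℕ.+ p ℕ.^ h
    3≤p^h+p^h = ℕ.≤-trans 3≤p^h (ℕ.m≤m+n _ _)

    large≢ : ∀ {n} → 3 ℕ.≤ n → ∀ j → j ℕ.< 3 → + n ≢ + j
    large≢ 3≤n j j<3 eq = ℕ.<⇒≢ (ℕ.<-≤-trans j<3 3≤n) (≡.sym (ℤ.+-injective eq))

    H+H≢H : H ⊕ H ≢ H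
    H+H≢H eq = ℕ.<⇒≢ (0<p^ h) (≡.sym (ℕ.+-cancelˡ-≡ (p ℕ.^ h) (p ℕ.^ h) 0 (≡.trans (ℤ.+-injective eq) (≡.sym (ℕ.+-identityʳ _)))))

    𝟙-large : ∀ {n} → 3 ℕ.≤ n → ∀ j → j ℕ.< 3 → 𝟙 (+ n ℤ.≟ + j) ≡ + 0
    𝟙-large {n} 3≤n j j<3 = 𝟙-no (+ n ℤ.≟ + j) (large≢ 3≤n j j<3)

    𝟙-large′ : ∀ {n} → 3 ℕ.≤ n → ∀ j → j ℕ.< 3 → 𝟙 (+ j ℤ.≟ + n) ≡ + 0
    𝟙-large′ {n} 3≤n j j<3 = 𝟙-no (+ j ℤ.≟ + n) (large≢ 3≤n j j<3 ∘ ≡.sym)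

    0<3 : 0 ℕ.< 3
    0<3 = ℕ.s≤s ℕ.z≤n

    1<3 : 1 ℕ.< 3
    1<3 = ℕ.s≤s (ℕ.s≤s ℕ.z≤n)

    2<3 : 2 ℕ.< 3
    2<3 = ℕ.≤-refl

    4frequency-2H : + 4 ⊛ frequency (w ⊛ (H ⊕ H)) ≡ d₂ (+ q) H
    4frequency-2H = ≡.trans
      (4frequency (H ⊕ H) (𝟙-yes (H ⊕ H ℤ.≟ H ⊕ H) ≡.refl) (𝟙-no (H ℤ.≟ H ⊕ H) (H+H≢H ∘ ≡.sym))
        (𝟙-large′ 3≤p^h+p^h 0 0<3) (𝟙-large′ 3≤p^h+p^h 1 1<3) (𝟙-no (ℤ.- + 1 ℤ.≟ H ⊕ H) λ ())
        (𝟙-large′ 3≤p^h+p^h 2 2<3) (𝟙-no (ℤ.- + 2 ℤ.≟ H ⊕ H) λ ()))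
      (pick (d₂ (+ q) H) (d₁ (+ q) H) (d₀ (+ q) H) (g₁ (+ q) H) (g₋₁ (+ q) H) (g₂ (+ q) H) (g₋₂ (+ q) H))
      where
      pick : ∀ a b c d e f g → a ⊛ + 1 ⊕ b ⊛ + 0 ⊕ c ⊛ + 0 ⊕ d ⊛ + 0 ⊕ e ⊛ + 0 ⊕ f ⊛ + 0 ⊕ g ⊛ + 0 ≡ a
      pick = ℤ-Solver.solve-∀

    4frequency-H : + 4 ⊛ frequency (w ⊛ H) ≡ d₁ (+ q) H
    4frequency-H = ≡.trans
      (4frequency H (𝟙-no (H ⊕ H ℤ.≟ H) H+H≢H) (𝟙-yes (H ℤ.≟ H) ≡.refl)
        (𝟙-large′ 3≤p^h 0 0<3) (𝟙-large′ 3≤p^h 1 1<3) (𝟙-no (ℤ.- + 1 ℤ.≟ H) λ ())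
        (𝟙-large′ 3≤p^h 2 2<3) (𝟙-no (ℤ.- + 2 ℤ.≟ H) λ ()))
      (pick (d₂ (+ q) H) (d₁ (+ q) H) (d₀ (+ q) H) (g₁ (+ q) H) (g₋₁ (+ q) H) (g₂ (+ q) H) (g₋₂ (+ q) H))
      where
      pick : ∀ a b c d e f g → a ⊛ + 0 ⊕ b ⊛ + 1 ⊕ c ⊛ + 0 ⊕ d ⊛ + 0 ⊕ e ⊛ + 0 ⊕ f ⊛ + 0 ⊕ g ⊛ + 0 ≡ b
      pick = ℤ-Solver.solve-∀

    4frequency-0 : + 4 ⊛ frequency (w ⊛ + 0) ≡ d₀ (+ q) H
    4frequency-0 = ≡.trans
      (4frequency (+ 0) (𝟙-large 3≤p^h+p^h 0 0<3) (𝟙-large 3≤p^h 0 0<3) ≡.refl ≡.refl ≡.refl ≡.refl ≡.refl)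
      (pick (d₂ (+ q) H) (d₁ (+ q) H) (d₀ (+ q) H) (g₁ (+ q) H) (g₋₁ (+ q) H) (g₂ (+ q) H) (g₋₂ (+ q) H))
      where
      pick : ∀ a b c d e f g → a ⊛ + 0 ⊕ b ⊛ + 0 ⊕ c ⊛ + 1 ⊕ d ⊛ + 0 ⊕ e ⊛ + 0 ⊕ f ⊛ + 0 ⊕ g ⊛ + 0 ≡ c
      pick = ℤ-Solver.solve-∀

    4frequency-1 : + 4 ⊛ frequency (w ⊛ + 1) ≡ g₁ (+ q) H
    4frequency-1 = ≡.trans
      (4frequency (+ 1) (𝟙-large 3≤p^h+p^h 1 1<3) (𝟙-large 3≤p^h 1 1<3) ≡.refl ≡.refl ≡.refl ≡.refl ≡.refl)
      (pick (d₂ (+ q) H) (d₁ (+ q) H) (d₀ (+ q) H) (g₁ (+ q) H) (g₋₁ (+ q) H) (g₂ (+ q) H) (g₋₂ (+ q) H))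
      where
      pick : ∀ a b c d e f g → a ⊛ + 0 ⊕ b ⊛ + 0 ⊕ c ⊛ + 0 ⊕ d ⊛ + 1 ⊕ e ⊛ + 0 ⊕ f ⊛ + 0 ⊕ g ⊛ + 0 ≡ d
      pick = ℤ-Solver.solve-∀

    4frequency-−1 : + 4 ⊛ frequency (w ⊛ (ℤ.- + 1)) ≡ g₋₁ (+ q) H
    4frequency-−1 = ≡.trans
      (4frequency (ℤ.- + 1) (𝟙-no (H ⊕ H ℤ.≟ ℤ.- + 1) λ ()) (𝟙-no (H ℤ.≟ ℤ.- + 1) λ ()) ≡.refl ≡.refl ≡.refl ≡.refl ≡.refl)
      (pick (d₂ (+ q) H) (d₁ (+ q) H) (d₀ (+ q) H) (g₁ (+ q) H) (g₋₁ (+ q) H) (g₂ (+ q) H) (g₋₂ (+ q) H))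
      where
      pick : ∀ a b c d e f g → a ⊛ + 0 ⊕ b ⊛ + 0 ⊕ c ⊛ + 0 ⊕ d ⊛ + 0 ⊕ e ⊛ + 1 ⊕ f ⊛ + 0 ⊕ g ⊛ + 0 ≡ e
      pick = ℤ-Solver.solve-∀

    4frequency-2 : + 4 ⊛ frequency (w ⊛ + 2) ≡ g₂ (+ q) H
    4frequency-2 = ≡.trans
      (4frequency (+ 2) (𝟙-large 3≤p^h+p^h 2 2<3) (𝟙-large 3≤p^h 2 2<3) ≡.refl ≡.refl ≡.refl ≡.refl ≡.refl)
      (pick (d₂ (+ q) H) (d₁ (+ q) H) (d₀ (+ q) H) (g₁ (+ q) H) (g₋₁ (+ q) H) (g₂ (+ q) H) (g₋₂ (+ q) H))
      where
      pick : ∀ a b c d e f g → a ⊛ + 0 ⊕ b ⊛ + 0 ⊕ c ⊛ + 0 ⊕ d ⊛ + 0 ⊕ e ⊛ + 0 ⊕ f ⊛ + 1 ⊕ g ⊛ + 0 ≡ f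
      pick = ℤ-Solver.solve-∀

    4frequency-−2 : + 4 ⊛ frequency (w ⊛ (ℤ.- + 2)) ≡ g₋₂ (+ q) H
    4frequency-−2 = ≡.trans
      (4frequency (ℤ.- + 2) (𝟙-no (H ⊕ H ℤ.≟ ℤ.- + 2) λ ()) (𝟙-no (H ℤ.≟ ℤ.- + 2) λ ()) ≡.refl ≡.refl ≡.refl ≡.refl ≡.refl)
      (pick (d₂ (+ q) H) (d₁ (+ q) H) (d₀ (+ q) H) (g₁ (+ q) H) (g₋₁ (+ q) H) (g₂ (+ q) H) (g₋₂ (+ q) H))
      where
      pick : ∀ a b c d e f g → a ⊛ + 0 ⊕ b ⊛ + 0 ⊕ c ⊛ + 0 ⊕ d ⊛ + 0 ⊕ e ⊛ + 0 ⊕ f ⊛ + 0 ⊕ g ⊛ + 1 ≡ g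
      pick = ℤ-Solver.solve-∀

    -- Comparison with the rational frequency formulas

    m∸1≡ : m ℕ.∸ 1 ≡ h ℕ.* 2
    m∸1≡ = ≡.trans (cong (ℕ._∸ 1) m≡2h+1) (ℕ.m+n∸n≡m (h ℕ.* 2) 1)

    [m∸1]/2≡ : (m ℕ.∸ 1) / 2 ≡ h
    [m∸1]/2≡ = ≡.trans (cong (_/ 2) m∸1≡) (m*n/n≡m h 2)

    [m+1]/2≡ : (m ℕ.+ 1) / 2 ≡ suc h
    [m+1]/2≡ = ≡.trans (cong (_/ 2) (≡.trans (cong (ℕ._+ 1) m≡2h+1) (arrange h))) (m*n/n≡m (suc h) 2)
      where
      arrange : ∀ h → h ℕ.* 2 ℕ.+ 1 ℕ.+ 1 ≡ suc h ℕ.* 2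
      arrange = ℕ-Solver.solve-∀

    P : ℕ → ℤ
    P n = + (p ℕ.^ n)

    P-+ : ∀ i j → P (i ℕ.+ j) ≡ P i ⊛ P j
    P-+ i j = ≡.trans (cong (λ z → + z) (ℕ.^-distribˡ-+-* p i j)) (ℤ.pos-* (p ℕ.^ i) (p ℕ.^ j))

    P-2* : ∀ n → P (2 ℕ.* n) ≡ P n ⊛ P n
    P-2* n = ≡.trans (cong P (cong (n ℕ.+_) (ℕ.+-identityʳ n))) (P-+ n n)

    P[m∸1]≡ : P (m ℕ.∸ 1) ≡ H ⊛ H
    P[m∸1]≡ = ≡.trans (cong P (≡.trans m∸1≡ (ℕ.*-comm h 2))) (P-2* h)

    P[[m∸1]/2]≡ : P ((m ℕ.∸ 1) / 2) ≡ H
    P[[m∸1]/2]≡ = cong P [m∸1]/2≡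

    P[2m∸1]≡ : P (2 ℕ.* m ℕ.∸ 1) ≡ P m ⊛ (H ⊛ H)
    P[2m∸1]≡ = begin
      P (m ℕ.+ (m ℕ.+ 0) ℕ.∸ 1) ≡⟨ cong (λ n → P (m ℕ.+ n ℕ.∸ 1)) (ℕ.+-identityʳ m) ⟩
      P (m ℕ.+ m ℕ.∸ 1) ≡⟨ cong P (ℕ.+-∸-assoc m 0<m) ⟩
      P (m ℕ.+ (m ℕ.∸ 1)) ≡⟨ P-+ m (m ℕ.∸ 1) ⟩
      P m ⊛ P (m ℕ.∸ 1) ≡⟨ cong (P m ⊛_) P[m∸1]≡ ⟩
      P m ⊛ (H ⊛ H) ∎

    w₁≡ : (+ p ⊖ + 1) ⊛ P ((m ℕ.+ 1) / 2) ≡ w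
    w₁≡ = cong (λ n → (+ p ⊖ + 1) ⊛ P n) [m+1]/2≡

    v₁≡ : (+ p ⊖ + 1) ⊛ P m ≡ w ⊛ H
    v₁≡ = ≡.trans (ℤ.*-comm (+ p ⊖ + 1) (P m)) q*[p-1]≡V

    v₂≡ : + 2 ⊛ (+ p ⊖ + 1) ⊛ P m ≡ w ⊛ (H ⊕ H)
    v₂≡ = ≡.trans (ℤ.*-assoc (+ 2) (+ p ⊖ + 1) (P m)) (≡.trans (cong (+ 2 ⊛_) v₁≡) (double w H))
      where
      double : ∀ w H → + 2 ⊛ (w ⊛ H) ≡ w ⊛ (H ⊕ H)
      double = ℤ-Solver.solve-∀

    w₂≡ : + 2 ⊛ (+ p ⊖ + 1) ⊛ P ((m ℕ.+ 1) / 2) ≡ w ⊛ + 2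
    w₂≡ = ≡.trans (ℤ.*-assoc (+ 2) (+ p ⊖ + 1) (P ((m ℕ.+ 1) / 2))) (≡.trans (cong (+ 2 ⊛_) w₁≡) (ℤ.*-comm (+ 2) w))

    Q′ H′ : ℚ
    Q′ = ι (P m)
    H′ = ι H

    ιP[m∸1]≡ : ι (P (m ℕ.∸ 1)) ≡ H′ ℚ.* H′
    ιP[m∸1]≡ = ≡.trans (cong ι P[m∸1]≡) (ι-* H H)

    ιP[[m∸1]/2]≡ : ι (P ((m ℕ.∸ 1) / 2)) ≡ H′
    ιP[[m∸1]/2]≡ = cong ι P[[m∸1]/2]≡

    qₑ Hₑ : Expr
    qₑ = lit (+ q)
    Hₑ = lit H

    -- `a` is four times the frequency. Written as an `Expr` it moves to ℚ, where the division by 4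
    -- can be carried out before the comparison with f.
    tabulate : ∀ {v t y f} (a : Expr) → v ≡ w ⊛ t → + 4 ⊛ frequency (w ⊛ t) ≡ y → y ≡ valueℤ a →
               (+ 1 ℚ./ 4) ℚ.* valueℚ a ≡ f → ι (frequency v) ≡ f
    tabulate {v} {t} {y} {f} a v≡ 4freq≡ y≡ f≡ = begin
      ι (frequency v) ≡⟨ cong (ι ∘ frequency) v≡ ⟩
      ι (frequency (w ⊛ t)) ≡⟨ quarter (≡.trans 4freq≡ y≡) ⟩
      (+ 1 ℚ./ 4) ℚ.* ι (valueℤ a) ≡⟨ cong ((+ 1 ℚ./ 4) ℚ.*_) (ι-value a) ⟩
      (+ 1 ℚ./ 4) ℚ.* valueℚ a ≡⟨ f≡ ⟩
      f ∎

    open ℚ-Solver using () renaming (solve to solveℚ; _:=_ to _:≡_; con to conℚ; _:+_ to infixl 7 _⟨+⟩_; _:*_ to infixl 8 _⟨*⟩_; _:-_ to infixl 7 _⟨-⟩_)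

    table : All (λ vf → ι (frequency (proj₁ vf)) ≡ proj₂ vf) (distribution p m)
    table =
      tabulate (lit (+ 4)) v₂≡ 4frequency-2H ≡.refl ≡.refl
      ∷ tabulate (lit (+ 8) ⊠ (qₑ ⊟ lit (+ 1))) v₁≡ 4frequency-H ≡.refl
          (solveℚ 1 (λ q → conℚ (+ 1 ℚ./ 4) ⟨*⟩ (conℚ (+ 8 ℚ./ 1) ⟨*⟩ (q ⟨-⟩ conℚ (+ 1 ℚ./ 1))) :≡ conℚ (+ 2 ℚ./ 1) ⟨*⟩ (q ⟨-⟩ conℚ (+ 1 ℚ./ 1))) ≡.refl Q′)
      ∷ tabulate (lit (+ 4) ⊠ ((qₑ ⊟ lit (+ 1)) ⊠ (qₑ ⊟ Hₑ ⊠ Hₑ) ⊠ (Hₑ ⊠ Hₑ ⊞ Hₑ))) (≡.trans w₁≡ (≡.sym (ℤ.*-identityʳ w))) 4frequency-1 ≡.refl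
          (≡.trans
            (solveℚ 2 (λ q H → conℚ (+ 1 ℚ./ 4) ⟨*⟩ (conℚ (+ 4 ℚ./ 1) ⟨*⟩ ((q ⟨-⟩ conℚ (+ 1 ℚ./ 1)) ⟨*⟩ (q ⟨-⟩ H ⟨*⟩ H) ⟨*⟩ (H ⟨*⟩ H ⟨+⟩ H)))
              :≡ (q ⟨-⟩ conℚ (+ 1 ℚ./ 1)) ⟨*⟩ (q ⟨-⟩ H ⟨*⟩ H) ⟨*⟩ (H ⟨*⟩ H ⟨+⟩ H)) ≡.refl Q′ H′)
            -- The solver identity involves only q and H; here p^(m-1) and p^((m-1)/2) in the
            -- tabulated formula are replaced by H² and H.
            (≡.sym (cong₂ (λ P h → (Q′ ℚ.- (+ 1 ℚ./ 1)) ℚ.* (Q′ ℚ.- P) ℚ.* (P ℚ.+ h)) ιP[m∸1]≡ ιP[[m∸1]/2]≡)))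
      ∷ tabulate (lit (+ 4) ⊠ ((qₑ ⊟ lit (+ 1)) ⊠ (qₑ ⊟ Hₑ ⊠ Hₑ) ⊠ (Hₑ ⊠ Hₑ ⊟ Hₑ))) (≡.trans (cong (ℤ.-_) w₁≡) (minus1 w)) 4frequency-−1 ≡.refl
          (≡.trans
            (solveℚ 2 (λ q H → conℚ (+ 1 ℚ./ 4) ⟨*⟩ (conℚ (+ 4 ℚ./ 1) ⟨*⟩ ((q ⟨-⟩ conℚ (+ 1 ℚ./ 1)) ⟨*⟩ (q ⟨-⟩ H ⟨*⟩ H) ⟨*⟩ (H ⟨*⟩ H ⟨-⟩ H)))
              :≡ (q ⟨-⟩ conℚ (+ 1 ℚ./ 1)) ⟨*⟩ (q ⟨-⟩ H ⟨*⟩ H) ⟨*⟩ (H ⟨*⟩ H ⟨-⟩ H)) ≡.refl Q′ H′)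
            (≡.sym (cong₂ (λ P h → (Q′ ℚ.- (+ 1 ℚ./ 1)) ℚ.* (Q′ ℚ.- P) ℚ.* (P ℚ.- h)) ιP[m∸1]≡ ιP[[m∸1]/2]≡)))
      ∷ tabulate ((qₑ ⊟ lit (+ 1)) ⊠ ((Hₑ ⊠ Hₑ ⊞ Hₑ) ⊠ (Hₑ ⊠ Hₑ ⊞ Hₑ))) w₂≡ 4frequency-2 ≡.refl
          (≡.trans
            (solveℚ 2 (λ q H → conℚ (+ 1 ℚ./ 4) ⟨*⟩ ((q ⟨-⟩ conℚ (+ 1 ℚ./ 1)) ⟨*⟩ ((H ⟨*⟩ H ⟨+⟩ H) ⟨*⟩ (H ⟨*⟩ H ⟨+⟩ H)))
              :≡ conℚ (+ 1 ℚ./ 4) ⟨*⟩ (q ⟨-⟩ conℚ (+ 1 ℚ./ 1)) ⟨*⟩ ((H ⟨*⟩ H ⟨+⟩ H) ⟨*⟩ (H ⟨*⟩ H ⟨+⟩ H))) ≡.refl Q′ H′)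
            (≡.sym (cong₂ (λ P h → (+ 1 ℚ./ 4) ℚ.* (Q′ ℚ.- (+ 1 ℚ./ 1)) ℚ.* ((P ℚ.+ h) ℚ.* (P ℚ.+ h))) ιP[m∸1]≡ ιP[[m∸1]/2]≡)))
      ∷ tabulate ((qₑ ⊟ lit (+ 1)) ⊠ ((Hₑ ⊠ Hₑ ⊟ Hₑ) ⊠ (Hₑ ⊠ Hₑ ⊟ Hₑ))) (≡.trans (cong (ℤ.-_) w₂≡) (ℤ.neg-distribʳ-* w (+ 2))) 4frequency-−2 ≡.refl
          (≡.trans
            (solveℚ 2 (λ q H → conℚ (+ 1 ℚ./ 4) ⟨*⟩ ((q ⟨-⟩ conℚ (+ 1 ℚ./ 1)) ⟨*⟩ ((H ⟨*⟩ H ⟨-⟩ H) ⟨*⟩ (H ⟨*⟩ H ⟨-⟩ H)))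
              :≡ conℚ (+ 1 ℚ./ 4) ⟨*⟩ (q ⟨-⟩ conℚ (+ 1 ℚ./ 1)) ⟨*⟩ ((H ⟨*⟩ H ⟨-⟩ H) ⟨*⟩ (H ⟨*⟩ H ⟨-⟩ H))) ≡.refl Q′ H′)
            (≡.sym (cong₂ (λ P h → (+ 1 ℚ./ 4) ℚ.* (Q′ ℚ.- (+ 1 ℚ./ 1)) ℚ.* ((P ℚ.- h) ℚ.* (P ℚ.- h))) ιP[m∸1]≡ ιP[[m∸1]/2]≡)))
      ∷ tabulate ((qₑ ⊟ lit (+ 1)) ⊠ (lit (+ 4) ⊠ (qₑ ⊟ lit (+ 1)) ⊞ (lit (+ 4) ⊠ (qₑ ⊟ Hₑ ⊠ Hₑ) ⊠ (qₑ ⊟ Hₑ ⊠ Hₑ) ⊞ lit (+ 2) ⊠ (Hₑ ⊠ Hₑ ⊞ Hₑ) ⊠ (Hₑ ⊠ Hₑ ⊟ Hₑ))))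
          (≡.sym (ℤ.*-zeroʳ w)) 4frequency-0 ≡.refl
          (≡.trans
            (solveℚ 2 (λ q H → conℚ (+ 1 ℚ./ 4) ⟨*⟩ ((q ⟨-⟩ conℚ (+ 1 ℚ./ 1)) ⟨*⟩ (conℚ (+ 4 ℚ./ 1) ⟨*⟩ (q ⟨-⟩ conℚ (+ 1 ℚ./ 1)) ⟨+⟩
                (conℚ (+ 4 ℚ./ 1) ⟨*⟩ (q ⟨-⟩ H ⟨*⟩ H) ⟨*⟩ (q ⟨-⟩ H ⟨*⟩ H) ⟨+⟩ conℚ (+ 2 ℚ./ 1) ⟨*⟩ (H ⟨*⟩ H ⟨+⟩ H) ⟨*⟩ (H ⟨*⟩ H ⟨-⟩ H))))
              :≡ (q ⟨-⟩ conℚ (+ 1 ℚ./ 1)) ⟨*⟩ (q ⟨*⟩ q ⟨+⟩ conℚ (+ 3 ℚ./ 2) ⟨*⟩ ((H ⟨*⟩ H) ⟨*⟩ (H ⟨*⟩ H)) ⟨-⟩ conℚ (+ 2 ℚ./ 1) ⟨*⟩ (q ⟨*⟩ (H ⟨*⟩ H))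
                ⟨+⟩ q ⟨-⟩ conℚ ½ ⟨*⟩ (H ⟨*⟩ H) ⟨-⟩ conℚ (+ 1 ℚ./ 1))) ≡.refl Q′ H′)
            (≡.sym (≡.trans
              (cong₂ (λ A B → (Q′ ℚ.- (+ 1 ℚ./ 1)) ℚ.* (A ℚ.+ (+ 3 ℚ./ 2) ℚ.* B ℚ.- (+ 2 ℚ./ 1) ℚ.* ι (P (2 ℕ.* m ℕ.∸ 1)) ℚ.+ Q′ ℚ.- ½ ℚ.* ι (P (m ℕ.∸ 1)) ℚ.- (+ 1 ℚ./ 1)))
                (≡.trans (cong ι (P-2* m)) (ι-* (P m) (P m)))
                (≡.trans (cong ι (P-2* (m ℕ.∸ 1))) (≡.trans (ι-* (P (m ℕ.∸ 1)) (P (m ℕ.∸ 1))) (cong (λ z → z ℚ.* z) ιP[m∸1]≡))))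
              (cong₂ (λ A B → (Q′ ℚ.- (+ 1 ℚ./ 1)) ℚ.* (Q′ ℚ.* Q′ ℚ.+ (+ 3 ℚ./ 2) ℚ.* ((H′ ℚ.* H′) ℚ.* (H′ ℚ.* H′)) ℚ.- (+ 2 ℚ./ 1) ℚ.* A ℚ.+ Q′ ℚ.- ½ ℚ.* B ℚ.- (+ 1 ℚ./ 1)))
                (≡.trans (cong ι P[2m∸1]≡) (≡.trans (ι-* (P m) (H ⊛ H)) (cong (Q′ ℚ.*_) (ι-* H H))))
                ιP[m∸1]≡))))
      ∷ []
      where
      minus1 : ∀ w → ℤ.- w ≡ w ⊛ (ℤ.- + 1)
      minus1 = ℤ-Solver.solve-∀

    -- Completeness of the list of values

    Listed : ℤ → Set
    Listed z = Any (λ vf → z ≡ proj₁ vf) (distribution p m)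

    listed-2H : Listed (w ℤ.* (H ℤ.+ H))
    listed-2H = here (≡.sym v₂≡)

    listed-H : Listed (w ℤ.* H)
    listed-H = there (here (≡.sym v₁≡))

    listed-w : Listed w
    listed-w = there (there (here (≡.sym w₁≡)))

    listed-−w : Listed (ℤ.- w)
    listed-−w = there (there (there (here (cong ℤ.-_ (≡.sym w₁≡)))))

    listed-2w : Listed (w ℤ.* + 2)
    listed-2w = there (there (there (there (here (≡.sym w₂≡)))))

    listed-−2w : Listed (ℤ.- (w ℤ.* + 2))
    listed-−2w = there (there (there (there (there (here (cong ℤ.-_ (≡.sym w₂≡)))))))

    listed-0 : Listed (+ 0)
    listed-0 = there (there (there (there (there (there (here ≡.refl))))))

    Value : ℤ → Set
    Value z = z ≡ + 0 ⊎ z ≡ w ⊎ z ≡ ℤ.- w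

    listed-sum : ∀ {x y} → Value x → Value y → Listed (x ℤ.+ y)
    listed-sum (inj₁ ≡.refl) (inj₁ ≡.refl) = listed-0
    listed-sum (inj₁ ≡.refl) (inj₂ (inj₁ ≡.refl)) = subst Listed (≡.sym (ℤ.+-identityˡ w)) listed-w
    listed-sum (inj₁ ≡.refl) (inj₂ (inj₂ ≡.refl)) = subst Listed (≡.sym (ℤ.+-identityˡ (ℤ.- w))) listed-−w
    listed-sum (inj₂ (inj₁ ≡.refl)) (inj₁ ≡.refl) = subst Listed (≡.sym (ℤ.+-identityʳ w)) listed-w
    listed-sum (inj₂ (inj₂ ≡.refl)) (inj₁ ≡.refl) = subst Listed (≡.sym (ℤ.+-identityʳ (ℤ.- w))) listed-−w
    listed-sum (inj₂ (inj₁ ≡.refl)) (inj₂ (inj₁ ≡.refl)) = subst Listed (double w) listed-2w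
      where
      double : ∀ w → w ℤ.* + 2 ≡ w ℤ.+ w
      double = ℤ-Solver.solve-∀
    listed-sum (inj₂ (inj₁ ≡.refl)) (inj₂ (inj₂ ≡.refl)) = subst Listed (≡.sym (ℤ.+-inverseʳ w)) listed-0
    listed-sum (inj₂ (inj₂ ≡.refl)) (inj₂ (inj₁ ≡.refl)) = subst Listed (≡.sym (ℤ.+-inverseˡ w)) listed-0
    listed-sum (inj₂ (inj₂ ≡.refl)) (inj₂ (inj₂ ≡.refl)) = subst Listed (double w) listed-−2w
      where
      double : ∀ w → ℤ.- (w ℤ.* + 2) ≡ ℤ.- w ℤ.+ ℤ.- w
      double = ℤ-Solver.solve-∀

    T-diagonal-value : ∀ x → T x 0# ≡ w ℤ.* H ⊎ T x 0# ≡ + 0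
    T-diagonal-value x = split (x ≟ 0#)
      where
      split : Dec (x ≡ 0#) → T x 0# ≡ w ℤ.* H ⊎ T x 0# ≡ + 0
      split (yes ≡.refl) = inj₁ (≡.trans T-zero q*[p-1]≡V)
      split (no x≢0)     = inj₂ (T-diagonal x x≢0)

    listed-diagonal : ∀ {x y} → x ≡ w ℤ.* H ⊎ x ≡ + 0 → y ≡ w ℤ.* H ⊎ y ≡ + 0 → Listed (x ℤ.+ y)
    listed-diagonal (inj₁ ≡.refl) (inj₁ ≡.refl) = subst Listed (ℤ.*-distribˡ-+ w H H) listed-2H
    listed-diagonal (inj₁ ≡.refl) (inj₂ ≡.refl) = subst Listed (≡.sym (ℤ.+-identityʳ (w ℤ.* H))) listed-H
    listed-diagonal (inj₂ ≡.refl) (inj₁ ≡.refl) = subst Listed (≡.sym (ℤ.+-identityˡ (w ℤ.* H))) listed-H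
    listed-diagonal (inj₂ ≡.refl) (inj₂ ≡.refl) = listed-0

    listed : ∀ x y c → Listed (T x c ℤ.+ T y c)
    listed x y c = split (c ≟ 0#)
      where
      split : Dec (c ≡ 0#) → Listed (T x c ℤ.+ T y c)
      split (yes ≡.refl) = listed-diagonal (T-diagonal-value x) (T-diagonal-value y)
      split (no c≢0)     = listed-sum (T-values x c≢0) (T-values y c≢0)

-- Heyting fields and the integers in them

module HeytingFieldProperties {c ℓ₁ ℓ₂} (K : HeytingField c ℓ₁ ℓ₂) where

  open HeytingField K using (_#_; tight; #⇒invertible)
  open FieldNotions K hiding (zero)
  open import Relation.Binary.Reasoning.Setoid setoid

  open IntegerImage commutativeRing using (⟦_⟧; ⟦⟧-+; ⟦⟧-neg; ⟦⟧-*)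

  invertible : ∀ {x} → x # 0# → ∃[ y ] x * y ≈ 1#
  invertible {x} x#0 = let (y , _ , [x-0]y≈1) = #⇒invertible x#0 in y , (begin
    x * y ≈⟨ *-congʳ (+-identityʳ x) ⟨
    (x + 0#) * y ≈⟨ *-congʳ (+-congˡ (RingProperties.-0#≈0# ring)) ⟨
    (x - 0#) * y ≈⟨ [x-0]y≈1 ⟩
    1# ∎)

  ¬#⇒≈ : ∀ {x y} → ¬ x # y → x ≈ y
  ¬#⇒≈ {x} {y} = proj₁ (tight x y)

  -- K comes without decidable equality. If y were apart from 0 it would be invertible and x would
  -- vanish; tightness turns the refutation of apartness into y ≈ 0.
  *-nonzeroˡ : ∀ {x y} → x * y ≈ 0# → ¬ (x ≈ 0#) → y ≈ 0#
  *-nonzeroˡ {x} {y} xy≈0 x≉0 = ¬#⇒≈ λ y#0 → x≉0 (let (z , yz≈1) = invertible y#0 in begin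
    x ≈⟨ *-identityʳ x ⟨
    x * 1# ≈⟨ *-congˡ yz≈1 ⟨
    x * (y * z) ≈⟨ *-assoc x y z ⟨
    x * y * z ≈⟨ *-congʳ xy≈0 ⟩
    0# * z ≈⟨ zeroˡ z ⟩
    0# ∎)

  fromℤ≈⟦⟧ : ∀ z → fromℤ z ≈ ⟦ z ⟧
  fromℤ≈⟦⟧ (+ n)    = refl
  fromℤ≈⟦⟧ -[1+ n ] = refl

  fromℤ-+ : ∀ x y → fromℤ (x ℤ.+ y) ≈ fromℤ x + fromℤ y
  fromℤ-+ x y = trans (fromℤ≈⟦⟧ (x ℤ.+ y)) (trans (⟦⟧-+ x y) (sym (+-cong (fromℤ≈⟦⟧ x) (fromℤ≈⟦⟧ y))))

  fromℤ-neg : ∀ x → fromℤ (ℤ.- x) ≈ - fromℤ x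
  fromℤ-neg x = trans (fromℤ≈⟦⟧ (ℤ.- x)) (trans (⟦⟧-neg x) (sym (-‿cong (fromℤ≈⟦⟧ x))))

  fromℤ-≡ : ∀ {x y} → x ≡ y → fromℤ x ≈ fromℤ y
  fromℤ-≡ ≡.refl = refl

  fromℤ-sum : ∀ {n} (f : Fin n → ℤ) → fromℤ (IntegerSums.∑ f) ≈ Sum.sum semiring (λ i → fromℤ (f i))
  fromℤ-sum {zero}  f = fromℤ-≡ (IntegerSums.∑-empty f)
  fromℤ-sum {suc n} f = trans (fromℤ-≡ (IntegerSums.∑-suc f)) (trans (fromℤ-+ (f zero) _) (+-congˡ (fromℤ-sum (f ∘ suc))))

  module _ (char0 : CharacteristicZero) where

    fromℤ-nonzero : ∀ z → fromℤ z ≈ 0# → z ≡ + 0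
    fromℤ-nonzero (+ n)    eq = cong (λ n → + n) (char0 n eq)
    fromℤ-nonzero -[1+ n ] eq with () ← char0 (suc n) (trans (sym (RingProperties.-‿involutive ring _)) (trans (-‿cong eq) (RingProperties.-0#≈0# ring)))

    fromℤ-injective : ∀ x y → fromℤ x ≈ fromℤ y → x ≡ y
    fromℤ-injective x y eq = ℤ.i-j≡0⇒i≡j x y (fromℤ-nonzero (x ℤ.- y) (begin
      fromℤ (x ℤ.- y) ≈⟨ fromℤ-+ x (ℤ.- y) ⟩
      fromℤ x + fromℤ (ℤ.- y) ≈⟨ +-cong eq (fromℤ-neg y) ⟩
      fromℤ y - fromℤ y ≈⟨ -‿inverseʳ _ ⟩
      0# ∎))

-- Transport of a finite field to `Fin q`

module Transport {c ℓ₁ ℓ₂} {q : ℕ} (F : FiniteField c ℓ₁ ℓ₂ q) (1<q : 1 ℕ.< q) where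

  private
    module F = FiniteField F
    module HF = HeytingFieldProperties F.heytingField
  open F using (_≈_)

  to : Fin q → F.Carrier
  to = F.element

  from : F.Carrier → Fin q
  from = Inverse.from F.enumeration

  from-cong : ∀ {x y} → x ≈ y → from x ≡ from y
  from-cong = Inverse.from-cong F.enumeration

  to-from : ∀ x → to (from x) ≈ x
  to-from = Inverse.strictlyInverseˡ F.enumeration

  from-to : ∀ x → from (to x) ≡ x
  from-to = Inverse.strictlyInverseʳ F.enumeration

  to-injective : ∀ {x y} → to x ≈ to y → x ≡ y
  to-injective {x} {y} eq = ≡.trans (≡.sym (from-to x)) (≡.trans (from-cong eq) (from-to y))

  rawRing : RawRing _ _
  rawRing = record
    { Carrier = Fin q
    ; _≈_     = _≡_
    ; _+_     = λ x y → from (to x F.+ to y)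
    ; _*_     = λ x y → from (to x F.* to y)
    ; -_      = λ x → from (F.- to x)
    ; 0#      = from F.0#
    ; 1#      = from F.1#
    }

  to-isRingMonomorphism : IsRingMonomorphism rawRing (CommutativeRing.rawRing F.commutativeRing) to
  to-isRingMonomorphism = record
    { isRingHomomorphism = record
      { isSemiringHomomorphism = record
        { isNearSemiringHomomorphism = record
          { +-isMonoidHomomorphism = record
            { isMagmaHomomorphism = record
              { isRelHomomorphism = record { cong = λ { ≡.refl → F.refl } }
              ; homo = λ _ _ → to-from _
              }
            ; ε-homo = to-from _
            }
          ; *-homo = λ _ _ → to-from _
          }
        ; 1#-homo = to-from _
        }
      ; -‿homo = λ _ → to-from _
      }
    ; injective = to-injective
    }

  private
    module R = RawRing rawRing

  1≉0 : ¬ (F.1# ≈ F.0#)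
  1≉0 1≈0 = ℕ.0≢1+n (≡.trans (≡.sym (Fin.toℕ-fromℕ< 0<q)) (≡.trans (cong toℕ (to-injective collapse)) (Fin.toℕ-fromℕ< 1<q)))
    where
    0<q : 0 ℕ.< q
    0<q = ℕ.<-trans (ℕ.n<1+n 0) 1<q

    ≈0 : ∀ x → x ≈ F.0#
    ≈0 x = F.trans (F.sym (F.*-identityʳ x)) (F.trans (F.*-congˡ 1≈0) (F.zeroʳ x))

    collapse : to (Fin.fromℕ< 0<q) ≈ to (Fin.fromℕ< 1<q)
    collapse = F.trans (≈0 _) (F.sym (≈0 _))

  -- Inequality alone yields no apartness, hence no inverse. A finite search decides whether an
  -- inverse exists; if there is none, x is not apart from 0, and tightness gives x = 0.
  inverse : ∀ x → x ≢ R.0# → ∃[ y ] x R.* y ≡ R.1#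
  inverse x x≢0 with Fin.any? (λ y → (x R.* y) Fin.≟ R.1#)
  ... | yes found = found
  ... | no absent = contradiction x≡0 x≢0
    where
    x≡0 : x ≡ R.0#
    x≡0 = to-injective (F.trans (HF.¬#⇒≈ λ x#0 → let (y , xy≈1) = HF.invertible x#0 in
      absent (from y , from-cong (F.trans (F.*-congˡ (to-from y)) xy≈1))) (F.sym (to-from F.0#)))

  fieldOn : FieldOn q
  fieldOn = record
    { isCommutativeRing = RingMonomorphism.isCommutativeRing to-isRingMonomorphism
                            (CommutativeRing.isCommutativeRing F.commutativeRing)
    ; inverse = inverse
    ; 1≢0 = λ 1≡0 → 1≉0 (F.trans (F.sym (to-from F.1#)) (F.trans (F.reflexive (cong to 1≡0)) (to-from F.0#)))
    }

-- Evaluation of the exponential sum in K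

module Evaluation {ℓ₀ ℓ₁ ℓ₂ ℓ₀′ ℓ₁′ ℓ₂′} {p m : ℕ} (p-prime : Prime p) (2<p : 2 ℕ.< p) (h : ℕ) (m≡2h+1 : m ≡ h ℕ.* 2 ℕ.+ 1) (0<m : 0 ℕ.< m) (0<h : 0 ℕ.< h)
                  (k : ℕ) (gcd≡1 : gcd m k ≡ 1) (F : FiniteField ℓ₀ ℓ₁ ℓ₂ (p ℕ.^ m)) (1<q : 1 ℕ.< p ℕ.^ m)
                  (u : Fin p) (u-nonsquare : FiniteFieldNotions.IsNonsquareIn𝔽p p m F u)
                  (K : HeytingField ℓ₀′ ℓ₁′ ℓ₂′) (ζ : HeytingField.Carrier K) (ζ-primitive : FieldNotions.IsPrimitiveRoot K p ζ) where

  open Transport F 1<q public using (to; from; from-cong; to-from; from-to; to-injective; fieldOn)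

  open JointValues p-prime 2<p h m≡2h+1 0<m 0<h fieldOn k gcd≡1 public

  private
    module F = FiniteField F
    module 𝕂 = FieldNotions K
    module FΣ = Sum F.semiring
    module RΣ = Sum semiring
    module 𝕂Σ = Sum 𝕂.semiring
  open FiniteFieldNotions p m F using (residue) renaming (Tr to Tr-F)
  open ExponentialSum p m k F u K ζ public using (S; χ; λ₀)
  open HeytingFieldProperties K using (fromℤ-+; fromℤ-≡; fromℤ-sum; fromℤ-neg)

  to-≡ : ∀ {x y} → x ≡ y → to x F.≈ to y
  to-≡ ≡.refl = F.refl

  to-+ : ∀ x y → to (x + y) F.≈ to x F.+ to y
  to-+ x y = to-from _

  to-* : ∀ x y → to (x * y) F.≈ to x F.* to y
  to-* x y = to-from _

  to-neg : ∀ x → to (- x) F.≈ F.- to x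
  to-neg x = to-from _

  to-^ : ∀ x n → to (x ^ n) F.≈ to x F.^ n
  to-^ x zero    = to-from _
  to-^ x (suc n) = F.trans (to-* x (x ^ n)) (F.*-congˡ (to-^ x n))

  to-·1 : ∀ n → to (n · 1#) F.≈ F.fromℕ n
  to-·1 zero    = to-from _
  to-·1 (suc n) = F.trans (to-+ 1# (n · 1#)) (F.+-cong (to-from _) (to-·1 n))

  to-sum : ∀ n (f : Fin n → A) → to (RΣ.sum f) F.≈ FΣ.sum (λ i → to (f i))
  to-sum zero    f = to-from _
  to-sum (suc n) f = F.trans (to-+ _ _) (F.+-congˡ (to-sum n (f ∘ suc)))

  F-^-cong : ∀ {x y} n → x F.≈ y → x F.^ n F.≈ y F.^ n
  F-^-cong n = Exp.^-congˡ F.semiring n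

  Tr-F-to : ∀ {z} x → z F.≈ to x → Tr-F z F.≈ to (Tr x)
  Tr-F-to {z} x z≈ = F.trans
    (FΣ.sum-cong-≋ {m} (λ i → F.trans (F-^-cong (p ℕ.^ toℕ i) z≈) (F.sym (to-^ x (p ℕ.^ toℕ i)))))
    (F.sym (to-sum m (λ i → frob (toℕ i) x)))

  -- `residue` returns whichever index its search meets; `fp-injective` leaves j as the only
  -- candidate, and the hypothesis excludes the default 0.
  residue-spec : ∀ z (j : Fin p) → F.fromℕ (toℕ j) F.≈ z → residue z ≡ toℕ j
  residue-spec z j fj≈z with Fin.any? (λ (j : Fin p) → F.fromℕ (toℕ j) F.≟ z)
  ... | no absent = contradiction (j , fj≈z) absent
  ... | yes (j′ , fj′≈z) = cong toℕ (fp-injective {j′} {j} (to-injective (F.trans (to-·1 (toℕ j′)) (F.trans fj′≈z (F.trans (F.sym fj≈z) (F.sym (to-·1 (toℕ j))))))))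

  index : ∀ {t} → t ∈𝔽p → Fin p
  index t∈ = proj₁ (fp-onto _ t∈)

  fp-index : ∀ {t} (t∈ : t ∈𝔽p) → fp (index t∈) ≡ t
  fp-index t∈ = proj₂ (fp-onto _ t∈)

  χ-index : ∀ {z t} (t∈ : t ∈𝔽p) → z F.≈ to t → χ z ≡ ζ 𝕂.^ toℕ (index t∈)
  χ-index {z} t∈ z≈ = cong (ζ 𝕂.^_) (residue-spec z (index t∈)
    (F.trans (F.sym (to-·1 (toℕ (index t∈)))) (F.trans (to-≡ (fp-index t∈)) (F.sym z≈))))

  -- The geometric sum in a form free of subtraction: both sides are 1 + ζ + ... + ζⁿ.
  geometric : ∀ n → 𝕂.1# 𝕂.+ ζ 𝕂.* 𝕂Σ.sum {n} (λ i → ζ 𝕂.^ toℕ i) 𝕂.≈ 𝕂Σ.sum {n} (λ i → ζ 𝕂.^ toℕ i) 𝕂.+ ζ 𝕂.^ n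
  geometric zero    = 𝕂.trans (𝕂.+-congˡ (𝕂.zeroʳ ζ)) (𝕂.+-comm _ _)
  geometric (suc n) = begin
    𝕂.1# 𝕂.+ ζ 𝕂.* (𝕂.1# 𝕂.+ Gζ) ≈⟨ 𝕂.+-congˡ (𝕂.*-congˡ step) ⟩
    𝕂.1# 𝕂.+ ζ 𝕂.* (G 𝕂.+ ζ 𝕂.^ n) ≈⟨ 𝕂.+-congˡ (𝕂.distribˡ ζ G (ζ 𝕂.^ n)) ⟩
    𝕂.1# 𝕂.+ (ζ 𝕂.* G 𝕂.+ ζ 𝕂.^ suc n) ≈⟨ 𝕂.+-assoc _ _ _ ⟨
    𝕂.1# 𝕂.+ ζ 𝕂.* G 𝕂.+ ζ 𝕂.^ suc n ≈⟨ 𝕂.+-congʳ (𝕂.+-congˡ (𝕂Σ.*-distribˡ-sum {n} ζ (λ i → ζ 𝕂.^ toℕ i))) ⟩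
    𝕂.1# 𝕂.+ Gζ 𝕂.+ ζ 𝕂.^ suc n ∎
    where
    open import Relation.Binary.Reasoning.Setoid 𝕂.setoid
    G Gζ : 𝕂.Carrier
    G = 𝕂Σ.sum {n} (λ i → ζ 𝕂.^ toℕ i)
    Gζ = 𝕂Σ.sum {n} (λ i → ζ 𝕂.^ suc (toℕ i))

    step : 𝕂.1# 𝕂.+ Gζ 𝕂.≈ G 𝕂.+ ζ 𝕂.^ n
    step = 𝕂.trans (𝕂.+-congˡ (𝕂.sym (𝕂Σ.*-distribˡ-sum {n} ζ (λ i → ζ 𝕂.^ toℕ i)))) (geometric n)

  -- (ζ - 1) times the sum is ζ^p - 1 = 0, and primitivity gives ζ ≠ 1 because p > 1.
  ∑ζ≈0 : 𝕂Σ.sum {p} (λ i → ζ 𝕂.^ toℕ i) 𝕂.≈ 𝕂.0#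
  ∑ζ≈0 = HeytingFieldProperties.*-nonzeroˡ K {ζ 𝕂.- 𝕂.1#} {G} (begin
    (ζ 𝕂.- 𝕂.1#) 𝕂.* G ≈⟨ solve𝕂 3 (λ z o g → (z ⟨-⟩ o) ⟨*⟩ g ⟨=⟩ (o ⟨+⟩ z ⟨*⟩ g) ⟨-⟩ (o ⟨*⟩ g ⟨+⟩ o)) 𝕂.refl ζ 𝕂.1# G ⟩
    (𝕂.1# 𝕂.+ ζ 𝕂.* G) 𝕂.- (𝕂.1# 𝕂.* G 𝕂.+ 𝕂.1#) ≈⟨ 𝕂.+-cong (𝕂.trans (geometric p) (𝕂.+-congˡ (proj₁ ζ-primitive))) (𝕂.-‿cong (𝕂.+-congʳ (𝕂.*-identityˡ G))) ⟩
    (G 𝕂.+ 𝕂.1#) 𝕂.- (G 𝕂.+ 𝕂.1#) ≈⟨ 𝕂.-‿inverseʳ _ ⟩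
    𝕂.0# ∎)
    (λ ζ-1≈0 → proj₂ ζ-primitive 1 (ℕ.s≤s ℕ.z≤n) (prime>1 p-prime)
      (𝕂.trans (𝕂.*-identityʳ ζ) (RingProperties.x∙y⁻¹≈ε⇒x≈y 𝕂.ring ζ 𝕂.1# ζ-1≈0)))
    where
    open import Relation.Binary.Reasoning.Setoid 𝕂.setoid
    open IntegerImage.Solver 𝕂.commutativeRing using () renaming (solve to solve𝕂; _:=_ to _⟨=⟩_; _:+_ to _⟨+⟩_; _:*_ to _⟨*⟩_; _:-_ to _⟨-⟩_)
    G : 𝕂.Carrier
    G = 𝕂Σ.sum {p} (λ i → ζ 𝕂.^ toℕ i)

  -- The index i of the outer sum in `S` stands for y = i + 1; this adds the term y = 0, so that the
  -- sum runs over all of 𝔽p.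
  sum-peel : ∀ n → 0 ℕ.< n → (g : ℕ → 𝕂.Carrier) →
             𝕂Σ.sum {n} (λ i → g (toℕ i)) ≡ g 0 𝕂.+ 𝕂Σ.sum {n ℕ.∸ 1} (λ i → g (suc (toℕ i)))
  sum-peel (suc n) _ g = ≡.refl

  module _ {z : F.Carrier} {t : A} (z≈ : z F.≈ to t) (t∈ : t ∈𝔽p) where

    open import Relation.Binary.Reasoning.Setoid 𝕂.setoid

    private
      g : ℕ → 𝕂.Carrier
      g n = χ (F.fromℕ n F.* z)

      n·t≈ : ∀ n → F.fromℕ n F.* z F.≈ to (n · 1# * t)
      n·t≈ n = F.trans (F.*-cong (F.sym (to-·1 n)) z≈) (F.sym (to-* _ t))

      0ₚ : Fin p
      0ₚ = Fin.fromℕ< 0<p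

      χ-0 : ∀ {y} → y F.≈ F.0# → χ y ≡ 𝕂.1#
      χ-0 {y} y≈0 = cong (ζ 𝕂.^_) (≡.trans (residue-spec y 0ₚ (F.trans (F.reflexive (cong F.fromℕ (Fin.toℕ-fromℕ< 0<p))) (F.sym y≈0)))
                                          (Fin.toℕ-fromℕ< 0<p))

    characterSum-zero : t ≡ 0# → 𝕂Σ.sum {p ℕ.∸ 1} (λ i → χ (F.fromℕ (suc (toℕ i)) F.* z)) 𝕂.≈ 𝕂.fromℤ (+ p ℤ.- + 1)
    characterSum-zero t≡0 = begin
      𝕂Σ.sum {p ℕ.∸ 1} (λ i → g (suc (toℕ i)))
        ≈⟨ 𝕂Σ.sum-cong-≋ {p ℕ.∸ 1} (λ i → 𝕂.reflexive (χ-0 (F.trans (F.*-congˡ (F.trans z≈ (F.trans (to-≡ t≡0) (to-from _)))) (F.zeroʳ _)))) ⟩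
      𝕂Σ.sum {p ℕ.∸ 1} (λ _ → 𝕂.1#)
        ≈⟨ 𝕂Σ.sum-replicate (p ℕ.∸ 1) ⟩
      𝕂.fromℤ (+ (p ℕ.∸ 1))
        ≈⟨ fromℤ-≡ (≡.sym (≡.trans (ℤ.m-n≡m⊖n p 1) (ℤ.⊖-≥ 0<p))) ⟩
      𝕂.fromℤ (+ p ℤ.- + 1) ∎

    characterSum-nonzero : t ≢ 0# → 𝕂Σ.sum {p ℕ.∸ 1} (λ i → χ (F.fromℕ (suc (toℕ i)) F.* z)) 𝕂.≈ 𝕂.fromℤ (ℤ.- + 1)
    characterSum-nonzero t≢0 = begin
      Σ′ ≈⟨ solve𝕂 2 (λ s o → s ⟨=⟩ (o ⟨+⟩ s) ⟨-⟩ o) 𝕂.refl Σ′ 𝕂.1# ⟩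
      (𝕂.1# 𝕂.+ Σ′) 𝕂.- 𝕂.1# ≈⟨ 𝕂.+-congʳ total ⟩
      𝕂.0# 𝕂.- 𝕂.1# ≈⟨ 𝕂.+-identityˡ _ ⟩
      𝕂.- 𝕂.1# ≈⟨ 𝕂.-‿cong (𝕂.+-identityʳ _) ⟨
      𝕂.fromℤ (ℤ.- + 1) ∎
      where
      open IntegerImage.Solver 𝕂.commutativeRing using () renaming (solve to solve𝕂; _:=_ to _⟨=⟩_; _:+_ to _⟨+⟩_; _:-_ to _⟨-⟩_)
      Σ′ : 𝕂.Carrier
      Σ′ = 𝕂Σ.sum {p ℕ.∸ 1} (λ i → g (suc (toℕ i)))

      r : A
      r = proj₁ (inverse t t≢0)

      tr≡1 : t * r ≡ 1#
      tr≡1 = proj₂ (inverse t t≢0)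

      r∈ : r ∈𝔽p
      r∈ = inverse-∈𝔽p t≢0 t∈ tr≡1

      times : ∀ {s} → s ∈𝔽p → Fin p → Fin p
      times s∈ j = index (*-∈𝔽p (n·1∈𝔽p (toℕ j)) s∈)

      fp-times : ∀ {s} (s∈ : s ∈𝔽p) j → fp (times s∈ j) ≡ fp j * s
      fp-times s∈ j = fp-index (*-∈𝔽p (n·1∈𝔽p (toℕ j)) s∈)

      cancel : ∀ {s s′} (s∈ : s ∈𝔽p) (s′∈ : s′ ∈𝔽p) → s * s′ ≡ 1# → ∀ j → times s′∈ (times s∈ j) ≡ j
      cancel {s} {s′} s∈ s′∈ ss′≡1 j = fp-injective {times s′∈ (times s∈ j)} {j} (≡.trans (fp-times s′∈ (times s∈ j)) (≡.trans (cong (_* s′) (fp-times s∈ j))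
        (≡.trans (*-assoc (fp j) s s′) (≡.trans (cong (fp j *_) ss′≡1) (*-identityʳ (fp j))))))

      π : Permutation.Permutation′ p
      π = Permutation.permutation (times t∈) (times r∈) (cancel r∈ t∈ (≡.trans (*-comm r t) tr≡1)) (cancel t∈ r∈ tr≡1)

      total : 𝕂.1# 𝕂.+ Σ′ 𝕂.≈ 𝕂.0#
      total = begin
        𝕂.1# 𝕂.+ Σ′ ≡⟨ cong (𝕂._+ Σ′) (χ-0 (F.zeroˡ z)) ⟨
        g 0 𝕂.+ Σ′ ≡⟨ sum-peel p 0<p g ⟨
        𝕂Σ.sum {p} (λ i → g (toℕ i)) ≈⟨ 𝕂Σ.sum-cong-≋ {p} (λ i → 𝕂.reflexive (χ-index (*-∈𝔽p (n·1∈𝔽p (toℕ i)) t∈) (n·t≈ (toℕ i)))) ⟩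
        𝕂Σ.sum {p} (λ i → ζ 𝕂.^ toℕ (times t∈ i)) ≈⟨ 𝕂Σ.sum-permute (λ i → ζ 𝕂.^ toℕ i) π ⟨
        𝕂Σ.sum {p} (λ i → ζ 𝕂.^ toℕ i) ≈⟨ ∑ζ≈0 ⟩
        𝕂.0# ∎

    characterSum : 𝕂Σ.sum {p ℕ.∸ 1} (λ i → χ (F.fromℕ (suc (toℕ i)) F.* z)) 𝕂.≈ 𝕂.fromℤ (e t)
    characterSum = split (t ≟ 0#)
      where
      split : Dec (t ≡ 0#) → 𝕂Σ.sum {p ℕ.∸ 1} (λ i → χ (F.fromℕ (suc (toℕ i)) F.* z)) 𝕂.≈ 𝕂.fromℤ (e t)
      split (yes t≡0) = 𝕂.trans (characterSum-zero t≡0) (fromℤ-≡ (≡.sym (≡.trans (cong e t≡0) e-0)))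
      split (no t≢0)  = 𝕂.trans (characterSum-nonzero t≢0) (fromℤ-≡ (≡.sym (e-nonzero t≢0)))

  λ′ : A
  λ′ = fp u

  λ′∈ : λ′ ∈𝔽p
  λ′∈ = n·1∈𝔽p (toℕ u)

  λ′-nonsquare : ∀ s → s ∈𝔽p → s * s ≢ λ′
  λ′-nonsquare s s∈ ss≡λ′ = u-nonsquare (index s∈ , (begin
    F.fromℕ (toℕ (index s∈)) F.^ 2 ≈⟨ F-^-cong 2 (F.trans (F.sym (to-·1 (toℕ (index s∈)))) (to-≡ (fp-index s∈))) ⟩
    to s F.^ 2 ≈⟨ to-^ s 2 ⟨
    to (s * (s * 1#)) ≈⟨ to-≡ (≡.trans (cong (s *_) (*-identityʳ s)) ss≡λ′) ⟩
    to λ′ ≈⟨ to-·1 (toℕ u) ⟩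
    F.fromℕ (toℕ u) ∎))
    where open import Relation.Binary.Reasoning.Setoid F.setoid

  λ′≢0 : λ′ ≢ 0#
  λ′≢0 λ′≡0 = λ′-nonsquare 0# 0∈𝔽p (≡.trans (zeroˡ 0#) (≡.sym λ′≡0))

  square-to : ∀ n → to n F.^ 2 F.≈ to (n * n)
  square-to n = F.trans (F.sym (to-^ n 2)) (to-≡ (cong (n *_) (*-identityʳ n)))

  power-to : ∀ n → to n F.^ (p ℕ.^ k ℕ.+ 1) F.≈ to (n * σ n)
  power-to n = F.trans (F.sym (to-^ n (p ℕ.^ k ℕ.+ 1)))
    (to-≡ (≡.trans (^-homo-* n (p ℕ.^ k) 1) (≡.trans (cong (σ n *_) (*-identityʳ n)) (*-comm (σ n) n))))

  module _ (a b c : F.Carrier) where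

    private
      a′ b′ c′ : A
      a′ = from a
      b′ = from b
      c′ = from c

    firstTrace : ∀ n → Tr-F ((a F.+ b) F.* to n F.^ 2 F.+ c F.* to n F.^ (p ℕ.^ k ℕ.+ 1)) F.≈ to (Q (a′ + b′) c′ n)
    firstTrace n = Tr-F-to _ (begin
      (a F.+ b) F.* to n F.^ 2 F.+ c F.* to n F.^ (p ℕ.^ k ℕ.+ 1)
        ≈⟨ F.+-cong (F.*-cong (F.+-cong (F.sym (to-from a)) (F.sym (to-from b))) (square-to n)) (F.*-cong (F.sym (to-from c)) (power-to n)) ⟩
      (to a′ F.+ to b′) F.* to (n * n) F.+ to c′ F.* to (n * σ n)
        ≈⟨ F.+-cong (F.trans (F.*-congʳ (F.sym (to-+ a′ b′))) (F.sym (to-* (a′ + b′) (n * n)))) (F.sym (to-* c′ (n * σ n))) ⟩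
      to ((a′ + b′) * (n * n)) F.+ to (c′ * (n * σ n))
        ≈⟨ to-+ _ _ ⟨
      to ((a′ + b′) * (n * n) + c′ * (n * σ n)) ∎)
      where open import Relation.Binary.Reasoning.Setoid F.setoid

    -- λ lies in 𝔽p, so it comes out of the trace as a nonzero factor, which `e-scale` then removes.
    -- This reduces the second summand of `S` to the form Q of the first.
    secondTrace : ∀ n → Tr-F ((a F.- b) F.* λ₀ F.* to n F.^ 2 F.+ c F.* λ₀ F.* to n F.^ (p ℕ.^ k ℕ.+ 1)) F.≈ to (λ′ * Q (a′ - b′) c′ n)
    secondTrace n = F.trans (Tr-F-to _ (begin
      (a F.- b) F.* λ₀ F.* to n F.^ 2 F.+ c F.* λ₀ F.* to n F.^ (p ℕ.^ k ℕ.+ 1)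
        ≈⟨ F.+-cong (F.*-cong (F.*-cong a-b≈ λ₀≈) (square-to n)) (F.*-cong (F.*-cong (F.sym (to-from c)) λ₀≈) (power-to n)) ⟩
      to (a′ - b′) F.* to λ′ F.* to (n * n) F.+ to c′ F.* to λ′ F.* to (n * σ n)
        ≈⟨ F.+-cong (F.trans (F.*-congʳ (F.sym (to-* _ _))) (F.sym (to-* _ _))) (F.trans (F.*-congʳ (F.sym (to-* _ _))) (F.sym (to-* _ _))) ⟩
      to ((a′ - b′) * λ′ * (n * n)) F.+ to (c′ * λ′ * (n * σ n))
        ≈⟨ to-+ _ _ ⟨
      to ((a′ - b′) * λ′ * (n * n) + c′ * λ′ * (n * σ n))
        ≈⟨ to-≡ (solve 5 (λ a l n c s → a :* l :* (n :* n) :+ c :* l :* (n :* s) := l :* (a :* (n :* n) :+ c :* (n :* s))) ≡.refl (a′ - b′) λ′ n c′ (σ n)) ⟩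
      to (λ′ * ((a′ - b′) * (n * n) + c′ * (n * σ n))) ∎)) (to-≡ (Tr-scale λ′∈ _))
      where
      open import Relation.Binary.Reasoning.Setoid F.setoid

      λ₀≈ : λ₀ F.≈ to λ′
      λ₀≈ = F.sym (to-·1 (toℕ u))

      a-b≈ : a F.- b F.≈ to (a′ - b′)
      a-b≈ = F.trans (F.+-cong (F.sym (to-from a)) (F.trans (F.-‿cong (F.sym (to-from b))) (F.sym (to-neg b′)))) (F.sym (to-+ a′ (- b′)))

    S-value : S (a , b , c) 𝕂.≈ 𝕂.fromℤ (T (a′ + b′) c′ ℤ.+ T (a′ - b′) c′)
    S-value = begin
      S (a , b , c)
        ≈⟨ 𝕂Σ.∑-comm {p ℕ.∸ 1} {p ℕ.^ m} (λ i n → χ₁ n i 𝕂.+ χ₂ n i) ⟩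
      𝕂Σ.sum {p ℕ.^ m} (λ n → 𝕂Σ.sum {p ℕ.∸ 1} (λ i → χ₁ n i 𝕂.+ χ₂ n i))
        ≈⟨ 𝕂Σ.sum-cong-≋ {p ℕ.^ m} (λ n → 𝕂.trans (𝕂Σ.∑-distrib-+ {p ℕ.∸ 1} (χ₁ n) (χ₂ n)) (𝕂.+-cong
             (characterSum (firstTrace n) (Q∈𝔽p (a′ + b′) c′ n))
             (𝕂.trans (characterSum (secondTrace n) (*-∈𝔽p λ′∈ (Q∈𝔽p (a′ - b′) c′ n))) (fromℤ-≡ (e-scale λ′≢0 (Q (a′ - b′) c′ n)))))) ⟩
      𝕂Σ.sum {p ℕ.^ m} (λ n → 𝕂.fromℤ (e (Q (a′ + b′) c′ n)) 𝕂.+ 𝕂.fromℤ (e (Q (a′ - b′) c′ n)))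
        ≈⟨ 𝕂Σ.∑-distrib-+ {p ℕ.^ m} (λ n → 𝕂.fromℤ (e (Q (a′ + b′) c′ n))) (λ n → 𝕂.fromℤ (e (Q (a′ - b′) c′ n))) ⟩
      𝕂Σ.sum {p ℕ.^ m} (λ n → 𝕂.fromℤ (e (Q (a′ + b′) c′ n))) 𝕂.+ 𝕂Σ.sum {p ℕ.^ m} (λ n → 𝕂.fromℤ (e (Q (a′ - b′) c′ n)))
        ≈⟨ 𝕂.+-cong (fromℤ-sum (λ n → e (Q (a′ + b′) c′ n))) (fromℤ-sum (λ n → e (Q (a′ - b′) c′ n))) ⟨
      𝕂.fromℤ (T (a′ + b′) c′) 𝕂.+ 𝕂.fromℤ (T (a′ - b′) c′)
        ≈⟨ fromℤ-+ (T (a′ + b′) c′) (T (a′ - b′) c′) ⟨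
      𝕂.fromℤ (T (a′ + b′) c′ ℤ.+ T (a′ - b′) c′) ∎
      where
      open import Relation.Binary.Reasoning.Setoid 𝕂.setoid

      χ₁ χ₂ : Fin (p ℕ.^ m) → Fin (p ℕ.∸ 1) → 𝕂.Carrier
      χ₁ n i = χ (F.fromℕ (suc (toℕ i)) F.* Tr-F ((a F.+ b) F.* to n F.^ 2 F.+ c F.* to n F.^ (p ℕ.^ k ℕ.+ 1)))
      χ₂ n i = χ (F.fromℕ (suc (toℕ i)) F.* Tr-F ((a F.- b) F.* λ₀ F.* to n F.^ 2 F.+ c F.* λ₀ F.* to n F.^ (p ℕ.^ k ℕ.+ 1)))

-- Counting with lists of triples

module ListCounting where

  open IntegerSums
  open ≡-Reasoning

  private
    variable
      a b : Level
      X Y : Set a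

  listSum : (X → ℤ) → List X → ℤ
  listSum f []       = + 0
  listSum f (x ∷ xs) = f x ℤ.+ listSum f xs

  listSum-++ : ∀ (f : X → ℤ) xs ys → listSum f (xs List.++ ys) ≡ listSum f xs ℤ.+ listSum f ys
  listSum-++ f []       ys = ≡.sym (ℤ.+-identityˡ _)
  listSum-++ f (x ∷ xs) ys = ≡.trans (cong (λ z → f x ℤ.+ z) (listSum-++ f xs ys)) (≡.sym (ℤ.+-assoc (f x) _ _))

  listSum-map : ∀ (f : Y → ℤ) (g : X → Y) xs → listSum f (List.map g xs) ≡ listSum (f ∘ g) xs
  listSum-map f g []       = ≡.refl
  listSum-map f g (x ∷ xs) = cong (λ z → f (g x) ℤ.+ z) (listSum-map f g xs)

  listSum-cartesianProduct : ∀ (f : X × Y → ℤ) xs ys →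
    listSum f (cartesianProduct xs ys) ≡ listSum (λ x → listSum (λ y → f (x , y)) ys) xs
  listSum-cartesianProduct f []       ys = ≡.refl
  listSum-cartesianProduct f (x ∷ xs) ys = ≡.trans
    (listSum-++ f (List.map (x ,_) ys) (cartesianProduct xs ys))
    (cong₂ ℤ._+_ (listSum-map f (x ,_) ys) (listSum-cartesianProduct f xs ys))

  listSum-tabulate : ∀ {n} (f : X → ℤ) (g : Fin n → X) → listSum f (List.tabulate g) ≡ ∑ (f ∘ g)
  listSum-tabulate {n = zero}  f g = ≡.sym (∑-empty (f ∘ g))
  listSum-tabulate {n = suc n} f g = ≡.trans (cong (λ z → f (g zero) ℤ.+ z) (listSum-tabulate f (g ∘ suc))) (≡.sym (∑-suc (f ∘ g)))

  length-filter : ∀ {P : X → Set b} (P? : Decidable P) xs → + length (filter P? xs) ≡ listSum (λ x → 𝟙 (P? x)) xs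
  length-filter P? []       = ≡.refl
  length-filter P? (x ∷ xs) with P? x
  ... | yes _ = cong (λ z → + 1 ℤ.+ z) (length-filter P? xs)
  ... | no _  = ≡.trans (length-filter P? xs) (≡.sym (ℤ.+-identityˡ _))

  triples : ∀ n → List (Fin n × Fin n × Fin n)
  triples n = cartesianProduct (allFin n) (cartesianProduct (allFin n) (allFin n))

  triples-unique : ∀ n → Unique (triples n)
  triples-unique n = cartesianProduct⁺ (allFin⁺ n) (cartesianProduct⁺ (allFin⁺ n) (allFin⁺ n))

  listSum-triples : ∀ {n} (f : Fin n × Fin n × Fin n → ℤ) →
                    listSum f (triples n) ≡ ∑ (λ x → ∑ (λ y → ∑ (λ z → f (x , y , z))))
  listSum-triples {n} f = begin
    listSum f (triples n)
      ≡⟨ listSum-cartesianProduct f (allFin n) (cartesianProduct (allFin n) (allFin n)) ⟩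
    listSum (λ x → listSum (λ yz → f (x , yz)) (cartesianProduct (allFin n) (allFin n))) (allFin n)
      ≡⟨ listSum-tabulate (λ x → listSum (λ yz → f (x , yz)) (cartesianProduct (allFin n) (allFin n))) id ⟩
    ∑ (λ x → listSum (λ yz → f (x , yz)) (cartesianProduct (allFin n) (allFin n)))
      ≡⟨ ∑-cong (λ x → listSum-cartesianProduct (λ yz → f (x , yz)) (allFin n) (allFin n)) ⟩
    ∑ (λ x → listSum (λ y → listSum (λ z → f (x , y , z)) (allFin n)) (allFin n))
      ≡⟨ ∑-cong (λ x → listSum-tabulate (λ y → listSum (λ z → f (x , y , z)) (allFin n)) id) ⟩
    ∑ (λ x → ∑ (λ y → listSum (λ z → f (x , y , z)) (allFin n)))
      ≡⟨ ∑-cong (λ x → ∑-cong (λ y → listSum-tabulate (λ z → f (x , y , z)) id)) ⟩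
    ∑ (λ x → ∑ (λ y → ∑ (λ z → f (x , y , z)))) ∎

-- Values and frequencies of S on triples of the original field

module ValueDistribution {ℓ₀ ℓ₁ ℓ₂ ℓ₀′ ℓ₁′ ℓ₂′} {p m : ℕ} (p-prime : Prime p) (2<p : 2 ℕ.< p) (h : ℕ) (m≡2h+1 : m ≡ h ℕ.* 2 ℕ.+ 1) (0<m : 0 ℕ.< m) (0<h : 0 ℕ.< h)
                  (k : ℕ) (gcd≡1 : gcd m k ≡ 1) (F : FiniteField ℓ₀ ℓ₁ ℓ₂ (p ℕ.^ m)) (1<q : 1 ℕ.< p ℕ.^ m)
                  (u : Fin p) (u-nonsquare : FiniteFieldNotions.IsNonsquareIn𝔽p p m F u)
                  (K : HeytingField ℓ₀′ ℓ₁′ ℓ₂′) (char0 : FieldNotions.CharacteristicZero K)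
                  (ζ : HeytingField.Carrier K) (ζ-primitive : FieldNotions.IsPrimitiveRoot K p ζ) where

  open Evaluation p-prime 2<p h m≡2h+1 0<m 0<h k gcd≡1 F 1<q u u-nonsquare K ζ ζ-primitive
  open Distribution λ′ λ′∈ λ′-nonsquare
  open ExponentialSum p m k F u K ζ using (Triples; TakesValue)
  open ListCounting

  private
    module F = FiniteField F
    module 𝕂 = FieldNotions K
    module Triples = Setoid Triples
  open HeytingFieldProperties K using (fromℤ-≡; fromℤ-injective)

  toTriple : A × A × A → Triples.Carrier
  toTriple (a , b , c) = to a , to b , to c

  fromTriple : Triples.Carrier → A × A × A
  fromTriple (a , b , c) = from a , from b , from c

  to-fromTriple : ∀ t → toTriple (fromTriple t) Triples.≈ t
  to-fromTriple (a , b , c) = to-from a , to-from b , to-from c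

  fromTriple-cong : ∀ {t t′} → t Triples.≈ t′ → fromTriple t ≡ fromTriple t′
  fromTriple-cong (a≈ , b≈ , c≈) = cong₂ _,_ (from-cong a≈) (cong₂ _,_ (from-cong b≈) (from-cong c≈))

  from-toTriple : ∀ t → fromTriple (toTriple t) ≡ t
  from-toTriple (a , b , c) = cong₂ _,_ (from-to a) (cong₂ _,_ (from-to b) (from-to c))

  toTriple-injective : ∀ {t t′} → toTriple t Triples.≈ toTriple t′ → t ≡ t′
  toTriple-injective {t} {t′} eq = ≡.trans (≡.sym (from-toTriple t)) (≡.trans (fromTriple-cong eq) (from-toTriple t′))

  value : A × A × A → ℤ
  value (a , b , c) = T (a + b) c ℤ.+ T (a - b) c

  S≈value : ∀ t → S t 𝕂.≈ 𝕂.fromℤ (value (fromTriple t))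
  S≈value (a , b , c) = S-value a b c

  -- In characteristic zero an equation between integers in K can be read back in ℤ, which makes it
  -- decidable and allows the solutions to be filtered from a list.
  takesValue⇔ : ∀ v t → TakesValue v t ⇔ value (fromTriple t) ≡ v
  takesValue⇔ v t = mk⇔
    (λ St≈v → fromℤ-injective char0 _ v (𝕂.trans (𝕂.sym (S≈value t)) St≈v))
    (λ eq → 𝕂.trans (S≈value t) (fromℤ-≡ eq))

  takesListedValue : ∀ t → Any (λ vf → TakesValue (proj₁ vf) t) (distribution p m)
  takesListedValue t@(a , b , c) = Any.map (λ {vf} → Equivalence.from (takesValue⇔ (proj₁ vf) t))
    (listed (from a + from b) (from a - from b) (from c))

  value? : ∀ v → Decidable (λ t → value t ≡ v)
  value? v t = value t ℤ.≟ v

  solutions : ℤ → List Triples.Carrier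
  solutions v = List.map toTriple (filter (value? v) (triples (p ℕ.^ m)))

  solutions-length : ∀ v → + length (solutions v) ≡ frequency v
  solutions-length v = ≡.trans (cong (λ n → + n) (length-map toTriple (filter (value? v) (triples (p ℕ.^ m)))))
    (≡.trans (length-filter (value? v) (triples (p ℕ.^ m))) (listSum-triples (λ t → 𝟙 (value? v t))))

  solutions-cardinality : ∀ v → HasCardinality Triples (TakesValue v) (length (solutions v))
  solutions-cardinality v =
    solutions v ,
    map⁺ (≡.setoid (A × A × A)) Triples toTriple-injective (filter⁺ (value? v) (triples-unique (p ℕ.^ m))) ,
    (λ t → mk⇔ (sound t) (complete t)) ,
    ≡.refl
    where
    open import Data.List.Membership.Setoid Triples using (_∈_)

    sound : ∀ t → t ∈ solutions v → TakesValue v t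
    sound t t∈ =
      let (s , s∈ , t≈s) = ∈-map⁻ (≡.setoid (A × A × A)) Triples t∈
          (_ , value≡v) = ∈-filter⁻ (value? v) {xs = triples (p ℕ.^ m)} s∈
      in Equivalence.from (takesValue⇔ v t)
           (≡.trans (cong value (≡.trans (fromTriple-cong t≈s) (from-toTriple s))) value≡v)

    complete : ∀ t → TakesValue v t → t ∈ solutions v
    complete t St≈v = ∈-resp-≈ Triples (to-fromTriple t)
      (∈-map⁺ (≡.setoid (A × A × A)) Triples (λ { ≡.refl → Triples.refl })
        (∈-filter⁺ (value? v) (everyTriple (fromTriple t)) (Equivalence.to (takesValue⇔ v t) St≈v)))
      where
      everyTriple : ∀ t → Any (t ≡_) (triples (p ℕ.^ m))
      everyTriple (a , b , c) = ∈-cartesianProduct⁺ (∈-allFin a) (∈-cartesianProduct⁺ (∈-allFin b) (∈-allFin c))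

  frequencies : All (λ vf → HasFrequency Triples (TakesValue (proj₁ vf)) (proj₂ vf)) (distribution p m)
  frequencies = All.map (λ {vf} freq≡ →
    length (solutions (proj₁ vf)) , solutions-cardinality (proj₁ vf) ,
    ≡.trans (cong IntegersInRationals.ι (solutions-length (proj₁ vf))) freq≡) table

odd⇒2h+1 : ∀ m → 2 ∤ m → ∃[ h ] m ≡ h ℕ.* 2 ℕ.+ 1
odd⇒2h+1 m 2∤m with m % 2 | m≡m%n+[m/n]*n m 2 | m%n<n m 2
... | 0           | m≡ | _                  = contradiction (ℕ.divides (m / 2) m≡) 2∤m
... | 1           | m≡ | _                  = m / 2 , ≡.trans m≡ (ℕ.+-comm 1 _)
... | suc (suc _) | m≡ | ℕ.s≤s (ℕ.s≤s ())

open import Data.Nat.Base using (_≤_; _^_)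

theorem3p5 :
    ∀ {c ℓ₁ ℓ₂ c′ ℓ₁′ ℓ₂′} (p m k : ℕ) →
    Prime p → 2 ∤ p →
    3 ≤ m → 2 ∤ m →
    1 ≤ k → 2 ∣ k →
    gcd m k ≡ 1 →
    (F : FiniteField c ℓ₁ ℓ₂ (p ^ m)) →
    (u : Fin p) → FiniteFieldNotions.IsNonsquareIn𝔽p p m F u →
    (K : HeytingField c′ ℓ₁′ ℓ₂′) → FieldNotions.CharacteristicZero K →
    (ζ : HeytingField.Carrier K) → FieldNotions.IsPrimitiveRoot K p ζ →
    (∀ t → Any (λ vf → ExponentialSum.TakesValue p m k F u K ζ (proj₁ vf) t)
               (distribution p m))
    ×
    All (λ vf → HasFrequency (ExponentialSum.Triples p m k F u K ζ)
                             (ExponentialSum.TakesValue p m k F u K ζ (proj₁ vf))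
                             (proj₂ vf))
        (distribution p m)
theorem3p5 p m k p-prime 2∤p 3≤m 2∤m _ _ gcd≡1 F u u-nonsquare K char0 ζ ζ-primitive =
  VD.takesListedValue , VD.frequencies
  where
  2<p : 2 ℕ.< p
  2<p = ℕ.≤∧≢⇒< (prime>1 p-prime) λ { ≡.refl → 2∤p ℕ.∣-refl }

  0<m : 0 ℕ.< m
  0<m = ℕ.≤-trans (ℕ.s≤s ℕ.z≤n) 3≤m

  h : ℕ
  h = proj₁ (odd⇒2h+1 m 2∤m)

  m≡2h+1 : m ≡ h ℕ.* 2 ℕ.+ 1
  m≡2h+1 = proj₂ (odd⇒2h+1 m 2∤m)

  0<h : 0 ℕ.< h
  0<h = positive h m≡2h+1
    where
    positive : ∀ h → m ≡ h ℕ.* 2 ℕ.+ 1 → 0 ℕ.< h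
    positive zero    m≡1 = contradiction (subst (3 ≤_) m≡1 3≤m) λ { (ℕ.s≤s ()) }
    positive (suc h) _   = ℕ.s≤s ℕ.z≤n

  1<q : 1 ℕ.< p ^ m
  1<q = ℕ.^-monoʳ-< p (prime>1 p-prime) 0<m

  module VD = ValueDistribution p-prime 2<p h m≡2h+1 0<m 0<h k gcd≡1 F 1<q u u-nonsquare K char0 ζ ζ-primitive
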